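{- For non-zero integers $a,b$ let $f_{a,b}:(0,\infty)\to(0,\infty)$, $f_{a,b}(z)=z^{a/b}$ (real positive branch), and let $I\subseteq(0,\infty)$ have non-empty interior. Then there exist uncountably many $\zeta\in\mathscr{L}\cap I$ such that, for all non-zero integers $a,b$, $f_{a,b}(\zeta)\in\mathscr{L}$ holds if and only if $a/b\in\mathbb{Z}$. In particular, for any fixed coprime non-zero integers $a,b$ with $|b|\geq2$, the set $f_{a,b}(\mathscr{L}\cap(0,\infty))\cap\mathscr{L}$ is uncountable but $f_{a,b}(\mathscr{L}\cap(0,\infty))\not\subseteq\mathscr{L}$.
   Context: $\mathscr{L}$ is the set of Liouville numbers (real irrational $\zeta$ such that for every $\eta>0$ there are infinitely many rationals $y/x$, $x\geq1$, with $|\zeta-y/x|\leq x^{ -\eta}$). -}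

module Defs where

open import Algebra.Bundles using (CommutativeRing)
import Algebra.Properties.CommutativeSemiring.Exp as Exp
open import Data.Empty using (⊥; ⊥-elim)
import Data.Integer as ℤ
import Data.Integer.Properties as ℤ
open import Data.List using (List)
open import Data.List.Membership.Propositional using (_∉_)
import Data.Nat as ℕ
import Data.Nat.Properties as ℕ
open import Data.Product using (Σ; Σ-syntax; ∃; ∃₂; _×_; _,_; proj₁; proj₂)
open import Data.Rational
open import Data.Rational.Properties
import Data.Rational.Solver as ℚSolver
import Data.Rational.Unnormalised as ℚᵘ
import Data.Rational.Unnormalised.Properties as ℚᵘ
import Data.Sign as Sign
open import Data.Sum using (_⊎_; inj₁; inj₂; [_,_]′)
open import Level using (Level; 0ℓ) renaming (suc to lsuc; _⊔_ to _⊔ˡ_)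
open import Relation.Binary.Definitions using (tri<; tri≈; tri>)
open import Relation.Binary.PropositionalEquality
open import Relation.Nullary using (¬_; Dec; yes; no)
open import Relation.Unary using (Pred; _⊆_)

open import Data.Nat using (ℕ; zero; suc)
open import Data.Integer using (ℤ; +_)
open Exp (CommutativeRing.commutativeSemiring +-*-commutativeRing) public
  using (_^_; ^-homo-*; ^-assocʳ; ^-distrib-*)
open ℚSolver.+-*-Solver using (solve; _:=_; _:+_; _:*_; _:-_; con)

private variable
  ℓ : Level
  p q r s t : ℚ

fromℕ : ℕ → ℚ
fromℕ n = + n / 1

fromℕ-suc : ∀ n → fromℕ (suc n) ≡ 1ℚ + fromℕ n
fromℕ-suc n = toℚᵘ-injective (ℚᵘ.≃-trans (toℚᵘ-fromℚᵘ (ℚᵘ.mkℚᵘ (+ suc n) 0))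
  (ℚᵘ.≃-sym (ℚᵘ.≃-trans (toℚᵘ-homo-+ 1ℚ (fromℕ n))
    (ℚᵘ.≃-trans (ℚᵘ.+-congʳ ℚᵘ.1ℚᵘ (toℚᵘ-fromℚᵘ (ℚᵘ.mkℚᵘ (+ n) 0)))
      (ℚᵘ.*≡* (cong (λ i → (+ 1 ℤ.+ i) ℤ.* + 1) (ℤ.*-identityʳ (+ n))))))))

/-mono-< : ∀ {i j : ℤ} {m n} → i ℤ.* + suc n ℤ.< j ℤ.* + suc m → i / suc m < j / suc n
/-mono-< {i} {j} {m} {n} h = toℚᵘ-cancel-<
  (ℚᵘ.<-respʳ-≃ (ℚᵘ.≃-sym (toℚᵘ-fromℚᵘ (ℚᵘ.mkℚᵘ j n)))
    (ℚᵘ.<-respˡ-≃ (ℚᵘ.≃-sym (toℚᵘ-fromℚᵘ (ℚᵘ.mkℚᵘ i m))) (ℚᵘ.*<* h)))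

/-cancel-< : ∀ {i j : ℤ} {m n} → i / suc m < j / suc n → i ℤ.* + suc n ℤ.< j ℤ.* + suc m
/-cancel-< {i} {j} {m} {n} h = ℚᵘ.drop-*<*
  (ℚᵘ.<-respʳ-≃ (toℚᵘ-fromℚᵘ (ℚᵘ.mkℚᵘ j n))
    (ℚᵘ.<-respˡ-≃ (toℚᵘ-fromℚᵘ (ℚᵘ.mkℚᵘ i m)) (toℚᵘ-mono-< h)))

0<1 : 0ℚ < 1ℚ
0<1 = positive⁻¹ 1ℚ

*-monoʳ-< : 0ℚ < r → p < q → r * p < r * q
*-monoʳ-< {r} 0<r = *-monoʳ-<-pos r {{positive 0<r}}

*-monoʳ-≤ : 0ℚ ≤ r → p ≤ q → r * p ≤ r * q
*-monoʳ-≤ {r} 0≤r = *-monoˡ-≤-nonNeg r {{nonNegative 0≤r}}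

*-monoˡ-< : 0ℚ < r → p < q → p * r < q * r
*-monoˡ-< {r} 0<r = *-monoˡ-<-pos r {{positive 0<r}}

*-monoˡ-≤ : 0ℚ ≤ r → p ≤ q → p * r ≤ q * r
*-monoˡ-≤ {r} 0≤r = *-monoʳ-≤-nonNeg r {{nonNegative 0≤r}}

*-cancelʳ-< : 0ℚ < r → p * r < q * r → p < q
*-cancelʳ-< {r} 0<r = *-cancelʳ-<-nonNeg r {{nonNegative (<⇒≤ 0<r)}}

0<* : 0ℚ < p → 0ℚ < q → 0ℚ < p * q
0<* {p} {q} 0<p 0<q = subst (_< p * q) (*-zeroʳ p) (*-monoʳ-< 0<p 0<q)

0≤* : 0ℚ ≤ p → 0ℚ ≤ q → 0ℚ ≤ p * q
0≤* {p} {q} 0≤p 0≤q = subst (_≤ p * q) (*-zeroʳ p) (*-monoʳ-≤ 0≤p 0≤q)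

0≤+ : 0ℚ ≤ p → 0ℚ ≤ q → 0ℚ ≤ p + q
0≤+ 0≤p 0≤q = +-mono-≤ 0≤p 0≤q

p<p+q : ∀ p → 0ℚ < q → p < p + q
p<p+q {q} p 0<q = subst (_< p + q) (+-identityʳ p) (+-monoʳ-< p 0<q)

p≤p+q : ∀ p → 0ℚ ≤ q → p ≤ p + q
p≤p+q {q} p 0≤q = subst (_≤ p + q) (+-identityʳ p) (+-monoʳ-≤ p 0≤q)

p-q<p : ∀ p → 0ℚ < q → p - q < p
p-q<p {q} p 0<q = subst (p - q <_) (+-identityʳ p) (+-monoʳ-< p (neg-antimono-< 0<q))

0<q-p : p < q → 0ℚ < q - p
0<q-p {p} {q} p<q = subst (_< q - p) (+-inverseʳ p) (+-monoˡ-< (- p) p<q)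

abstract
  divide : ∀ p → 0ℚ < q → Σ[ d ∈ ℚ ] d * q ≡ p
  divide {q} p 0<q = go {{pos⇒nonZero q {{positive 0<q}}}}
    where
    go : .{{_ : NonZero q}} → Σ[ d ∈ ℚ ] d * q ≡ p
    go = p * 1/ q ,
      trans (*-assoc p (1/ q) q) (trans (cong (p *_) (*-inverseˡ q)) (*-identityʳ p))

0<-divide : ∀ {d} → 0ℚ < p → 0ℚ < q → d * q ≡ p → 0ℚ < d
0<-divide {p} {q} {d} 0<p 0<q eq =
  *-cancelʳ-< 0<q (subst₂ _<_ (sym (*-zeroˡ q)) (sym eq) 0<p)

0≤fromℕ : ∀ n → 0ℚ ≤ fromℕ n
0≤fromℕ zero    = ≤-refl
0≤fromℕ (suc n) = subst (0ℚ ≤_) (sym (fromℕ-suc n)) (0≤+ (<⇒≤ 0<1) (0≤fromℕ n))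

1≤fromℕ : ∀ n .{{_ : ℕ.NonZero n}} → 1ℚ ≤ fromℕ n
1≤fromℕ (suc n) = subst (1ℚ ≤_) (sym (fromℕ-suc n)) (p≤p+q 1ℚ (0≤fromℕ n))

archimedean : ∀ q n → Σ[ k ∈ ℕ ] q < + k / suc n
archimedean q n = k , subst (_< + k / suc n) (↥p/↧p≡p q) (/-mono-< {↥ q} {+ k} h)
  where
  open ℤ.≤-Reasoning
  d = ↧ₙ q
  k = suc (ℤ.∣ ↥ q ∣ ℕ.* suc n)
  i≤∣i∣ : ∀ i → i ℤ.≤ + ℤ.∣ i ∣
  i≤∣i∣ (+ _)        = ℤ.≤-refl
  i≤∣i∣ (ℤ.-[1+ _ ]) = ℤ.-≤+
  h : ↥ q ℤ.* + suc n ℤ.< + k ℤ.* + d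
  h = begin-strict
    ↥ q ℤ.* + suc n          ≤⟨ ℤ.*-monoʳ-≤-nonNeg (+ suc n) (i≤∣i∣ (↥ q)) ⟩
    + ℤ.∣ ↥ q ∣ ℤ.* + suc n  ≡⟨ ℤ.pos-* ℤ.∣ ↥ q ∣ (suc n) ⟨
    + (ℤ.∣ ↥ q ∣ ℕ.* suc n)  <⟨ ℤ.+<+ (ℕ.n<1+n _) ⟩
    + k                      ≤⟨ ℤ.+≤+ (ℕ.m≤m*n k d) ⟩
    + (k ℕ.* d)              ≡⟨ ℤ.pos-* k d ⟩
    + k ℤ.* + d              ∎

archimedean* : ∀ p → 0ℚ < q → Σ[ k ∈ ℕ ] p < fromℕ k * q
archimedean* {q} p 0<q =
  let d , eq  = divide p 0<q
      k , d<k = archimedean d 0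
  in k , subst (_< fromℕ k * q) eq (*-monoˡ-< 0<q d<k)

0<^ : 0ℚ < q → ∀ n → 0ℚ < q ^ n
0<^ 0<q zero    = 0<1
0<^ 0<q (suc n) = 0<* 0<q (0<^ 0<q n)

0≤^ : 0ℚ ≤ q → ∀ n → 0ℚ ≤ q ^ n
0≤^ 0≤q zero    = <⇒≤ 0<1
0≤^ 0≤q (suc n) = 0≤* 0≤q (0≤^ 0≤q n)

^-mono-≤ : 0ℚ ≤ q → q ≤ r → ∀ n → q ^ n ≤ r ^ n
^-mono-≤ 0≤q q≤r zero    = ≤-refl
^-mono-≤ 0≤q q≤r (suc n) = ≤-trans (*-monoʳ-≤ 0≤q (^-mono-≤ 0≤q q≤r n))
                                   (*-monoˡ-≤ (0≤^ (≤-trans 0≤q q≤r) n) q≤r)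

^-mono-< : 0ℚ ≤ q → q < r → ∀ n .{{_ : ℕ.NonZero n}} → q ^ n < r ^ n
^-mono-< 0≤q q<r (suc n) = ≤-<-trans (*-monoʳ-≤ 0≤q (^-mono-≤ 0≤q (<⇒≤ q<r) n))
                                     (*-monoˡ-< (0<^ (≤-<-trans 0≤q q<r) n) q<r)

infix 4 _<⊎≥_
_<⊎≥_ : ∀ p q → p < q ⊎ q ≤ p
p <⊎≥ q with p <? q
... | yes p<q = inj₁ p<q
... | no  p≮q = inj₂ (≮⇒≥ p≮q)

^-cancel-< : 0ℚ ≤ r → ∀ n → q ^ n < r ^ n → q < r
^-cancel-< {r} {q} 0≤r n h with q <? r
... | yes q<r = q<r
... | no  q≮r = ⊥-elim (<-irrefl refl (<-≤-trans h (^-mono-≤ 0≤r (≮⇒≥ q≮r) n)))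

1≤^ : 1ℚ ≤ q → ∀ n → 1ℚ ≤ q ^ n
1≤^ 1≤q zero        = ≤-refl
1≤^ {q} 1≤q (suc n) = ≤-trans (subst (1ℚ ≤_) (sym (*-identityʳ q)) 1≤q)
  (*-monoʳ-≤ (≤-trans (<⇒≤ 0<1) 1≤q) (1≤^ 1≤q n))

^≤1 : 0ℚ ≤ q → q ≤ 1ℚ → ∀ n → q ^ n ≤ 1ℚ
^≤1 0≤q q≤1 zero    = ≤-refl
^≤1 {q} 0≤q q≤1 (suc n) = ≤-trans
  (subst (q * q ^ n ≤_) (*-identityʳ q) (*-monoʳ-≤ 0≤q (^≤1 0≤q q≤1 n))) q≤1

^-monoʳ-≤ : 1ℚ ≤ q → ∀ {m n} → m ℕ.≤ n → q ^ m ≤ q ^ n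
^-monoʳ-≤ {q} 1≤q {m} {n} m≤n = subst₂ _≤_ (*-identityʳ (q ^ m))
  (trans (sym (^-homo-* q m (n ℕ.∸ m))) (cong (q ^_) (ℕ.m+[n∸m]≡n m≤n)))
  (*-monoʳ-≤ (0≤^ (≤-trans (<⇒≤ 0<1) 1≤q) m) (1≤^ 1≤q (n ℕ.∸ m)))

bernoulli : 0ℚ ≤ q → ∀ {d} → 0ℚ ≤ d → ∀ n → q ^ n * (q + fromℕ n * d) ≤ (q + d) ^ n * q
bernoulli {q} 0≤q {d} 0≤d zero = ≤-reflexive
  (solve 2 (λ q d → con 1ℚ :* (q :+ con 0ℚ :* d) := con 1ℚ :* q) refl q d)
bernoulli {q} 0≤q {d} 0≤d (suc n) = begin
  q * q ^ n * (q + fromℕ (suc n) * d)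
    ≡⟨ cong (λ k → q * q ^ n * (q + k * d)) (fromℕ-suc n) ⟩
  q * q ^ n * (q + (1ℚ + k) * d)
    ≤⟨ p≤p+q _ (0≤* (0≤^ 0≤q n) (0≤* (0≤* (0≤fromℕ n) 0≤d) 0≤d)) ⟩
  q * q ^ n * (q + (1ℚ + k) * d) + q ^ n * (k * d * d)
    ≡⟨ solve 4 (λ q d k e → q :* e :* (q :+ (con 1ℚ :+ k) :* d) :+ e :* (k :* d :* d)
                         := (q :+ d) :* (e :* (q :+ k :* d))) refl q d k (q ^ n) ⟩
  (q + d) * (q ^ n * (q + k * d))
    ≤⟨ *-monoʳ-≤ (0≤+ 0≤q 0≤d) (bernoulli 0≤q 0≤d n) ⟩
  (q + d) * ((q + d) ^ n * q)
    ≡⟨ *-assoc (q + d) _ q ⟨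
  (q + d) * (q + d) ^ n * q ∎
  where open ≤-Reasoning ; k = fromℕ n

bernoulli⁻ : ∀ {d} → 0ℚ ≤ d → 0ℚ ≤ 1ℚ - d → 0ℚ ≤ r → ∀ n →
             r - d * (fromℕ n * r) ≤ (1ℚ - d) ^ n * r
bernoulli⁻ {r} {d} 0≤d 0≤e 0≤r zero = ≤-reflexive
  (solve 2 (λ r d → r :- d :* (con 0ℚ :* r) := con 1ℚ :* r) refl r d)
bernoulli⁻ {r} {d} 0≤d 0≤e 0≤r (suc n) = begin
  r - d * (fromℕ (suc n) * r)
    ≡⟨ cong (λ k → r - d * (k * r)) (fromℕ-suc n) ⟩
  r - d * ((1ℚ + k) * r)
    ≤⟨ p≤p+q _ (0≤* 0≤d (0≤* 0≤d (0≤* (0≤fromℕ n) 0≤r))) ⟩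
  r - d * ((1ℚ + k) * r) + d * (d * (k * r))
    ≡⟨ solve 3 (λ r d k → r :- d :* ((con 1ℚ :+ k) :* r) :+ d :* (d :* (k :* r))
                       := (con 1ℚ :- d) :* (r :- d :* (k :* r))) refl r d k ⟩
  (1ℚ - d) * (r - d * (k * r))
    ≤⟨ *-monoʳ-≤ 0≤e (bernoulli⁻ 0≤d 0≤e 0≤r n) ⟩
  (1ℚ - d) * ((1ℚ - d) ^ n * r)
    ≡⟨ *-assoc (1ℚ - d) _ r ⟨
  (1ℚ - d) * (1ℚ - d) ^ n * r ∎
  where open ≤-Reasoning ; k = fromℕ n

decay : ∀ {d} → 0ℚ ≤ d → 0ℚ ≤ 1ℚ - d → 0ℚ ≤ r → ∀ n →
        (1ℚ - d) ^ n * (r + d * (fromℕ n * r)) ≤ r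
decay {r} {d} 0≤d 0≤e 0≤r zero = ≤-reflexive
  (solve 2 (λ r d → con 1ℚ :* (r :+ d :* (con 0ℚ :* r)) := r) refl r d)
decay {r} {d} 0≤d 0≤e 0≤r (suc n) = begin
  (1ℚ - d) * e * (r + d * (fromℕ (suc n) * r))
    ≡⟨ cong (λ k → (1ℚ - d) * e * (r + d * (k * r))) (fromℕ-suc n) ⟩
  (1ℚ - d) * e * (r + d * ((1ℚ + k) * r))
    ≤⟨ p≤p+q _ (0≤* (0≤^ 0≤e n) (0≤* (0≤* 0≤d 0≤d) (0≤+ 0≤r (0≤* (0≤fromℕ n) 0≤r)))) ⟩
  (1ℚ - d) * e * (r + d * ((1ℚ + k) * r)) + e * (d * d * (r + k * r))
    ≡⟨ solve 4 (λ r d k e →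
         (con 1ℚ :- d) :* e :* (r :+ d :* ((con 1ℚ :+ k) :* r)) :+ e :* (d :* d :* (r :+ k :* r))
         := e :* (r :+ d :* (k :* r))) refl r d k e ⟩
  e * (r + d * (k * r))
    ≤⟨ decay 0≤d 0≤e 0≤r n ⟩
  r ∎
  where open ≤-Reasoning ; k = fromℕ n ; e = (1ℚ - d) ^ n

-- Multiplying a start value C by θ = 1 - d repeatedly, the n-th powers
-- shrink by a factor θ^n each time and so cannot jump over (q , r)
descend : ∀ n {θ} → 0ℚ < θ → q < θ ^ n * r → ∀ k C → 0ℚ < C → r ≤ C ^ n →
          (θ ^ k * C) ^ n < r → Σ[ c ∈ ℚ ] 0ℚ < c × q < c ^ n × c ^ n < r
descend {r = r} n _ _ zero C _ r≤ <r =
  ⊥-elim (<-irrefl refl (≤-<-trans r≤ (subst (λ x → x ^ n < r) (*-identityˡ C) <r)))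
descend {q = q} {r = r} n {θ} 0<θ q< (suc k) C 0<C r≤ <r =
  [ (λ h → θ * C , 0<* 0<θ 0<C ,
      subst (q <_) (sym (^-distrib-* θ C n))
        (<-≤-trans q< (*-monoʳ-≤ (0≤^ (<⇒≤ 0<θ) n) r≤)) , h)
  , (λ h → descend n 0<θ q< k (θ * C) (0<* 0<θ 0<C) h (subst (λ x → x ^ n < r)
      (solve 3 (λ t e c → t :* e :* c := e :* (t :* c)) refl θ (θ ^ k) C) <r))
  ]′ ((θ * C) ^ n <⊎≥ r)

ratio : ∀ n .{{_ : ℕ.NonZero n}} → 0ℚ ≤ q → q < r →
        Σ[ d ∈ ℚ ] 0ℚ < d × 0ℚ < 1ℚ - d × q < (1ℚ - d) ^ n * r
ratio {q} {r} n 0≤q q<r =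
  let k       = fromℕ n
      0<r     = ≤-<-trans 0≤q q<r
      0<kr    = 0<* (<-≤-trans 0<1 (1≤fromℕ n)) 0<r
      0<b     = +-mono-< 0<r 0<kr
      d , db≡ = divide (r - q) 0<b
      0<d     = 0<-divide (0<q-p q<r) 0<b db≡
      0<1-d   = 0<q-p {d} {1ℚ} (*-cancelʳ-< 0<b (d*b<b k d 0<kr db≡))
  in d , 0<d , 0<1-d , <-≤-trans (q<r-dkr k d (0<* 0<d 0<r) db≡)
                         (bernoulli⁻ (<⇒≤ 0<d) (<⇒≤ 0<1-d) (<⇒≤ 0<r) n)
  where
  open ≤-Reasoning
  lemma₁ : ∀ q d r k → q + d * r ≡ q + d * (r + k * r) - d * (k * r)
  lemma₁ = solve 4 (λ q d r k → q :+ d :* r := q :+ d :* (r :+ k :* r) :- d :* (k :* r)) refl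
  lemma₂ : ∀ q r x → q + (r - q) - x ≡ r - x
  lemma₂ = solve 3 (λ q r x → q :+ (r :- q) :- x := r :- x) refl
  d*b<b : ∀ k d → 0ℚ < k * r → d * (r + k * r) ≡ r - q → d * (r + k * r) < 1ℚ * (r + k * r)
  d*b<b k d 0<kr db≡ = begin-strict
    d * (r + k * r)   ≡⟨ db≡ ⟩
    r - q             ≤⟨ +-monoʳ-≤ r (neg-antimono-≤ 0≤q) ⟩
    r + 0ℚ            <⟨ +-monoʳ-< r 0<kr ⟩
    r + k * r         ≡⟨ *-identityˡ _ ⟨
    1ℚ * (r + k * r)  ∎
  q<r-dkr : ∀ k d → 0ℚ < d * r → d * (r + k * r) ≡ r - q → q < r - d * (k * r)
  q<r-dkr k d 0<dr db≡ = begin-strict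
    q                                 <⟨ p<p+q q 0<dr ⟩
    q + d * r                         ≡⟨ lemma₁ q d r k ⟩
    q + d * (r + k * r) - d * (k * r) ≡⟨ cong (λ x → q + x - d * (k * r)) db≡ ⟩
    q + (r - q) - d * (k * r)         ≡⟨ lemma₂ q r (d * (k * r)) ⟩
    r - d * (k * r)                   ∎

eventually-< : ∀ {d C} → 0ℚ < d → 0ℚ < 1ℚ - d → 0ℚ < r → Σ[ k ∈ ℕ ] (1ℚ - d) ^ k * C < r
eventually-< {r} {d} {C} 0<d 0<θ 0<r =
  let k , C< = archimedean* C (0<* 0<d 0<r) in
  k , <-≤-trans (*-monoʳ-< (0<^ 0<θ k) (<-≤-trans C< (≤-trans (p≤p+q _ (<⇒≤ 0<r))
                                                     (≤-reflexive (lemma (fromℕ k) d r)))))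
                (decay (<⇒≤ 0<d) (<⇒≤ 0<θ) (<⇒≤ 0<r) k)
  where
  lemma : ∀ k d r → k * (d * r) + r ≡ r + d * (k * r)
  lemma = solve 3 (λ k d r → k :* (d :* r) :+ r := r :+ d :* (k :* r)) refl

p≤p^ : 1ℚ ≤ p → ∀ n .{{_ : ℕ.NonZero n}} → p ≤ p ^ n
p≤p^ {p} 1≤p (suc n) = subst (_≤ p ^ suc n) (*-identityʳ p)
  (*-monoʳ-≤ (≤-trans (<⇒≤ 0<1) 1≤p) (1≤^ 1≤p n))

0^ : ∀ n .{{_ : ℕ.NonZero n}} → 0ℚ ^ n ≡ 0ℚ
0^ (suc n) = *-zeroˡ (0ℚ ^ n)

p^≤p : 0ℚ ≤ p → p ≤ 1ℚ → ∀ n .{{_ : ℕ.NonZero n}} → p ^ n ≤ p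
p^≤p {p} 0≤p p≤1 (suc n) = subst (p ^ suc n ≤_) (*-identityʳ p)
  (*-monoʳ-≤ 0≤p (^≤1 0≤p p≤1 n))

min1 : ∀ {r} → 0ℚ < r → Σ[ μ ∈ ℚ ] 0ℚ < μ × μ ≤ 1ℚ × μ ≤ r
min1 {r} 0<r with ≤-total 1ℚ r
... | inj₁ 1≤r = 1ℚ , 0<1 , ≤-refl , 1≤r
... | inj₂ r≤1 = r , 0<r , r≤1 , ≤-refl

abstract
  ^-dense : ∀ n .{{_ : ℕ.NonZero n}} → 0ℚ ≤ q → q < r →
            Σ[ c ∈ ℚ ] 0ℚ < c × q < c ^ n × c ^ n < r
  ^-dense {q} {r} n 0≤q q<r =
    let 0<r = ≤-<-trans 0≤q q<r
        d , 0<d , 0<θ , q<θ^n*r = ratio n 0≤q q<r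
        μ , 0<μ , μ≤1 , μ≤r = min1 0<r
        k , y<μ = eventually-< {d = d} {C = 1ℚ + r} 0<d 0<θ 0<μ
        0<C = +-mono-< 0<1 0<r
    in
    descend n 0<θ q<θ^n*r k (1ℚ + r) 0<C
      (≤-trans (subst (r ≤_) (+-comm r 1ℚ) (p≤p+q r (<⇒≤ 0<1)))
               (p≤p^ (p≤p+q 1ℚ (<⇒≤ 0<r)) n))
      (≤-<-trans (p^≤p (<⇒≤ (0<* (0<^ 0<θ k) 0<C)) (≤-trans (<⇒≤ y<μ) μ≤1) n)
                 (<-≤-trans y<μ μ≤r))

^*-below : ∀ n .{{_ : ℕ.NonZero n}} x → 0ℚ < x → 0ℚ ≤ q → q ^ n * x < 1ℚ →
           Σ[ c ∈ ℚ ] q < c × 0ℚ < c × c ^ n * x < 1ℚ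
^*-below {q} n x 0<x 0≤q h = let d , dx≡1 = divide 1ℚ 0<x in below d dx≡1
  where
  below : ∀ d → d * x ≡ 1ℚ → Σ[ c ∈ ℚ ] q < c × 0ℚ < c × c ^ n * x < 1ℚ
  below d dx≡1 =
    let q^n<d = *-cancelʳ-< {x} {q ^ n} {d} 0<x (subst (q ^ n * x <_) (sym dx≡1) h)
        c , 0<c , q^n<c^n , c^n<d = ^-dense n (0≤^ 0≤q n) q^n<d
    in c , ^-cancel-< (<⇒≤ 0<c) n q^n<c^n , 0<c ,
       subst (c ^ n * x <_) dx≡1 (*-monoˡ-< 0<x c^n<d)

^*-above : ∀ n .{{_ : ℕ.NonZero n}} x → 0ℚ < x → 0ℚ < q → 1ℚ < q ^ n * x →
           Σ[ c ∈ ℚ ] c < q × 0ℚ < c × 1ℚ < c ^ n * x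
^*-above {q} n x 0<x 0<q h = let d , dx≡1 = divide 1ℚ 0<x in above d dx≡1
  where
  above : ∀ d → d * x ≡ 1ℚ → Σ[ c ∈ ℚ ] c < q × 0ℚ < c × 1ℚ < c ^ n * x
  above d dx≡1 =
    let d<q^n = *-cancelʳ-< {x} {d} {q ^ n} 0<x (subst (_< q ^ n * x) (sym dx≡1) h)
        c , 0<c , d<c^n , c^n<q^n = ^-dense n (<⇒≤ (0<-divide 0<1 0<x dx≡1)) d<q^n
    in c , ^-cancel-< (<⇒≤ 0<q) n c^n<q^n , 0<c ,
       subst (_< c ^ n * x) dx≡1 (*-monoˡ-< 0<x d<c^n)

-- Real numbers: two-sided, located Dedekind cuts of ℚ, where  lower q
-- and  upper q  stand for  q < x  and  x < q

record ℝ : Set₁ where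
  field
    lower upper     : Pred ℚ 0ℓ
    lower-inhabited : ∃ lower
    upper-inhabited : ∃ upper
    lower-closed    : q < r → lower r → lower q
    upper-closed    : q < r → upper q → upper r
    lower-rounded   : lower q → ∃ λ r → q < r × lower r
    upper-rounded   : upper r → ∃ λ q → q < r × upper q
    disjoint        : ¬ (lower q × upper q)
    located         : q < r → lower q ⊎ upper r

  lower<upper : lower q → upper r → q < r
  lower<upper {q} {r} l u with <-cmp q r
  ... | tri< q<r _ _  = q<r
  ... | tri≈ _ refl _ = ⊥-elim (disjoint (l , u))
  ... | tri> _ _ r<q  = ⊥-elim (disjoint (l , upper-closed r<q u))

open ℝ public

infix 4 _≤ℝ_ _<ℝ_ _≈_

_≤ℝ_ _<ℝ_ _≈_ : ℝ → ℝ → Set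
x ≤ℝ y = lower x ⊆ lower y
x <ℝ y = ∃ λ q → upper x q × lower y q
x ≈ y  = x ≤ℝ y × y ≤ℝ x

fromℚ : ℚ → ℝ
fromℚ q = record
  { lower           = _< q
  ; upper           = q <_
  ; lower-inhabited = q - 1ℚ , p-q<p q 0<1
  ; upper-inhabited = q + 1ℚ , p<p+q q 0<1
  ; lower-closed    = <-trans
  ; upper-closed    = λ r<s q<r → <-trans q<r r<s
  ; lower-rounded   = λ r<q → let m , r<m , m<q = <-dense r<q in m , r<m , m<q
  ; upper-rounded   = λ q<r → let m , q<m , m<r = <-dense q<r in m , m<r , q<m
  ; disjoint        = λ (r<q , q<r) → <-asym r<q q<r
  ; located         = loc
  }
  where
  loc : r < s → r < q ⊎ q < s
  loc {r} r<s with r <? q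
  ... | yes r<q = inj₁ r<q
  ... | no  r≮q = inj₂ (≤-<-trans (≮⇒≥ r≮q) r<s)

Positiveℝ : Pred ℝ 0ℓ
Positiveℝ x = fromℚ 0ℚ <ℝ x

ℝ⁺ : Set₁
ℝ⁺ = Σ ℝ Positiveℝ

val : ℝ⁺ → ℝ
val = proj₁

lower-pos : ((x , _) : ℝ⁺) → Σ[ s ∈ ℚ ] 0ℚ < s × lower x s
lower-pos (x , s , 0<s , l) = s , 0<s , l

upper-pos : ((x , _) : ℝ⁺) → upper x t → 0ℚ < t
upper-pos (x , s , 0<s , l) u = <-trans 0<s (lower<upper x l u)

∣_-_∣ℝ : ℝ → ℚ → ℝ
∣ x - q ∣ℝ = record
  { lower           = λ r → r < 0ℚ ⊎ lower x (q + r) ⊎ upper x (q - r)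
  ; upper           = λ r → upper x (q + r) × lower x (q - r)
  ; lower-inhabited = - 1ℚ , inj₁ (negative⁻¹ (- 1ℚ))
  ; upper-inhabited = ub
  ; lower-closed    = lc
  ; upper-closed    = λ r<s (u , l) →
      upper-closed x (+-monoʳ-< q r<s) u ,
      lower-closed x (+-monoʳ-< q (neg-antimono-< r<s)) l
  ; lower-rounded   = lr
  ; upper-rounded   = ur
  ; disjoint        = λ (l , u) → dis l u
  ; located         = loc
  }
  where
  q+[r-q] : ∀ r → q + (r - q) ≡ r
  q+[r-q] r = solve 2 (λ q r → q :+ (r :- q) := r) refl q r
  q-[q-r] : ∀ r → q - (q - r) ≡ r
  q-[q-r] r = solve 2 (λ q r → q :- (q :- r) := r) refl q r
  move+ : q + r < s → r < s - q
  move+ {r} {s} h = subst (_< s - q) (solve 2 (λ q r → q :+ r :- q := r) refl q r) (+-monoˡ-< (- q) h)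
  move- : s < q - r → r < q - s
  move- {s} {r} h = subst (_< q - s) (q-[q-r] r) (+-monoʳ-< q (neg-antimono-< h))
  lc : r < s → (s < 0ℚ ⊎ lower x (q + s) ⊎ upper x (q - s)) → r < 0ℚ ⊎ lower x (q + r) ⊎ upper x (q - r)
  lc r<s (inj₁ s<0)      = inj₁ (<-trans r<s s<0)
  lc r<s (inj₂ (inj₁ l)) = inj₂ (inj₁ (lower-closed x (+-monoʳ-< q r<s) l))
  lc r<s (inj₂ (inj₂ u)) = inj₂ (inj₂ (upper-closed x (+-monoʳ-< q (neg-antimono-< r<s)) u))
  lr : (r < 0ℚ ⊎ lower x (q + r) ⊎ upper x (q - r)) →
       ∃ λ s → r < s × (s < 0ℚ ⊎ lower x (q + s) ⊎ upper x (q - s))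
  lr (inj₁ r<0) = let m , r<m , m<0 = <-dense r<0 in m , r<m , inj₁ m<0
  lr (inj₂ (inj₁ l)) = let s , q+r<s , l′ = lower-rounded x l in
    s - q , move+ q+r<s , inj₂ (inj₁ (subst (lower x) (sym (q+[r-q] s)) l′))
  lr (inj₂ (inj₂ u)) = let s , s<q-r , u′ = upper-rounded x u in
    q - s , move- s<q-r , inj₂ (inj₂ (subst (upper x) (sym (q-[q-r] s)) u′))
  0<r : upper x (q + r) → lower x (q - r) → 0ℚ < r
  0<r {r} u l with 0ℚ <? r
  ... | yes h = h
  ... | no ¬h = ⊥-elim (<-irrefl refl (<-≤-trans (lower<upper x l u) (+-monoʳ-≤ q
        (≤-trans (≮⇒≥ ¬h) (neg-antimono-≤ (≮⇒≥ ¬h))))))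
  dis : (r < 0ℚ ⊎ lower x (q + r) ⊎ upper x (q - r)) → upper x (q + r) × lower x (q - r) → ⊥
  dis (inj₁ r<0)      (u , l) = <-asym r<0 (0<r u l)
  dis (inj₂ (inj₁ l)) (u , _) = disjoint x (l , u)
  dis (inj₂ (inj₂ u)) (_ , l) = disjoint x (l , u)
  max : r < p → s < p → r ⊔ s < p
  max {r} {p} {s} r<p s<p with ⊔-sel r s
  ... | inj₁ e = subst (_< p) (sym e) r<p
  ... | inj₂ e = subst (_< p) (sym e) s<p
  upper-≤ : r ≤ s → upper x r → upper x s
  upper-≤ {r} {s} r≤s u =
    let r′ , r′<r , u′ = upper-rounded x u in upper-closed x (<-≤-trans r′<r r≤s) u′
  lower-≤ : r ≤ s → lower x s → lower x r
  lower-≤ {r} {s} r≤s l =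
    let s′ , s<s′ , l′ = lower-rounded x l in lower-closed x (≤-<-trans r≤s s<s′) l′
  within : upper x t → lower x s → (s′ : ℚ) → t - q ≤ s′ → q - s ≤ s′ →
           upper x (q + s′) × lower x (q - s′)
  within {t} {s} u l s′ h₁ h₂ =
    upper-≤ (subst (_≤ q + s′) (q+[r-q] t) (+-monoʳ-≤ q h₁)) u ,
    lower-≤ (subst (q - s′ ≤_) (q-[q-r] s) (+-monoʳ-≤ q (neg-antimono-≤ h₂))) l
  ub : ∃ λ r → upper x (q + r) × lower x (q - r)
  ub = let s , l = lower-inhabited x ; t , u = upper-inhabited x in
    (t - q) ⊔ (q - s) , within u l _ (p≤p⊔q (t - q) (q - s)) (p≤q⊔p (t - q) (q - s))
  ur : upper x (q + r) × lower x (q - r) → ∃ λ s → s < r × upper x (q + s) × lower x (q - s)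
  ur {r} (u , l) = let t , t<q+r , u′ = upper-rounded x u ; s , q-r<s , l′ = lower-rounded x l in
    (t - q) ⊔ (q - s) ,
    max (subst (t - q <_) (solve 2 (λ q r → q :+ r :- q := r) refl q r) (+-monoˡ-< (- q) t<q+r))
        (subst (q - s <_) (q-[q-r] r) (+-monoʳ-< q (neg-antimono-< q-r<s))) ,
    within u′ l′ _ (p≤p⊔q (t - q) (q - s)) (p≤q⊔p (t - q) (q - s))
  loc : r < s → (r < 0ℚ ⊎ lower x (q + r) ⊎ upper x (q - r)) ⊎ (upper x (q + s) × lower x (q - s))
  loc r<s =
    [ (λ l → inj₁ (inj₂ (inj₁ l)))
    , (λ u → [ (λ l → inj₂ (u , l)) , (λ u′ → inj₁ (inj₂ (inj₂ u′))) ]′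
        (located x (+-monoʳ-< q (neg-antimono-< r<s))))
    ]′ (located x (+-monoʳ-< q r<s))

inv : ℝ⁺ → ℝ⁺
inv z⁺@(z , _) = w , lr (proj₂ (lower-inhabited w))
  where
  0<-factor : 1ℚ < q * s → 0ℚ < s → 0ℚ < q
  0<-factor {q} {s} h 0<s = *-cancelʳ-< 0<s (subst (_< q * s) (sym (*-zeroˡ s)) (<-trans 0<1 h))
  Lw Uw : ℚ → Set
  Lw q = ∃ λ t → upper z t × q * t < 1ℚ
  Uw q = ∃ λ s → 0ℚ < s × lower z s × 1ℚ < q * s
  ui : ∃ Uw
  ui = let s , 0<s , l = lower-pos z⁺ ; d , ds≡1 = divide 1ℚ 0<s in
    d + 1ℚ , s , 0<s , l , subst (1ℚ <_)
      (trans (cong₂ _+_ (sym ds≡1) (sym (*-identityˡ s))) (sym (*-distribʳ-+ s d 1ℚ)))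
      (p<p+q 1ℚ 0<s)
  lr : Lw q → ∃ λ r → q < r × Lw r
  lr {q} (t , u , qt<1) =
    let 0<t = upper-pos z⁺ u ; m , qt<m , m<1 = <-dense qt<1 ; d , dt≡m = divide m 0<t in
    d , *-cancelʳ-< 0<t (subst (q * t <_) (sym dt≡m) qt<m) , t , u , subst (_< 1ℚ) (sym dt≡m) m<1
  ur : Uw q → ∃ λ r → r < q × Uw r
  ur {q} (s , 0<s , l , 1<qs) =
    let m , 1<m , m<qs = <-dense 1<qs ; d , ds≡m = divide m 0<s in
    d , *-cancelʳ-< 0<s (subst (_< q * s) (sym ds≡m) m<qs) , s , 0<s , l , subst (1ℚ <_) (sym ds≡m) 1<m
  loc⁺ : 0ℚ < q → q < r → Lw q ⊎ Uw r
  loc⁺ {q} {r} 0<q q<r =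
    let i , iq≡1 = divide 1ℚ 0<q
        j , jr≡1 = divide 1ℚ 0<r
        0<j = 0<-divide 0<1 0<r jr≡1
    in between i j iq≡1 jr≡1 0<j (*-cancelʳ-< {q} {j} {i} 0<q
         (subst (j * q <_) (trans jr≡1 (sym iq≡1)) (*-monoʳ-< 0<j q<r)))
    where
    0<r = <-trans 0<q q<r
    decide : ∀ {i j} s t → i * q ≡ 1ℚ → j * r ≡ 1ℚ → 0ℚ < j → j < s → s < t → t < i → Lw q ⊎ Uw r
    decide {i} {j} s t iq≡1 jr≡1 0<j j<s s<t t<i =
      [ (λ l → inj₂ (s , <-trans 0<j j<s , l ,
          subst₂ _<_ jr≡1 (*-comm s r) (*-monoˡ-< {r} {j} {s} 0<r j<s)))
      , (λ u → inj₁ (t , u ,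
          subst₂ _<_ (*-comm t q) iq≡1 (*-monoˡ-< {q} {t} {i} 0<q t<i)))
      ]′ (located z s<t)
    between : ∀ i j → i * q ≡ 1ℚ → j * r ≡ 1ℚ → 0ℚ < j → j < i → Lw q ⊎ Uw r
    between i j iq≡1 jr≡1 0<j j<i =
      let s , j<s , s<i = <-dense j<i
          t , s<t , t<i = <-dense s<i
      in decide {i} {j} s t iq≡1 jr≡1 0<j j<s s<t t<i
  loc : q < r → Lw q ⊎ Uw r
  loc {q} q<r =
    [ (λ 0<q → loc⁺ 0<q q<r)
    , (λ q≤0 → let t , u = upper-inhabited z in inj₁ (t , u , ≤-<-trans
        (subst (q * t ≤_) (*-zeroˡ t) (*-monoˡ-≤ (<⇒≤ (upper-pos z⁺ u)) q≤0)) 0<1))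
    ]′ (0ℚ <⊎≥ q)
  w : ℝ
  w = record
    { lower           = Lw
    ; upper           = Uw
    ; lower-inhabited = 0ℚ , let t , u = upper-inhabited z in
                        t , u , subst (_< 1ℚ) (sym (*-zeroˡ t)) 0<1
    ; upper-inhabited = ui
    ; lower-closed    = λ q<r (t , u , h) →
                        t , u , <-trans (*-monoˡ-< (upper-pos z⁺ u) q<r) h
    ; upper-closed    = λ q<r (s , 0<s , l , h) →
                        s , 0<s , l , <-trans h (*-monoˡ-< 0<s q<r)
    ; lower-rounded   = lr
    ; upper-rounded   = ur
    ; disjoint        = λ {q} ((t , u , qt<1) , (s , 0<s , l , 1<qs)) → <-asym qt<1
                        (<-trans 1<qs (*-monoʳ-< (0<-factor {q} {s} 1<qs 0<s) (lower<upper z l u)))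
    ; located         = loc
    }

-- z^(m/n), the positive n-th root of z^m: for a rational q ≥ 0 one has
-- q < z^(m/n) iff q^n < s^m for some rational 0 < s < z, and
-- z^(m/n) < q iff t^m < q^n for some rational t > z
pow : (m n : ℕ) .{{_ : ℕ.NonZero n}} → ℝ⁺ → ℝ⁺
pow m n z⁺@(z , _) = w , lr l₀
  where
  Lw Uw : ℚ → Set
  Lw q = q < 0ℚ ⊎ ∃ λ s → 0ℚ < s × lower z s × q ^ n < s ^ m
  Uw q = 0ℚ < q × ∃ λ t → upper z t × t ^ m < q ^ n
  l₀ : Lw 0ℚ
  l₀ = let s , 0<s , l = lower-pos z⁺ in
    inj₂ (s , 0<s , l , subst (_< s ^ m) (sym (0^ n)) (0<^ 0<s m))
  ui : ∃ Uw
  ui =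
    let t , u   = upper-inhabited z
        0<t^m   = 0<^ (upper-pos z⁺ u) m
        0<1+t^m = +-mono-< 0<1 0<t^m
    in
    1ℚ + t ^ m , 0<1+t^m , t , u , <-≤-trans
      (subst (t ^ m <_) (+-comm (t ^ m) 1ℚ) (p<p+q (t ^ m) 0<1))
      (p≤p^ (p≤p+q 1ℚ (<⇒≤ 0<t^m)) n)
  lc : q < r → Lw r → Lw q
  lc q<r (inj₁ r<0) = inj₁ (<-trans q<r r<0)
  lc {q} q<r (inj₂ (s , 0<s , l , h)) =
    [ inj₁
    , (λ 0≤q → inj₂ (s , 0<s , l , <-trans (^-mono-< 0≤q q<r n) h))
    ]′ (q <⊎≥ 0ℚ)
  lr⁻ : q < 0ℚ → ∃ λ r → q < r × Lw r
  lr⁻ q<0 = let m , q<m , m<0 = <-dense q<0 in m , q<m , inj₁ m<0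
  lr : Lw q → ∃ λ r → q < r × Lw r
  lr (inj₁ q<0) = lr⁻ q<0
  lr {q} (inj₂ (s , 0<s , l , h)) =
    [ lr⁻
    , (λ 0≤q → let c , 0<c , q^n<c^n , c^n<s^m = ^-dense n (0≤^ 0≤q n) h in
        c , ^-cancel-< (<⇒≤ 0<c) n q^n<c^n , inj₂ (s , 0<s , l , c^n<s^m))
    ]′ (q <⊎≥ 0ℚ)
  ur : Uw q → ∃ λ r → r < q × Uw r
  ur (0<q , t , u , h) =
    let c , 0<c , t^m<c^n , c^n<q^n = ^-dense n (0≤^ (<⇒≤ (upper-pos z⁺ u)) m) h in
    c , ^-cancel-< (<⇒≤ 0<q) n c^n<q^n , 0<c , t , u , t^m<c^n
  dis : Lw q → Uw q → ⊥
  dis (inj₁ q<0) (0<q , _) = <-asym q<0 0<q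
  dis (inj₂ (s , 0<s , l , h)) (_ , t , u , h′) = <-irrefl refl
    (<-≤-trans (<-trans h′ h) (^-mono-≤ (<⇒≤ 0<s) (<⇒≤ (lower<upper z l u)) m))
  loc-0 : m ≡ 0 → 0ℚ ≤ q → q < r → Lw q ⊎ Uw r
  loc-0 {q} {r} m≡0 0≤q q<r =
    [ (λ 1<r^n → let t , u = upper-inhabited z in
        inj₂ (≤-<-trans 0≤q q<r , t , u , subst (λ k → t ^ k < r ^ n) (sym m≡0) 1<r^n))
    , (λ r^n≤1 → let s , 0<s , l = lower-pos z⁺ in
        inj₁ (inj₂ (s , 0<s , l , subst (λ k → q ^ n < s ^ k) (sym m≡0)
          (<-≤-trans (^-mono-< 0≤q q<r n) r^n≤1))))
    ]′ (1ℚ <⊎≥ r ^ n)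
  loc-suc : .{{_ : ℕ.NonZero m}} → 0ℚ ≤ q → q < r → Lw q ⊎ Uw r
  loc-suc {q} {r} 0≤q q<r =
    let c , 0<c , q^n<c^m , c^m<r^n = ^-dense m (0≤^ 0≤q n) (^-mono-< 0≤q q<r n)
        d , 0<d , c^m<d^m , d^m<r^n = ^-dense m (0≤^ (<⇒≤ 0<c) m) c^m<r^n
    in decide c d 0<c 0<d q^n<c^m c^m<d^m d^m<r^n
    where
    decide : ∀ c d → 0ℚ < c → 0ℚ < d → q ^ n < c ^ m → c ^ m < d ^ m → d ^ m < r ^ n → Lw q ⊎ Uw r
    decide c d 0<c 0<d q^n<c^m c^m<d^m d^m<r^n =
      [ (λ l → inj₁ (inj₂ (c , 0<c , l , q^n<c^m)))
      , (λ u → inj₂ (≤-<-trans 0≤q q<r , d , u , d^m<r^n))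
      ]′ (located z (^-cancel-< (<⇒≤ 0<d) m c^m<d^m))
  loc⁺ : 0ℚ ≤ q → q < r → Lw q ⊎ Uw r
  loc⁺ = split (m ℕ.≟ 0)
    where
    split : Dec (m ≡ 0) → 0ℚ ≤ q → q < r → Lw q ⊎ Uw r
    split (yes m≡0) = loc-0 m≡0
    split (no  m≢0) = loc-suc {{ℕ.≢-nonZero m≢0}}
  loc : q < r → Lw q ⊎ Uw r
  loc {q} q<r = [ (λ q<0 → inj₁ (inj₁ q<0)) , (λ 0≤q → loc⁺ 0≤q q<r) ]′ (q <⊎≥ 0ℚ)
  w : ℝ
  w = record
    { lower           = Lw
    ; upper           = Uw
    ; lower-inhabited = 0ℚ , l₀
    ; upper-inhabited = ui
    ; lower-closed    = lc
    ; upper-closed    = λ q<r (0<q , t , u , h) →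
                        <-trans 0<q q<r , t , u , <-trans h (^-mono-< (<⇒≤ 0<q) q<r n)
    ; lower-rounded   = lr
    ; upper-rounded   = ur
    ; disjoint        = λ (l , u) → dis l u
    ; located         = loc
    }

-- f a b z = z^(a/b); the sign of a/b is the product of those of a and b
f : (a b : ℤ) .{{_ : ℤ.NonZero b}} → ℝ⁺ → ℝ⁺
f a b z with ℤ.sign a Sign.* ℤ.sign b
... | Sign.+ = pow ℤ.∣ a ∣ ℤ.∣ b ∣ z
... | Sign.- = inv (pow ℤ.∣ a ∣ ℤ.∣ b ∣ z)

-- x^(-η) for real η > 0 and an integer x ≥ 1, with supremum and infimum
-- taken over the rational exponents u = k/n: a rational q ≥ 0 satisfies
-- q < x^(-η) iff q < x^(-u), i.e. q^n x^k < 1, for some u > η, and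
-- x^(-η) < q iff x^(-u) < q, i.e. 1 < q^n x^k, for some 0 ≤ u < η
infixr 8 _^-_
_^-_ : (x : ℕ) .{{_ : ℕ.NonZero x}} → ℝ⁺ → ℝ
x ^- η⁺@(η , _) = record
  { lower           = Lw
  ; upper           = Uw
  ; lower-inhabited = - 1ℚ , inj₁ (negative⁻¹ (- 1ℚ))
  ; upper-inhabited = ui
  ; lower-closed    = lc
  ; upper-closed    = λ q<r (0<q , k , n , l , h) → <-trans 0<q q<r , k , n , l ,
                        <-trans h (*-monoˡ-< (0<X^ k) (^-mono-< (<⇒≤ 0<q) q<r (suc n)))
  ; lower-rounded   = lr
  ; upper-rounded   = ur
  ; disjoint        = λ (l , u) → dis l u
  ; located         = loc
  }
  where
  X = fromℕ x
  1≤X = 1≤fromℕ x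
  0<X : 0ℚ < X
  0<X = <-≤-trans 0<1 1≤X
  0<X^ : ∀ k → 0ℚ < X ^ k
  0<X^ = 0<^ 0<X
  Lw Uw : ℚ → Set
  Lw q = q < 0ℚ ⊎ ∃₂ λ k n → upper η (+ k / suc n) × q ^ suc n * X ^ k < 1ℚ
  Uw q = 0ℚ < q × ∃₂ λ k n → lower η (+ k / suc n) × 1ℚ < q ^ suc n * X ^ k
  0/1 : lower η (+ 0 / 1)
  0/1 = let s , 0<s , l = lower-pos η⁺ in lower-closed η 0<s l
  ui : ∃ Uw
  ui = 1ℚ + 1ℚ , +-mono-< 0<1 0<1 , 0 , 0 , 0/1 , p<p+q 1ℚ 0<1
  lc : q < r → Lw r → Lw q
  lc q<r (inj₁ r<0) = inj₁ (<-trans q<r r<0)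
  lc {q} q<r (inj₂ (k , n , u , h)) =
    [ inj₁
    , (λ 0≤q → inj₂ (k , n , u , <-trans (*-monoˡ-< (0<X^ k) (^-mono-< 0≤q q<r (suc n))) h))
    ]′ (q <⊎≥ 0ℚ)
  lr⁻ : q < 0ℚ → ∃ λ r → q < r × Lw r
  lr⁻ q<0 = let m , q<m , m<0 = <-dense q<0 in m , q<m , inj₁ m<0
  lr : Lw q → ∃ λ r → q < r × Lw r
  lr (inj₁ q<0) = lr⁻ q<0
  lr {q} (inj₂ (k , n , u , h)) =
    [ lr⁻
    , (λ 0≤q → let c , q<c , _ , h′ = ^*-below (suc n) (X ^ k) (0<X^ k) 0≤q h in
        c , q<c , inj₂ (k , n , u , h′))
    ]′ (q <⊎≥ 0ℚ)
  ur : Uw q → ∃ λ r → r < q × Uw r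
  ur (0<q , k , n , l , h) =
    let c , c<q , 0<c , h′ = ^*-above (suc n) (X ^ k) (0<X^ k) 0<q h in
    c , c<q , 0<c , k , n , l , h′
  raise : ∀ q k n m → (q ^ n * X ^ k) ^ m ≡ q ^ (n ℕ.* m) * X ^ (k ℕ.* m)
  raise q k n m = trans (^-distrib-* (q ^ n) (X ^ k) m) (cong₂ _*_ (^-assocʳ q n m) (^-assocʳ X k m))
  1^ : ∀ n → 1ℚ ^ n ≡ 1ℚ
  1^ zero    = refl
  1^ (suc n) = trans (*-identityˡ _) (1^ n)
  dis : Lw q → Uw q → ⊥
  dis (inj₁ q<0) (0<q , _) = <-asym q<0 0<q
  dis {q} (inj₂ (k , n , u , h)) (0<q , k′ , n′ , l , h′) = <-irrefl refl (begin-strict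
    1ℚ                                            ≡⟨ 1^ (suc n) ⟨
    1ℚ ^ suc n                                    <⟨ ^-mono-< (<⇒≤ 0<1) h′ (suc n) ⟩
    (q ^ suc n′ * X ^ k′) ^ suc n                 ≡⟨ raise q k′ (suc n′) (suc n) ⟩
    q ^ (suc n′ ℕ.* suc n) * X ^ (k′ ℕ.* suc n)   ≤⟨ *-monoʳ-≤ (0≤^ (<⇒≤ 0<q) (suc n′ ℕ.* suc n))
                                                       (^-monoʳ-≤ 1≤X (ℕ.<⇒≤ k′n<kn′)) ⟩
    q ^ (suc n′ ℕ.* suc n) * X ^ (k ℕ.* suc n′)   ≡⟨ cong (λ e → q ^ e * X ^ (k ℕ.* suc n′)) (ℕ.*-comm (suc n′) (suc n)) ⟩
    q ^ (suc n ℕ.* suc n′) * X ^ (k ℕ.* suc n′)   ≡⟨ raise q k (suc n) (suc n′) ⟨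
    (q ^ suc n * X ^ k) ^ suc n′                  <⟨ ^-mono-< (<⇒≤ (0<* (0<^ 0<q (suc n)) (0<X^ k))) h (suc n′) ⟩
    1ℚ ^ suc n′                                   ≡⟨ 1^ (suc n′) ⟩
    1ℚ                                            ∎)
    where
    open ≤-Reasoning
    k′n<kn′ : k′ ℕ.* suc n ℕ.< k ℕ.* suc n′
    k′n<kn′ = ℤ.drop‿+<+ (subst₂ ℤ._<_ (sym (ℤ.pos-* k′ (suc n))) (sym (ℤ.pos-* k (suc n′)))
      (/-cancel-< {+ k′} {+ k} (lower<upper η l u)))
  walk : ∀ n j k → lower η (+ k / suc n) → upper η (+ (k ℕ.+ j) / suc n) →
         ∃ λ k → lower η (+ k / suc n) × upper η (+ (2 ℕ.+ k) / suc n)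
  walk n zero k l u =
    ⊥-elim (disjoint η (l , subst (λ i → upper η (+ i / suc n)) (ℕ.+-identityʳ k) u))
  walk n (suc j) k l u =
    [ (λ l′ → walk n j (suc k) l′ (subst (λ i → upper η (+ i / suc n)) (ℕ.+-suc k j) u))
    , (λ u′ → k , l , u′)
    ]′ (located η (/-mono-< {+ suc k} {+ (2 ℕ.+ k)} {n} {n}
         (ℤ.*-monoʳ-<-pos (+ suc n) (ℤ.+<+ (ℕ.n<1+n (suc k))))))
  grid : ∀ n → ∃ λ k → lower η (+ k / suc n) × upper η (+ (2 ℕ.+ k) / suc n)
  grid n = let t , u = upper-inhabited η ; j , t<j = archimedean t n in
    walk n j 0 (subst (lower η) (sym (0/n≡0 (suc n))) 0/1) (upper-closed η t<j u)
  gap : 0ℚ < q → q < r → ∃ λ n → q ^ suc n * X ^ 2 < r ^ suc n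
  gap {q} {r} 0<q q<r = let n , h = archimedean* (X ^ 2 * q) 0<d in n , bound n h
    where
    open ≤-Reasoning
    d = r - q
    0<d = 0<q-p q<r
    lemma : ∀ q d k → k * d + (q + d) ≡ q + (1ℚ + k) * d
    lemma = solve 3 (λ q d k → k :* d :+ (q :+ d) := q :+ (con 1ℚ :+ k) :* d) refl
    step : ∀ n → fromℕ n * d + (q + d) ≡ q + fromℕ (suc n) * d
    step n = trans (lemma q d (fromℕ n)) (cong (λ k → q + k * d) (sym (fromℕ-suc n)))
    q+d≡r : q + d ≡ r
    q+d≡r = solve 2 (λ q r → q :+ (r :- q) := r) refl q r
    bound : ∀ n → X ^ 2 * q < fromℕ n * d → q ^ suc n * X ^ 2 < r ^ suc n
    bound n h = *-cancelʳ-< 0<q (begin-strict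
      q ^ N * X ^ 2 * q             ≡⟨ *-assoc (q ^ N) (X ^ 2) q ⟩
      q ^ N * (X ^ 2 * q)           <⟨ *-monoʳ-< (0<^ 0<q N) h ⟩
      q ^ N * (fromℕ n * d)         ≤⟨ *-monoʳ-≤ (0≤^ (<⇒≤ 0<q) N) (≤-trans
                                        (p≤p+q _ (0≤+ (<⇒≤ 0<q) (<⇒≤ 0<d))) (≤-reflexive (step n))) ⟩
      q ^ N * (q + fromℕ N * d)     ≤⟨ bernoulli (<⇒≤ 0<q) (<⇒≤ 0<d) N ⟩
      (q + d) ^ N * q               ≡⟨ cong (λ s → s ^ N * q) q+d≡r ⟩
      r ^ N * q                     ∎)
      where N = suc n
  loc⁺ : 0ℚ < q → q < r → Lw q ⊎ Uw r
  loc⁺ {q} {r} 0<q q<r = let n , g = gap 0<q q<r ; k , l , u = grid n in decide n k g l u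
    where
    open ≤-Reasoning
    shift : ∀ n k → q ^ suc n * X ^ 2 < r ^ suc n → q ^ suc n * X ^ (2 ℕ.+ k) < r ^ suc n * X ^ k
    shift n k g = begin-strict
      q ^ suc n * X ^ (2 ℕ.+ k)     ≡⟨ cong (q ^ suc n *_) (^-homo-* X 2 k) ⟩
      q ^ suc n * (X ^ 2 * X ^ k)   ≡⟨ *-assoc (q ^ suc n) (X ^ 2) (X ^ k) ⟨
      q ^ suc n * X ^ 2 * X ^ k     <⟨ *-monoˡ-< (0<X^ k) g ⟩
      r ^ suc n * X ^ k             ∎
    decide : ∀ n k → q ^ suc n * X ^ 2 < r ^ suc n →
             lower η (+ k / suc n) → upper η (+ (2 ℕ.+ k) / suc n) → Lw q ⊎ Uw r
    decide n k g l u =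
      [ (λ 1<rX → inj₂ (<-trans 0<q q<r , k , n , l , 1<rX))
      , (λ rX≤1 → inj₁ (inj₂ (2 ℕ.+ k , n , u , <-≤-trans (shift n k g) rX≤1)))
      ]′ (1ℚ <⊎≥ r ^ suc n * X ^ k)
  loc : q < r → Lw q ⊎ Uw r
  loc {q} q<r =
    [ (λ q<0 → inj₁ (inj₁ q<0))
    , (λ 0≤q → let p , q<p , p<r = <-dense q<r in
        [ (λ l → inj₁ (lc q<p l)) , inj₂ ]′ (loc⁺ (≤-<-trans 0≤q q<p) p<r))
    ]′ (q <⊎≥ 0ℚ)

Infinite : Pred ℚ 0ℓ → Set
Infinite P = (qs : List ℚ) → ∃ λ q → P q × q ∉ qs

-- No sequence of reals exhausts P; the witness form of "not countable"
Uncountable : Pred ℝ ℓ → Set (lsuc 0ℓ ⊔ˡ ℓ)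
Uncountable P = (s : ℕ → ℝ) → ∃ λ x → P x × ∀ n → ¬ x ≈ s n

Interior : Pred ℝ ℓ → Pred ℝ (lsuc 0ℓ ⊔ˡ ℓ)
Interior I x = ∃₂ λ c d → c <ℝ x × x <ℝ d × (∀ y → c <ℝ y → y <ℝ d → I y)

-- The image g(P ∩ (0,∞)), closed under equality of reals
Image⁺ : (ℝ⁺ → ℝ⁺) → Pred ℝ ℓ → Pred ℝ (lsuc 0ℓ ⊔ˡ ℓ)
Image⁺ g P y = ∃ λ z → P (val z) × y ≈ val (g z)

Irrational : Pred ℝ 0ℓ
Irrational ζ = ∀ q → ¬ ζ ≈ fromℚ q

-- Each rational y/x is taken in lowest terms, which gives the weakest
-- bound x^(-η) among its representations with x ≥ 1
𝓛 : Pred ℝ (lsuc 0ℓ)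
𝓛 ζ = Irrational ζ ×
  ((η : ℝ⁺) → Infinite λ q → ∣ ζ - q ∣ℝ ≤ℝ ↧ₙ q ^- η)

{-# OPTIONS --safe #-}

-- Let ζ = lim zₖ with zₖ = 2Pₖ/Qₖ, where Pₖ and Qₖ are odd, Qₖ₊₁ = Qₖ^(k+3) and
-- zₖ < ζ < zₖ + 10/Qₖ₊₁.  The fractions zₖ^m and zₖ^(-m) approximate ζ^m and ζ^(-m) so well
-- that these powers are Liouville numbers.  If ζ^(±m/n) is a Liouville number, then it has an
-- approximation y/x so good that, for a suitable k, both (y/x)^n and zₖ^(±m) are closer to
-- ζ^(±m) than half the distance two different fractions with their denominators must have.
-- Hence (y/x)^n = zₖ^(±m), and since 2 divides zₖ exactly once, n divides m.
-- At every step there are two choices for zₖ₊₁, which suffices to avoid a given sequence.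
module Submission where

import Data.Integer as ℤ
import Data.Integer.Coprimality as ℤ using (Coprime)
import Data.Integer.Divisibility.Signed as ℤ using (_∣_; ∣ᵤ⇒∣; ∣⇒∣ᵤ)
import Data.Integer.Properties as ℤ
import Data.Nat as ℕ
import Data.Nat.Coprimality as ℕ using (Coprime; coprime-divisor; recompute; sym)
import Data.Nat.Divisibility as ℕ
import Data.Nat.Properties as ℕ
import Data.Rational.Solver as ℚSolver
import Data.Rational.Unnormalised as ℚᵘ
import Data.Rational.Unnormalised.Properties as ℚᵘ
open import Data.Empty using (⊥; ⊥-elim)
open import Data.Integer using (ℤ)
open import Data.List using (List; []; _∷_; _++_; upTo; cartesianProductWith)
open import Data.List.Membership.Propositional using (_∈_; _∉_)
open import Data.List.Membership.Propositional.Properties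
  using (∈-++⁺ˡ; ∈-++⁺ʳ; ∈-cartesianProductWith⁺; ∈-upTo⁺)
open import Data.List.Relation.Unary.Any using (here; there)
open import Data.Nat using (ℕ; zero; suc)
open import Data.Product using (Σ-syntax; ∃; ∃₂; _×_; _,_; proj₁; proj₂)
open import Data.Sum using (_⊎_; inj₁; inj₂; [_,_]′)
open import Function using (_⇔_; mk⇔; module Equivalence)
open import Level using (0ℓ)
open import Relation.Binary.Definitions using (tri<; tri≈; tri>)
open import Relation.Binary.PropositionalEquality
open import Relation.Nullary using (¬_; yes; no)
open import Relation.Unary using (Pred; Decidable; _⊆_; _⊈_; _∩_; Satisfiable)

-- Liouville powers require the exponents k+3 to be unbounded, whereas a denominator x that comes
-- from outside must be matched with some Qₖ up to a bounded power. Both are possible because the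
-- relevant exponents differ only by the fixed m. The error of zₖ^(±m) is about Qₖ^(-k-3) and its
-- denominator about Qₖ^m, so zₖ^(±m) is close enough once xⁿ is below about Qₖ^(k+3-m). If this
-- still fails at k-1, then Qₖ₋₁^(k+2-m) is at most about xⁿ, and Qₖ = Qₖ₋₁^(k+2) is at most about
-- the square of xⁿ, since k+2 is at most twice k+2-m for k > 2m. For the image under z ↦ z^(±m/n),
-- the point ζ^(±n) is Liouville and is sent to ζ^m, so there it is ζ^m that has to avoid the given
-- sequence. No power of a real is ever manipulated: all estimates concern rational test points
-- raised to the n-th power.

-- The exponent of 2 in natural numbers.

module TwoAdic where

  open import Data.Nat
  open import Data.Nat.Properties
  open import Data.Nat.Divisibility
  open import Data.Nat.Induction using (<-rec)
  open import Data.Nat.Primality using (prime[2]; euclidsLemma)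
  open import Data.Nat.Tactic.RingSolver using (solve-∀)
  open ≡-Reasoning

  Odd : ℕ → Set
  Odd n = ¬ 2 ∣ n

  odd-* : ∀ {m n} → Odd m → Odd n → Odd (m * n)
  odd-* {m} {n} odd-m odd-n 2∣mn = [ odd-m , odd-n ]′ (euclidsLemma m n prime[2] 2∣mn)

  odd-1 : Odd 1
  odd-1 2∣1 with s≤s () ← ∣⇒≤ 2∣1

  odd-^ : ∀ {m} n → Odd m → Odd (m ^ n)
  odd-^ zero    odd-m = odd-1
  odd-^ {m} (suc n) odd-m = odd-* {m} {m ^ n} odd-m (odd-^ n odd-m)

  odd-+ : ∀ {m n} → Odd m → 2 ∣ n → Odd (m + n)
  odd-+ {m} {n} odd-m 2∣n 2∣m+n = odd-m (∣m+n∣m⇒∣n (subst (2 ∣_) (+-comm m n) 2∣m+n) 2∣n)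

  odd⇒0< : ∀ {n} → Odd n → 0 < n
  odd⇒0< {zero}  odd = ⊥-elim (odd (2 ∣0))
  odd⇒0< {suc n} odd = z<s

  2-adic : ∀ n → 0 < n → ∃₂ λ i a → n ≡ 2 ^ i * a × Odd a
  2-adic = <-rec _ step
    where
    step : ∀ n → (∀ {m} → m < n → 0 < m → ∃₂ λ i a → m ≡ 2 ^ i * a × Odd a) →
           0 < n → ∃₂ λ i a → n ≡ 2 ^ i * a × Odd a
    step n rec 0<n with 2 ∣? n
    ... | no odd = 0 , n , sym (+-identityʳ n) , odd
    ... | yes (divides zero eq) = ⊥-elim (<-irrefl (sym eq) 0<n)
    ... | yes (divides q@(suc _) eq) with rec (subst (q <_) (sym eq) (m<m*n q 2 ≤-refl)) z<s
    ...   | i , a , q≡ , odd = suc i , a , trans eq (trans (cong (_* 2) q≡) (rearrange (2 ^ i) a)) , odd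
      where
      rearrange : ∀ e a → e * a * 2 ≡ 2 * e * a
      rearrange = solve-∀

  2-adic-unique : ∀ i j {a b} → Odd a → Odd b → 2 ^ i * a ≡ 2 ^ j * b → i ≡ j
  2-adic-unique zero    zero    _ _ _ = refl
  2-adic-unique zero    (suc j) {a} {b} odd-a _ eq = ⊥-elim (odd-a (divides (2 ^ j * b)
    (trans (sym (+-identityʳ a)) (trans eq (trans (*-assoc 2 (2 ^ j) b) (*-comm 2 (2 ^ j * b)))))))
  2-adic-unique (suc i) zero    {a} {b} _ odd-b eq = ⊥-elim (odd-b (divides (2 ^ i * a)
    (trans (sym (+-identityʳ b)) (trans (sym eq) (trans (*-assoc 2 (2 ^ i) a) (*-comm 2 (2 ^ i * a)))))))
  2-adic-unique (suc i) (suc j) {a} {b} odd-a odd-b eq = cong suc (2-adic-unique i j odd-a odd-b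
    (*-cancelˡ-≡ (2 ^ i * a) (2 ^ j * b) 2 (trans (sym (*-assoc 2 (2 ^ i) a)) (trans eq (*-assoc 2 (2 ^ j) b)))))

  ^-distribʳ-* : ∀ a b n → (a * b) ^ n ≡ a ^ n * b ^ n
  ^-distribʳ-* a b zero = refl
  ^-distribʳ-* a b (suc n) = trans (cong (a * b *_) (^-distribʳ-* a b n)) (rearrange a b (a ^ n) (b ^ n))
    where
    rearrange : ∀ a b c d → a * b * (c * d) ≡ a * c * (b * d)
    rearrange = solve-∀

  -- With x = 2^j x′ and y = 2^i y′ for odd x′, y′, comparing the exponents of 2 on both sides gives
  -- i n = m + j n. The fraction y/x need not be in lowest terms.
  2-adic-power : ∀ {P Q} m n {x y} → Odd P → Odd Q → 0 < x → 0 < y →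
                 y ^ n * Q ^ m ≡ (2 * P) ^ m * x ^ n → n ∣ m
  2-adic-power {P} {Q} m n {x} {y} odd-P odd-Q 0<x 0<y eq with 2-adic x 0<x | 2-adic y 0<y
  ... | j , x′ , refl , odd-x′ | i , y′ , refl , odd-y′ =
    ∣m+n∣m⇒∣n (subst (n ∣_) (trans i*n≡m+j*n (+-comm m (j * n))) (n∣m*n i)) (n∣m*n j)
    where
    rearrange : ∀ a b c d → a * b * (c * d) ≡ a * c * (b * d)
    rearrange = solve-∀
    i*n≡m+j*n : i * n ≡ m + j * n
    i*n≡m+j*n = 2-adic-unique (i * n) (m + j * n)
      (odd-* (odd-^ n odd-y′) (odd-^ m odd-Q)) (odd-* (odd-^ m odd-P) (odd-^ n odd-x′)) (begin
      2 ^ (i * n) * (y′ ^ n * Q ^ m)   ≡⟨ *-assoc (2 ^ (i * n)) (y′ ^ n) (Q ^ m) ⟨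
      2 ^ (i * n) * y′ ^ n * Q ^ m     ≡⟨ cong (λ e → e * y′ ^ n * Q ^ m) (^-*-assoc 2 i n) ⟨
      (2 ^ i) ^ n * y′ ^ n * Q ^ m     ≡⟨ cong (_* Q ^ m) (^-distribʳ-* (2 ^ i) y′ n) ⟨
      (2 ^ i * y′) ^ n * Q ^ m         ≡⟨ eq ⟩
      (2 * P) ^ m * (2 ^ j * x′) ^ n
        ≡⟨ cong₂ _*_ (^-distribʳ-* 2 P m) (^-distribʳ-* (2 ^ j) x′ n) ⟩
      2 ^ m * P ^ m * ((2 ^ j) ^ n * x′ ^ n)
        ≡⟨ cong (λ e → 2 ^ m * P ^ m * (e * x′ ^ n)) (^-*-assoc 2 j n) ⟩
      2 ^ m * P ^ m * (2 ^ (j * n) * x′ ^ n)   ≡⟨ rearrange (2 ^ m) (P ^ m) (2 ^ (j * n)) (x′ ^ n) ⟩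
      2 ^ m * 2 ^ (j * n) * (P ^ m * x′ ^ n)   ≡⟨ cong (_* (P ^ m * x′ ^ n)) (^-distribˡ-+-* 2 m (j * n)) ⟨
      2 ^ (m + j * n) * (P ^ m * x′ ^ n)       ∎)

open import Defs

-- Powers of rationals and distances between fractions.

module RationalPowers where

  open import Data.Rational
  open import Data.Rational.Properties
  open ℚSolver.+-*-Solver using (solve; _:=_; _:+_; _:*_; _:-_; con)
  open ≤-Reasoning

  -- fromℕ m unfolds to a quotient by a gcd; abstractly, ι m can be unified.
  abstract
    ι : ℕ → ℚ
    ι = fromℕ

    ι≡fromℕ : ∀ n → ι n ≡ fromℕ n
    ι≡fromℕ n = refl

    ι-0 : ι 0 ≡ 0ℚ
    ι-0 = refl

    ι-1 : ι 1 ≡ 1ℚ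
    ι-1 = refl

    ι-suc : ∀ n → ι (suc n) ≡ 1ℚ + ι n
    ι-suc = fromℕ-suc

    0≤ι : ∀ n → 0ℚ ≤ ι n
    0≤ι = 0≤fromℕ

    1≤ι : ∀ n .{{_ : ℕ.NonZero n}} → 1ℚ ≤ ι n
    1≤ι n = 1≤fromℕ n

    toℚᵘ-ι : ∀ n → toℚᵘ (ι n) ℚᵘ.≃ ℚᵘ.mkℚᵘ (ℤ.+ n) 0
    toℚᵘ-ι n = toℚᵘ-fromℚᵘ (ℚᵘ.mkℚᵘ (ℤ.+ n) 0)

    ι-unbounded : ∀ q → ∃ λ n → q < ι n
    ι-unbounded q = archimedean q 0

  ι-+ : ∀ m n → ι (m ℕ.+ n) ≡ ι m + ι n
  ι-+ zero    n = sym (trans (cong (_+ ι n) ι-0) (+-identityˡ (ι n)))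
  ι-+ (suc m) n = begin-equality
    ι (suc (m ℕ.+ n))   ≡⟨ ι-suc (m ℕ.+ n) ⟩
    1ℚ + ι (m ℕ.+ n)    ≡⟨ cong (1ℚ +_) (ι-+ m n) ⟩
    1ℚ + (ι m + ι n)    ≡⟨ +-assoc 1ℚ (ι m) (ι n) ⟨
    1ℚ + ι m + ι n      ≡⟨ cong (_+ ι n) (ι-suc m) ⟨
    ι (suc m) + ι n     ∎

  ι-* : ∀ m n → ι (m ℕ.* n) ≡ ι m * ι n
  ι-* zero    n = trans ι-0 (sym (trans (cong (_* ι n) ι-0) (*-zeroˡ (ι n))))
  ι-* (suc m) n = begin-equality
    ι (n ℕ.+ m ℕ.* n)      ≡⟨ ι-+ n (m ℕ.* n) ⟩
    ι n + ι (m ℕ.* n)      ≡⟨ cong (ι n +_) (ι-* m n) ⟩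
    ι n + ι m * ι n        ≡⟨ cong (_+ ι m * ι n) (*-identityˡ (ι n)) ⟨
    1ℚ * ι n + ι m * ι n   ≡⟨ *-distribʳ-+ (ι n) 1ℚ (ι m) ⟨
    (1ℚ + ι m) * ι n       ≡⟨ cong (_* ι n) (ι-suc m) ⟨
    ι (suc m) * ι n        ∎

  ι-^ : ∀ m n → ι (m ℕ.^ n) ≡ ι m ^ n
  ι-^ m zero    = ι-1
  ι-^ m (suc n) = trans (ι-* m (m ℕ.^ n)) (cong (ι m *_) (ι-^ m n))

  ι-mono-≤ : ∀ {m n} → m ℕ.≤ n → ι m ≤ ι n
  ι-mono-≤ {m} {n} m≤n = begin
    ι m                   ≤⟨ p≤p+q _ (0≤ι (n ℕ.∸ m)) ⟩
    ι m + ι (n ℕ.∸ m)     ≡⟨ ι-+ m (n ℕ.∸ m) ⟨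
    ι (m ℕ.+ (n ℕ.∸ m))   ≡⟨ cong ι (ℕ.m+[n∸m]≡n m≤n) ⟩
    ι n                   ∎

  ι-mono-< : ∀ {m n} → m ℕ.< n → ι m < ι n
  ι-mono-< {m} {n} m<n = begin-strict
    ι m         <⟨ p<p+q (ι m) 0<1 ⟩
    ι m + 1ℚ    ≡⟨ +-comm (ι m) 1ℚ ⟩
    1ℚ + ι m    ≡⟨ ι-suc m ⟨
    ι (suc m)   ≤⟨ ι-mono-≤ m<n ⟩
    ι n         ∎

  ι-cancel-< : ∀ {m n} → ι m < ι n → m ℕ.< n
  ι-cancel-< {m} {n} h with m ℕ.<? n
  ... | yes m<n = m<n
  ... | no  m≮n = ⊥-elim (<-irrefl refl (<-≤-trans h (ι-mono-≤ (ℕ.≮⇒≥ m≮n))))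

  ι-cancel-≤ : ∀ {m n} → ι m ≤ ι n → m ℕ.≤ n
  ι-cancel-≤ h = ℕ.≮⇒≥ λ n<m → <-irrefl refl (<-≤-trans (ι-mono-< n<m) h)

  ι-injective : ∀ {m n} → ι m ≡ ι n → m ≡ n
  ι-injective {m} {n} eq with ℕ.<-cmp m n
  ... | tri< m<n _ _ = ⊥-elim (<-irrefl eq (ι-mono-< m<n))
  ... | tri≈ _ m≡n _ = m≡n
  ... | tri> _ _ n<m = ⊥-elim (<-irrefl (sym eq) (ι-mono-< n<m))

  0<ι : ∀ n .{{_ : ℕ.NonZero n}} → 0ℚ < ι n
  0<ι n = <-≤-trans 0<1 (1≤ι n)

  1^ : ∀ n → 1ℚ ^ n ≡ 1ℚ
  1^ zero    = refl
  1^ (suc n) = trans (*-identityˡ (1ℚ ^ n)) (1^ n)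

  *-mono-≤ : ∀ {p q r s} → 0ℚ ≤ p → 0ℚ ≤ s → p ≤ q → r ≤ s → p * r ≤ q * s
  *-mono-≤ 0≤p 0≤s p≤q r≤s = ≤-trans (*-monoʳ-≤ 0≤p r≤s) (*-monoˡ-≤ 0≤s p≤q)

  *-cancelʳ-≤ : ∀ {p q r} → 0ℚ < r → p * r ≤ q * r → p ≤ q
  *-cancelʳ-≤ {r = r} 0<r = *-cancelʳ-≤-pos r {{positive 0<r}}

  0≤q-p : ∀ {p q} → p ≤ q → 0ℚ ≤ q - p
  0≤q-p {p} {q} p≤q = subst (_≤ q - p) (+-inverseʳ p) (+-monoˡ-≤ (- p) p≤q)

  ^-injective : ∀ {p q} n .{{_ : ℕ.NonZero n}} → 0ℚ ≤ p → 0ℚ ≤ q → p ^ n ≡ q ^ n → p ≡ q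
  ^-injective {p} {q} n 0≤p 0≤q eq with <-cmp p q
  ... | tri< p<q _ _ = ⊥-elim (<-irrefl eq (^-mono-< 0≤p p<q n))
  ... | tri≈ _ p≡q _ = p≡q
  ... | tri> _ _ q<p = ⊥-elim (<-irrefl (sym eq) (^-mono-< 0≤q q<p n))

  ^-cancel-≤ : ∀ {p q} n .{{_ : ℕ.NonZero n}} → 0ℚ ≤ q → p ^ n ≤ q ^ n → p ≤ q
  ^-cancel-≤ {p} {q} n 0≤q h = ≮⇒≥ λ q<p → <-irrefl refl (<-≤-trans (^-mono-< 0≤q q<p n) h)

  ^-inverse : ∀ {p q} n → p * q ≡ 1ℚ → p ^ n * q ^ n ≡ 1ℚ
  ^-inverse {p} {q} n eq = trans (sym (^-distrib-* p q n)) (trans (cong (_^ n) eq) (1^ n))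

  n<2^ : ∀ {q} → 1ℚ + 1ℚ ≤ q → ∀ n → ι n < q ^ n
  n<2^ 2≤q zero = subst (_< 1ℚ) (sym ι-0) 0<1
  n<2^ {q} 2≤q (suc n) = begin-strict
    ι (suc n)           ≡⟨ ι-suc n ⟩
    1ℚ + ι n            <⟨ +-monoʳ-< 1ℚ (n<2^ 2≤q n) ⟩
    1ℚ + q ^ n          ≤⟨ +-monoˡ-≤ (q ^ n) (1≤^ (≤-trans (<⇒≤ (p<p+q 1ℚ 0<1)) 2≤q) n) ⟩
    q ^ n + q ^ n       ≡⟨ solve 1 (λ e → e :+ e := (con 1ℚ :+ con 1ℚ) :* e) refl (q ^ n) ⟩
    (1ℚ + 1ℚ) * q ^ n   ≤⟨ *-monoˡ-≤ (0≤^ (≤-trans (<⇒≤ (+-mono-< 0<1 0<1)) 2≤q) n) 2≤q ⟩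
    q * q ^ n           ∎

  -- Induction through u uⁿ - l lⁿ = u (uⁿ - lⁿ) + (u - l) lⁿ. The factor H^n instead of H^(n-1) is
  -- harmless as 1 ≤ H, and it avoids a subtraction in the exponent.
  ^-lipschitz : ∀ {l u H} → 0ℚ ≤ l → l ≤ u → u ≤ H → 1ℚ ≤ H → ∀ n →
                u ^ n - l ^ n ≤ (u - l) * (ι n * H ^ n)
  ^-lipschitz {l} {u} {H} 0≤l l≤u u≤H 1≤H zero = ≤-reflexive (trans
    (solve 2 (λ l u → con 1ℚ :- con 1ℚ := (u :- l) :* (con 0ℚ :* con 1ℚ)) refl l u)
    (cong (λ k → (u - l) * (k * 1ℚ)) (sym ι-0)))
  ^-lipschitz {l} {u} {H} 0≤l l≤u u≤H 1≤H (suc n) = begin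
    u * u ^ n - l * l ^ n
      ≡⟨ solve 4 (λ u l a b → u :* a :- l :* b := u :* (a :- b) :+ (u :- l) :* b) refl u l (u ^ n) (l ^ n) ⟩
    u * (u ^ n - l ^ n) + (u - l) * l ^ n
      ≤⟨ +-mono-≤ (*-mono-≤ 0≤u 0≤bound u≤H (^-lipschitz 0≤l l≤u u≤H 1≤H n))
                  (*-monoʳ-≤ 0≤d (≤-trans (^-mono-≤ 0≤l (≤-trans l≤u u≤H) n) (^-monoʳ-≤ 1≤H (ℕ.n≤1+n n)))) ⟩
    H * ((u - l) * (ι n * H ^ n)) + (u - l) * (H * H ^ n)
      ≡⟨ solve 4 (λ h d k e → h :* (d :* (k :* e)) :+ d :* (h :* e)
                           := d :* ((con 1ℚ :+ k) :* (h :* e))) refl H (u - l) (ι n) (H ^ n) ⟩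
    (u - l) * ((1ℚ + ι n) * (H * H ^ n))
      ≡⟨ cong (λ k → (u - l) * (k * (H * H ^ n))) (ι-suc n) ⟨
    (u - l) * (ι (suc n) * H ^ suc n) ∎
    where
    0≤u = ≤-trans 0≤l l≤u
    0≤d = 0≤q-p l≤u
    0≤bound = 0≤* 0≤d (0≤* (0≤ι n) (0≤^ (≤-trans (<⇒≤ 0<1) 1≤H) n))

  ι-numerator : ∀ y d .{coprime : ℕ.Coprime y (suc d)} → mkℚ (ℤ.+ y) d coprime * ι (suc d) ≡ ι y
  ι-numerator y d {coprime} = toℚᵘ-injective
    (ℚᵘ.≃-trans (toℚᵘ-homo-* q (ι (suc d)))
      (ℚᵘ.≃-trans (ℚᵘ.*-congˡ {toℚᵘ q} (toℚᵘ-ι (suc d)))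
      (ℚᵘ.≃-trans (ℚᵘ.*≡* (trans (ℤ.*-identityʳ _)
          (cong (λ k → ℤ.+ y ℤ.* ℤ.+ k) (sym (ℕ.*-identityʳ (suc d))))))
        (ℚᵘ.≃-sym (toℚᵘ-ι y)))))
    where q = mkℚ (ℤ.+ y) d coprime

  positive-numerator : ∀ {q} → 0ℚ < q → Σ[ y ∈ ℕ ] 0 ℕ.< y × q * ι (↧ₙ q) ≡ ι y
  positive-numerator {mkℚ (ℤ.+ suc y) d _} 0<q = suc y , ℕ.z<s , ι-numerator (suc y) d
  positive-numerator {mkℚ (ℤ.+ 0) d _} (*<* (ℤ.+<+ ()))
  positive-numerator {mkℚ ℤ.-[1+ y ] d _} (*<* ())

  0<↧ : ∀ q → 0ℚ < ι (↧ₙ q)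
  0<↧ q = 0<ι (↧ₙ q)

  -- Multiplied by X D, both fractions become natural numbers, and different naturals are at least 1
  -- apart.
  separation : ∀ {p q} X D {y c} → p * ι X ≡ ι y → q * ι D ≡ ι c →
               0ℚ < ι X * ι D → p < q → 1ℚ ≤ (q - p) * (ι X * ι D)
  separation {p} {q} X D {y} {c} pX qD 0<XD p<q = begin
    1ℚ                                ≡⟨ solve 1 (λ a → con 1ℚ := con 1ℚ :+ a :- a) refl (ι (y ℕ.* D)) ⟩
    1ℚ + ι (y ℕ.* D) - ι (y ℕ.* D)    ≡⟨ cong (_- ι (y ℕ.* D)) (ι-suc (y ℕ.* D)) ⟨
    ι (suc (y ℕ.* D)) - ι (y ℕ.* D)   ≤⟨ +-monoˡ-≤ (- ι (y ℕ.* D)) (ι-mono-≤ yD<cX) ⟩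
    ι (c ℕ.* X) - ι (y ℕ.* D)         ≡⟨ cong₂ _-_ qXD pXD ⟨
    q * (ι X * ι D) - p * (ι X * ι D)
      ≡⟨ solve 3 (λ q p a → q :* a :- p :* a := (q :- p) :* a) refl q p (ι X * ι D) ⟩
    (q - p) * (ι X * ι D)        ∎
    where
    pXD : p * (ι X * ι D) ≡ ι (y ℕ.* D)
    pXD = trans (sym (*-assoc p (ι X) (ι D))) (trans (cong (_* ι D) pX) (sym (ι-* y D)))
    qXD : q * (ι X * ι D) ≡ ι (c ℕ.* X)
    qXD = trans (cong (q *_) (*-comm (ι X) (ι D)))
      (trans (sym (*-assoc q (ι D) (ι X))) (trans (cong (_* ι X) qD) (sym (ι-* c X))))
    yD<cX : y ℕ.* D ℕ.< c ℕ.* X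
    yD<cX = ι-cancel-< (subst₂ _<_ pXD qXD (*-monoˡ-< 0<XD p<q))

  close⇒≡ : ∀ {p q e} X D {y c} → p * ι X ≡ ι y → q * ι D ≡ ι c →
            0ℚ < ι X * ι D → p - q ≤ e → q - p ≤ e → e * (ι X * ι D) < 1ℚ → p ≡ q
  close⇒≡ {p} {q} {e} X D pX qD 0<XD p-q≤e q-p≤e e<1 with <-cmp p q
  ... | tri< p<q _ _ = ⊥-elim (<-irrefl refl (≤-<-trans
          (≤-trans (separation X D pX qD 0<XD p<q) (*-monoˡ-≤ (<⇒≤ 0<XD) q-p≤e)) e<1))
  ... | tri≈ _ p≡q _ = p≡q
  ... | tri> _ _ q<p = ⊥-elim (<-irrefl refl (≤-<-trans
          (≤-trans (separation D X qD pX 0<DX q<p) (≤-trans (*-monoˡ-≤ (<⇒≤ 0<DX) p-q≤e)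
            (≤-reflexive (cong (e *_) (*-comm (ι D) (ι X)))))) e<1))
    where 0<DX = subst (0ℚ <_) (*-comm (ι X) (ι D)) 0<XD

  -- `𝓛` measures with the denominator in lowest terms, while the approximating fractions come with
  -- a denominator `D` that may not be reduced. By coprimality the reduced one divides `D`.
  ↧≤ : ∀ {q} D .{{_ : ℕ.NonZero D}} {c} → q * ι D ≡ ι c → ↧ₙ q ℕ.≤ D
  ↧≤ {q@(mkℚ i d coprime)} D {c} qD = ℕ.∣⇒≤ (ℕ.coprime-divisor (ℕ.sym (ℕ.recompute coprime)) (ℕ.divides c eq))
    where
    ratio≃ : toℚᵘ q ℚᵘ.* ℚᵘ.mkℚᵘ (ℤ.+ D) 0 ℚᵘ.≃ ℚᵘ.mkℚᵘ (ℤ.+ c) 0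
    ratio≃ = ℚᵘ.≃-trans (ℚᵘ.*-congˡ {toℚᵘ q} (ℚᵘ.≃-sym (toℚᵘ-ι D)))
      (ℚᵘ.≃-trans (ℚᵘ.≃-sym (toℚᵘ-homo-* q (ι D)))
        (ℚᵘ.≃-trans (ℚᵘ.≃-reflexive (cong toℚᵘ qD)) (toℚᵘ-ι c)))
    eqℤ : (i ℤ.* ℤ.+ D) ℤ.* ℤ.+ 1 ≡ ℤ.+ c ℤ.* ℤ.+ (suc d ℕ.* 1)
    eqℤ with ratio≃
    ... | ℚᵘ.*≡* h = h
    eq : ℤ.∣ i ∣ ℕ.* D ≡ c ℕ.* suc d
    eq = trans (trans (sym (ℤ.abs-* i (ℤ.+ D)))
        (trans (cong ℤ.∣_∣ (sym (ℤ.*-identityʳ (i ℤ.* ℤ.+ D)))) (cong ℤ.∣_∣ eqℤ)))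
      (trans (ℤ.abs-* (ℤ.+ c) (ℤ.+ (suc d ℕ.* 1))) (cong (c ℕ.*_) (ℕ.*-identityʳ (suc d))))

  -- Descends from a place where P holds until it fails. P need not be monotone: some crossing is
  -- found, with the failure just before it.
  transition : ∀ {P : Pred ℕ 0ℓ} → Decidable P → ¬ P 0 → ∀ {n} → P n → ∃ λ j → ¬ P j × P (suc j)
  transition P? ¬P0 {zero}  Pn = ⊥-elim (¬P0 Pn)
  transition P? ¬P0 {suc n} Pn with P? n
  ... | no ¬P = n , ¬P , Pn
  ... | yes P = transition P? ¬P0 P

-- Rational enclosures of reals and the Liouville condition.

module Enclosures where

  open RationalPowers
  open import Data.Rational
  open import Data.Rational.Properties
  open ℚSolver.+-*-Solver using (solve; _:=_; _:+_; _:-_; _:*_; :-_)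
  open ≤-Reasoning

  -- This is L ≤ ξ^n ≤ U, expressed through rational test points. The exponent lets a root such as
  -- z^(m/n) keep the rational endpoints l^m and u^m.
  record Enclosed (ξ : ℝ) (n : ℕ) (L U : ℚ) : Set where
    field
      below : ∀ {A} → 0ℚ ≤ A → A ^ n < L → lower ξ A
      above : ∀ {B} → 0ℚ < B → U < B ^ n → upper ξ B
  open Enclosed public

  p^1≡p : ∀ p → p ^ 1 ≡ p
  p^1≡p = *-identityʳ

  lower⇒≤ : ∀ {ξ L U A} → Enclosed ξ 1 L U → 0ℚ < U → lower ξ A → A ≤ U
  lower⇒≤ {ξ} {L} {U} {A} e 0<U l = ≮⇒≥ λ U<A → disjoint ξ
    (l , above e (<-trans 0<U U<A) (subst (U <_) (sym (p^1≡p A)) U<A))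

  upper⇒≥ : ∀ {ξ L U B} → Enclosed ξ 1 L U → 0ℚ < L → upper ξ B → L ≤ B
  upper⇒≥ {ξ} {L} {U} {B} e 0<L u = ≮⇒≥ λ B<L → disjoint ξ
    (below e (<⇒≤ (lower<upper ξ (below e ≤-refl 0<L) u)) (subst (_< L) (sym (p^1≡p B)) B<L) , u)

  -- `≤ℝ` compares lower cuts only; roundedness and locatedness carry it over to the upper cuts.
  ≤ℝ⇒upper : ∀ {x y p} → x ≤ℝ y → upper y p → upper x p
  ≤ℝ⇒upper {x} {y} x≤y u = let p′ , p′<p , u′ = upper-rounded y u in
    [ (λ l → ⊥-elim (disjoint y (x≤y l , u′))) , (λ u″ → u″) ]′ (located x p′<p)

  enclosed⇒≉ : ∀ {ξ s L U p} → Enclosed ξ 1 L U → 0ℚ < L → 0ℚ < U →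
               (lower s p × U ≤ p) ⊎ (upper s p × p ≤ L) → ¬ ξ ≈ s
  enclosed⇒≉ {ξ} {s} e 0<L 0<U (inj₁ (p<s , U≤p)) (ξ≤s , s≤ξ) =
    let r , p<r , r<s = lower-rounded s p<s in
    <-irrefl refl (<-≤-trans p<r (≤-trans (lower⇒≤ e 0<U (s≤ξ r<s)) U≤p))
  enclosed⇒≉ {ξ} {s} e 0<L 0<U (inj₂ (s<p , p≤L)) (ξ≤s , s≤ξ) =
    let r , r<p , s<r = upper-rounded s s<p in
    <-irrefl refl (<-≤-trans r<p (≤-trans p≤L (upper⇒≥ e 0<L (≤ℝ⇒upper {ξ} {s} ξ≤s s<r))))

  -- The cuts of `pow` ask for a rational point of z whose m-th power is beyond A^n or B^n. Density
  -- of m-th powers supplies one strictly before the endpoint, hence in the cut of z.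
  enclosed-pow : ∀ (z : ℝ⁺) {l u} m n .{{_ : ℕ.NonZero m}} .{{_ : ℕ.NonZero n}} → 0ℚ ≤ l → 0ℚ ≤ u →
                 Enclosed (val z) 1 l u → Enclosed (val (pow m n z)) n (l ^ m) (u ^ m)
  enclosed-pow z {l} {u} m n 0≤l 0≤u e = record
    { below = λ {A} 0≤A A^n<l^m →
        let c , 0<c , A^n<c^m , c^m<l^m = ^-dense m (0≤^ 0≤A n) A^n<l^m
            c<l = ^-cancel-< 0≤l m c^m<l^m
        in inj₂ (c , 0<c , below e (<⇒≤ 0<c) (subst (_< l) (sym (p^1≡p c)) c<l) , A^n<c^m)
    ; above = λ {B} 0<B u^m<B^n →
        let c , 0<c , u^m<c^m , c^m<B^n = ^-dense m (0≤^ 0≤u m) u^m<B^n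
            u<c = ^-cancel-< (<⇒≤ 0<c) m u^m<c^m
        in 0<B , c , above e 0<c (subst (u <_) (sym (p^1≡p c)) u<c) , c^m<B^n
    }

  inverse-antimono-< : ∀ {p p′ q q′} → 0ℚ < p′ → 0ℚ < q′ → p * p′ ≡ 1ℚ → q * q′ ≡ 1ℚ → p < q → q′ < p′
  inverse-antimono-< {p} {p′} {q} {q′} 0<p′ 0<q′ pp′ qq′ p<q = begin-strict
    q′              ≡⟨ *-identityˡ q′ ⟨
    1ℚ * q′         ≡⟨ cong (_* q′) pp′ ⟨
    p * p′ * q′     ≡⟨ *-assoc p p′ q′ ⟩
    p * (p′ * q′)   <⟨ *-monoˡ-< (0<* 0<p′ 0<q′) p<q ⟩
    q * (p′ * q′)   ≡⟨ solve 3 (λ q p q′ → q :* (p :* q′) := (q :* q′) :* p) refl q p′ q′ ⟩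
    q * q′ * p′     ≡⟨ cong (_* p′) qq′ ⟩
    1ℚ * p′         ≡⟨ *-identityˡ p′ ⟩
    p′              ∎

  inverse : ∀ {q} → 0ℚ < q → Σ[ d ∈ ℚ ] 0ℚ < d × d * q ≡ 1ℚ
  inverse {q} 0<q = let d , dq = divide 1ℚ 0<q in d , 0<-divide 0<1 0<q dq , dq

  -- The witness is the inverse of an interpolated c′ rather than of A or B: A may be 0, and the
  -- product with the witness has to differ strictly from 1.
  enclosed-inv : ∀ (z : ℝ⁺) {l u l′ u′} n .{{_ : ℕ.NonZero n}} → 0ℚ < l → 0ℚ < u → 0ℚ < l′ →
                 l′ * l ≡ 1ℚ → u′ * u ≡ 1ℚ →
                 Enclosed (val z) n l u → Enclosed (val (inv z)) n u′ l′
  enclosed-inv z {l} {u} {l′} {u′} n 0<l 0<u 0<l′ l′l u′u e = record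
    { below = λ {A} 0≤A A^n<u′ →
        let c′ , 0<c′ , A^n<c′^n , c′^n<u′ = ^-dense n (0≤^ 0≤A n) A^n<u′
            c , 0<c , cc′ = inverse 0<c′
            u<c^n = inverse-antimono-< (0<^ 0<c n) 0<u (trans (*-comm (c′ ^ n) (c ^ n)) (^-inverse n cc′)) u′u c′^n<u′
            A<c′ = ^-cancel-< (<⇒≤ 0<c′) n A^n<c′^n
        in c , above e 0<c u<c^n , subst (A * c <_) (trans (*-comm c′ c) cc′) (*-monoˡ-< 0<c A<c′)
    ; above = λ {B} 0<B l′<B^n →
        let c′ , 0<c′ , l′<c′^n , c′^n<B^n = ^-dense n (<⇒≤ 0<l′) l′<B^n
            c , 0<c , cc′ = inverse 0<c′
            c^n<l = inverse-antimono-< 0<l (0<^ 0<c n) l′l (trans (*-comm (c′ ^ n) (c ^ n)) (^-inverse n cc′)) l′<c′^n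
            c′<B = ^-cancel-< (<⇒≤ 0<B) n c′^n<B^n
        in c , 0<c , below e (<⇒≤ 0<c) c^n<l , subst (_< B * c) (trans (*-comm c′ c) cc′) (*-monoˡ-< 0<c c′<B)
    }

  -- The case in which n divides the exponent: z^(cn/n) is z^c, and the root disappears.
  enclosed-root : ∀ {ξ l u} c n .{{_ : ℕ.NonZero n}} → 0ℚ ≤ l → 0ℚ ≤ u →
                  Enclosed ξ n (l ^ (c ℕ.* n)) (u ^ (c ℕ.* n)) → Enclosed ξ 1 (l ^ c) (u ^ c)
  enclosed-root {ξ} {l} {u} c n 0≤l 0≤u e = record
    { below = λ {A} 0≤A A<l^c → below e 0≤A (subst (A ^ n <_) (^-assocʳ l c n)
        (^-mono-< 0≤A (subst (_< l ^ c) (p^1≡p A) A<l^c) n))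
    ; above = λ {B} 0<B u^c<B → above e 0<B (subst (_< B ^ n) (^-assocʳ u c n)
        (^-mono-< (0≤^ 0≤u c) (subst (u ^ c <_) (p^1≡p B) u^c<B) n))
    }

  -- An integer exponent N above η suffices, since x^(-N) ≤ x^(-η). In the witness, 0 encodes the
  -- denominator 1 of N.
  ≤^-intro : ∀ {ξ q} x .{{_ : ℕ.NonZero x}} (η : ℝ⁺) N → upper (val η) (fromℕ N) →
         (∀ r → 0ℚ ≤ r → lower ∣ ξ - q ∣ℝ r → r * ι x ^ N < 1ℚ) → ∣ ξ - q ∣ℝ ≤ℝ x ^- η
  ≤^-intro x η N η<N h {r} l with r <⊎≥ 0ℚ
  ... | inj₁ r<0 = inj₁ r<0
  ... | inj₂ 0≤r = inj₂ (N , 0 , η<N ,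
          subst₂ (λ a b → a * b ^ N < 1ℚ) (sym (p^1≡p r)) (ι≡fromℕ x) (h r 0≤r l))

  positiveℕ : ∀ N .{{_ : ℕ.NonZero N}} → ℝ⁺
  positiveℕ N = fromℚ (fromℕ N) , let m , 0<m , m<N = <-dense (<-≤-trans 0<1 (1≤fromℕ N)) in m , 0<m , m<N

  -- Here r is x^(-N). If r were below the distance, it would also be strictly below x^(-N), so
  -- r^(n+1) x^k < 1 for some k/(n+1) > N. The (n+1)-th power of r x^N = 1 excludes this.
  ≤^-elim : ∀ {ξ q r} x N .{{_ : ℕ.NonZero x}} .{{_ : ℕ.NonZero N}} → 0ℚ ≤ r → r * ι x ^ N ≡ 1ℚ →
        ∣ ξ - q ∣ℝ ≤ℝ x ^- positiveℕ N → ¬ lower ∣ ξ - q ∣ℝ r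
  ≤^-elim {ξ} {q} {r} x N 0≤r rx^N≡1 h l with h l
  ... | inj₁ r<0 = <-irrefl refl (<-≤-trans r<0 0≤r)
  ... | inj₂ (k , n , N<k/n , r^nx^k<1) = <-irrefl refl (begin-strict
    1ℚ                                ≡⟨ 1^ (suc n) ⟨
    1ℚ ^ suc n                        ≡⟨ cong (_^ suc n) rx^N≡1 ⟨
    (r * ι x ^ N) ^ suc n             ≡⟨ ^-distrib-* r (ι x ^ N) (suc n) ⟩
    r ^ suc n * (ι x ^ N) ^ suc n     ≡⟨ cong (r ^ suc n *_) (^-assocʳ (ι x) N (suc n)) ⟩
    r ^ suc n * ι x ^ (N ℕ.* suc n)   ≤⟨ *-monoʳ-≤ (0≤^ 0≤r (suc n)) (^-monoʳ-≤ (1≤ι x) (ℕ.<⇒≤ N*n<k)) ⟩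
    r ^ suc n * ι x ^ k               ≡⟨ cong (λ y → r ^ suc n * y ^ k) (ι≡fromℕ x) ⟩
    r ^ suc n * fromℕ x ^ k           <⟨ r^nx^k<1 ⟩
    1ℚ                                ∎)
    where
    N*n<k : N ℕ.* suc n ℕ.< k
    N*n<k = ℤ.drop‿+<+ (subst₂ ℤ._<_ (sym (ℤ.pos-* N (suc n))) (ℤ.*-identityʳ (ℤ.+ k))
      (/-cancel-< {ℤ.+ N} {ℤ.+ k} N<k/n))

  boundedRationals : ℕ → List ℚ
  boundedRationals K =
    cartesianProductWith (λ i d → ℤ.+ i / suc d) (upTo K) (upTo K) ++
    cartesianProductWith (λ i d → ℤ.-[1+ i ] / suc d) (upTo K) (upTo K)

  ∈-boundedRationals : ∀ {q} K x₀ B → q ≤ ι B → - q ≤ ι B → ↧ₙ q ℕ.≤ x₀ → B ℕ.* x₀ ℕ.< K → x₀ ℕ.≤ K →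
                       q ∈ boundedRationals K
  ∈-boundedRationals {q@(mkℚ (ℤ.+ i) d _)} K x₀ B q≤B -q≤B d<x₀ Bx₀<K x₀≤K = ∈-++⁺ˡ
    (subst (_∈ cartesianProductWith (λ i d → ℤ.+ i / suc d) (upTo K) (upTo K)) (↥p/↧p≡p q)
      (∈-cartesianProductWith⁺ (λ i d → ℤ.+ i / suc d) {xs = upTo K} {ys = upTo K}
         (∈-upTo⁺ i<K) (∈-upTo⁺ (ℕ.<-≤-trans d<x₀ x₀≤K))))
    where
    i<K : i ℕ.< K
    i<K = ℕ.≤-<-trans (ι-cancel-≤ (begin
      ι i               ≡⟨ ι-numerator i d ⟨
      q * ι (suc d)     ≤⟨ *-monoˡ-≤ (0≤ι (suc d)) q≤B ⟩
      ι B * ι (suc d)   ≡⟨ ι-* B (suc d) ⟨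
      ι (B ℕ.* suc d)   ≤⟨ ι-mono-≤ (ℕ.*-monoʳ-≤ B d<x₀) ⟩
      ι (B ℕ.* x₀)      ∎)) Bx₀<K
  ∈-boundedRationals {q@(mkℚ ℤ.-[1+ i ] d _)} K x₀ B q≤B -q≤B d<x₀ Bx₀<K x₀≤K = ∈-++⁺ʳ
    (cartesianProductWith (λ i d → ℤ.+ i / suc d) (upTo K) (upTo K))
    (subst (_∈ cartesianProductWith (λ i d → ℤ.-[1+ i ] / suc d) (upTo K) (upTo K)) (↥p/↧p≡p q)
      (∈-cartesianProductWith⁺ (λ i d → ℤ.-[1+ i ] / suc d) {xs = upTo K} {ys = upTo K}
         (∈-upTo⁺ (ℕ.<-trans (ℕ.n<1+n i) i<K)) (∈-upTo⁺ (ℕ.<-≤-trans d<x₀ x₀≤K))))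
    where
    i<K : suc i ℕ.< K
    i<K = ℕ.≤-<-trans (ι-cancel-≤ (begin
      ι (suc i)           ≡⟨ ι-numerator (suc i) d ⟨
      (- q) * ι (suc d)   ≤⟨ *-monoˡ-≤ (0≤ι (suc d)) -q≤B ⟩
      ι B * ι (suc d)     ≡⟨ ι-* B (suc d) ⟨
      ι (B ℕ.* suc d)     ≤⟨ ι-mono-≤ (ℕ.*-monoʳ-≤ B d<x₀) ⟩
      ι (B ℕ.* x₀)        ∎)) Bx₀<K

  inverse≤1 : ∀ {r X} → 0ℚ < X → 1ℚ ≤ X → r * X ≡ 1ℚ → r ≤ 1ℚ
  inverse≤1 {r} {X} 0<X 1≤X rX≡1 = *-cancelʳ-≤ 0<X (begin
    r * X    ≡⟨ rX≡1 ⟩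
    1ℚ       ≤⟨ 1≤X ⟩
    X        ≡⟨ *-identityˡ X ⟨
    1ℚ * X   ∎)

  -- The last two fields together say that ξ has distance at most r = x^(-N) from q. A weak
  -- inequality of cuts is a negation, which is enough because all conclusions drawn from it are
  -- weak rational inequalities.
  record Approximation (ξ : ℝ) (N x₀ : ℕ) : Set where
    field
      q r         : ℚ
      x₀<x        : x₀ ℕ.< ↧ₙ q
      0<r         : 0ℚ < r
      rx^N≡1      : r * ι (↧ₙ q) ^ N ≡ 1ℚ
      q+r-notlower : ¬ lower ξ (q + r)
      q-r-notupper : ¬ upper ξ (q - r)

  -- Only finitely many rationals of bounded denominator lie within distance 1 of ξ.
  approximation : ∀ {ξ} → 𝓛 ξ → ∀ N .{{_ : ℕ.NonZero N}} x₀ → Approximation ξ N x₀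
  approximation {ξ} (_ , infinite) N x₀ =
    let a , la = lower-inhabited ξ
        b , ub = upper-inhabited ξ
        B₁ , b+1<B₁ = ι-unbounded (b + 1ℚ)
        B₂ , 1-a<B₂ = ι-unbounded (1ℚ - a)
        B = B₁ ℕ.+ B₂
        K = suc (B ℕ.* x₀) ℕ.+ x₀
        q , h , q∉ = infinite (positiveℕ N) (boundedRationals K)
        0<x = 0<↧ q
        0<x^N = 0<^ 0<x N
        r , 0<r , rx^N≡1 = inverse 0<x^N
        not-r = ≤^-elim {ξ} {q} (↧ₙ q) N (<⇒≤ 0<r) rx^N≡1 h
        q+r∉ = λ l → not-r (inj₂ (inj₁ l))
        q-r∉ = λ u → not-r (inj₂ (inj₂ u))
        r≤1 = inverse≤1 0<x^N (1≤^ (1≤ι (↧ₙ q)) N) rx^N≡1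
    in record
      { q = q ; r = r ; 0<r = 0<r ; rx^N≡1 = rx^N≡1 ; q+r-notlower = q+r∉ ; q-r-notupper = q-r∉
      ; x₀<x = ℕ.≰⇒> λ x≤x₀ → q∉ (∈-boundedRationals K x₀ B
          (≤-trans (q≤ q r b r≤1 (≮⇒≥ λ b<q-r → q-r∉ (upper-closed ξ b<q-r ub)))
            (≤-trans (<⇒≤ b+1<B₁) (ι-mono-≤ (ℕ.m≤m+n B₁ B₂))))
          (≤-trans (-q≤ q r a r≤1 (≮⇒≥ λ q+r<a → q+r∉ (lower-closed ξ q+r<a la)))
            (≤-trans (<⇒≤ 1-a<B₂) (ι-mono-≤ (ℕ.m≤n+m B₂ B₁))))
          x≤x₀ (ℕ.m≤m+n _ x₀) (ℕ.m≤n+m x₀ _))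
      }
    where
    q≤ : ∀ q r b → r ≤ 1ℚ → q - r ≤ b → q ≤ b + 1ℚ
    q≤ q r b r≤1 h = begin
      q           ≡⟨ solve 2 (λ q r → q := q :- r :+ r) refl q r ⟩
      q - r + r   ≤⟨ +-mono-≤ h r≤1 ⟩
      b + 1ℚ      ∎
    -q≤ : ∀ q r a → r ≤ 1ℚ → a ≤ q + r → - q ≤ 1ℚ - a
    -q≤ q r a r≤1 h = begin
      - q           ≡⟨ solve 2 (λ q r → :- q := r :- (q :+ r)) refl q r ⟩
      r - (q + r)   ≤⟨ +-mono-≤ r≤1 (neg-antimono-≤ h) ⟩
      1ℚ - a        ∎

-- Powers of a real with rapidly converging fractions.

module RapidApproximation where

  open RationalPowers
  open Enclosures
  open import Data.Nat.Tactic.RingSolver using (solve-∀)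
  open import Data.Rational
  open import Data.Rational.Properties
  open ℚSolver.+-*-Solver using (solve; _:=_; _:+_; _:*_; _:-_; con)
  open ≤-Reasoning

  -- One interface for ζ and 1/ζ. Inversion reverses the order, so the fraction `w` is the left end
  -- of the enclosure for ζ and the right end for 1/ζ. The denominators for 1/ζ are the numerators
  -- 2P, comparable with `Q` only up to a factor; hence `den≤`.
  record Approximants : Set where
    field
      Q l w u  : ℕ → ℚ
      K        : ℚ
      num den  : ℕ → ℕ
      2≤Q      : ∀ k → 1ℚ + 1ℚ ≤ Q k
      growth   : ∀ k → Q (suc k) ≡ Q k ^ (3 ℕ.+ k)
      1≤K      : 1ℚ ≤ K
      0<l      : ∀ k → 0ℚ < l k
      l≤w      : ∀ k → l k ≤ w k
      w≤u      : ∀ k → w k ≤ u k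
      u≤K      : ∀ k → u k ≤ K
      gap      : ∀ k → (u k - l k) * Q (suc k) ≤ K
      0<den    : ∀ k → 0 ℕ.< den k
      den≤     : ∀ k → ι (den k) ≤ K * Q k
      fraction : ∀ k → w k * ι (den k) ≡ ι (num k)
      distinct : ∀ {j k} → j ℕ.< k → w j ≢ w k
      -- That is, (w k)^m = (y/x)^n only if n ∣ m.
      generic  : ∀ k m n x y → 0 ℕ.< x → 0 ℕ.< y →
                 y ℕ.^ n ℕ.* den k ℕ.^ m ≡ num k ℕ.^ m ℕ.* x ℕ.^ n → n ℕ.∣ m

    0<w : ∀ k → 0ℚ < w k
    0<w k = <-≤-trans (0<l k) (l≤w k)

    0<u : ∀ k → 0ℚ < u k
    0<u k = <-≤-trans (0<w k) (w≤u k)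

  module Powers (approximants : Approximants) (m : ℕ) .{{_ : ℕ.NonZero m}} where
    open Approximants approximants

    L W U δ : ℕ → ℚ
    L k = l k ^ m
    W k = w k ^ m
    U k = u k ^ m
    δ k = U k - L k

    D : ℕ → ℕ
    D k = den k ℕ.^ m

    -- One constant above both K^m, the factor in the bound on `D`, and K m K^m, the factor that the
    -- Lipschitz estimate puts on `δ`.
    G : ℚ
    G = (1ℚ + ι m * K) * K ^ m

    0≤K : 0ℚ ≤ K
    0≤K = ≤-trans (<⇒≤ 0<1) 1≤K

    0<L : ∀ k → 0ℚ < L k
    0<L k = 0<^ (0<l k) m

    0<U : ∀ k → 0ℚ < U k
    0<U k = 0<^ (0<u k) m

    L≤W : ∀ k → L k ≤ W k
    L≤W k = ^-mono-≤ (<⇒≤ (0<l k)) (l≤w k) m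

    W≤U : ∀ k → W k ≤ U k
    W≤U k = ^-mono-≤ (<⇒≤ (0<w k)) (w≤u k) m

    0≤δ : ∀ k → 0ℚ ≤ δ k
    0≤δ k = 0≤q-p (≤-trans (L≤W k) (W≤U k))

    1≤K^m : 1ℚ ≤ K ^ m
    1≤K^m = 1≤^ 1≤K m

    0≤K^m : 0ℚ ≤ K ^ m
    0≤K^m = 0≤^ 0≤K m

    K^m≤G : K ^ m ≤ G
    K^m≤G = subst (_≤ G) (*-identityˡ (K ^ m)) (*-monoˡ-≤ 0≤K^m (p≤p+q 1ℚ (0≤* (0≤ι m) 0≤K)))

    1≤G : 1ℚ ≤ G
    1≤G = ≤-trans 1≤K^m K^m≤G

    0<G : 0ℚ < G
    0<G = <-≤-trans 0<1 1≤G

    0<Q : ∀ k → 0ℚ < Q k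
    0<Q k = <-≤-trans (+-mono-< 0<1 0<1) (2≤Q k)

    1≤Q : ∀ k → 1ℚ ≤ Q k
    1≤Q k = ≤-trans (p≤p+q 1ℚ (<⇒≤ 0<1)) (2≤Q k)

    δ*Q≤G : ∀ k → δ k * Q (suc k) ≤ G
    δ*Q≤G k = begin
      δ k * Q (suc k)
        ≤⟨ *-monoˡ-≤ (<⇒≤ (0<Q (suc k)))
             (^-lipschitz (<⇒≤ (0<l k)) (≤-trans (l≤w k) (w≤u k)) (u≤K k) 1≤K m) ⟩
      (u k - l k) * (ι m * K ^ m) * Q (suc k)
        ≡⟨ solve 4 (λ d i e q → d :* (i :* e) :* q := d :* q :* (i :* e)) refl (u k - l k) (ι m) (K ^ m) (Q (suc k)) ⟩
      (u k - l k) * Q (suc k) * (ι m * K ^ m)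
        ≤⟨ *-monoˡ-≤ (0≤* (0≤ι m) 0≤K^m) (gap k) ⟩
      K * (ι m * K ^ m)
        ≤⟨ p≤p+q _ 0≤K^m ⟩
      K * (ι m * K ^ m) + K ^ m
        ≡⟨ solve 3 (λ κ i e → κ :* (i :* e) :+ e := (con 1ℚ :+ i :* κ) :* e) refl K (ι m) (K ^ m) ⟩
      G ∎

    D≤ : ∀ k → ι (D k) ≤ G * Q k ^ m
    D≤ k = begin
      ι (D k)           ≡⟨ ι-^ (den k) m ⟩
      ι (den k) ^ m     ≤⟨ ^-mono-≤ (0≤ι (den k)) (den≤ k) m ⟩
      (K * Q k) ^ m     ≡⟨ ^-distrib-* K (Q k) m ⟩
      K ^ m * Q k ^ m   ≤⟨ *-monoˡ-≤ (0≤^ (<⇒≤ (0<Q k)) m) K^m≤G ⟩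
      G * Q k ^ m       ∎

    D-nonZero : ∀ k → ℕ.NonZero (D k)
    D-nonZero k = ℕ.m^n≢0 (den k) m {{ℕ.>-nonZero (0<den k)}}

    W*D : ∀ k → W k * ι (D k) ≡ ι (num k ℕ.^ m)
    W*D k = begin-equality
      w k ^ m * ι (den k ℕ.^ m)   ≡⟨ cong (w k ^ m *_) (ι-^ (den k) m) ⟩
      w k ^ m * ι (den k) ^ m     ≡⟨ ^-distrib-* (w k) (ι (den k)) m ⟨
      (w k * ι (den k)) ^ m       ≡⟨ cong (_^ m) (fraction k) ⟩
      ι (num k) ^ m               ≡⟨ ι-^ (num k) m ⟨
      ι (num k ℕ.^ m)             ∎

    W-distinct : ∀ {j k} → j ℕ.< k → W j ≢ W k
    W-distinct {j} {k} j<k eq = distinct j<k (^-injective m (<⇒≤ (0<w j)) (<⇒≤ (0<w k)) eq)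

    -- Each q equals `W k` for at most one k. When the head of the list is hit, the search restarts
    -- behind that index, where it cannot be hit again.
    W-avoids : ∀ qs k₀ → ∃ λ k → k₀ ℕ.≤ k × W k ∉ qs
    W-avoids [] k₀ = k₀ , ℕ.≤-refl , λ ()
    W-avoids (q ∷ qs) k₀ with W-avoids qs k₀
    ... | k , k₀≤k , ∉qs with W k ≟ q
    ... | no  W≢q = k , k₀≤k , λ { (here W≡q) → W≢q W≡q ; (there ∈qs) → ∉qs ∈qs }
    ... | yes W≡q with W-avoids qs (suc k)
    ... | k′ , k<k′ , ∉qs′ = k′ , ℕ.≤-trans k₀≤k (ℕ.<⇒≤ k<k′) ,
          λ { (here W′≡q) → W-distinct k<k′ (trans W≡q (sym W′≡q)) ; (there ∈qs) → ∉qs′ ∈qs }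

    -- The threshold must be uniform in k, because k will depend on j. It is, since every `Q k` is
    -- at least 2.
    Q-exceeds : ∀ c → ∃ λ j₀ → ∀ {j} → j₀ ℕ.≤ j → ∀ k → c ≤ Q k ^ j
    Q-exceeds c = let j₀ , c<j₀ = ι-unbounded c in j₀ , λ {j} j₀≤j k →
      ≤-trans (<⇒≤ c<j₀) (≤-trans (ι-mono-≤ j₀≤j) (<⇒≤ (n<2^ (2≤Q k) j)))

    -- The growth exponent 3 + k is split into e, which pays for the power of `Q k` in M, and 3 + j,
    -- which pays for c and G. The bound is 1/2, written as a sum, to leave room for the error of a
    -- second approximation.
    δ-small : ∀ {M} e j c k → k ≡ e ℕ.+ j → M ≤ Q k ^ e * c → c * (G + G) ≤ Q k ^ (3 ℕ.+ j) → 0ℚ ≤ M →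
              δ k * M + δ k * M ≤ 1ℚ
    δ-small {M} e j c k refl M≤ c≤ 0≤M = *-cancelʳ-≤ 0<G (begin
      (δ k * M + δ k * M) * G
        ≡⟨ solve 3 (λ d a g → (d :* a :+ d :* a) :* g := d :* (a :* (g :+ g))) refl (δ k) M G ⟩
      δ k * (M * (G + G))                 ≤⟨ *-monoʳ-≤ (0≤δ k) (*-monoˡ-≤ (0≤+ (<⇒≤ 0<G) (<⇒≤ 0<G)) M≤) ⟩
      δ k * (Q k ^ e * c * (G + G))       ≡⟨ cong (δ k *_) (*-assoc (Q k ^ e) c (G + G)) ⟩
      δ k * (Q k ^ e * (c * (G + G)))     ≤⟨ *-monoʳ-≤ (0≤δ k) (*-monoʳ-≤ (0≤^ (<⇒≤ (0<Q k)) e) c≤) ⟩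
      δ k * (Q k ^ e * Q k ^ (3 ℕ.+ j))   ≡⟨ cong (δ k *_) (^-homo-* (Q k) e (3 ℕ.+ j)) ⟨
      δ k * Q k ^ (e ℕ.+ (3 ℕ.+ j))       ≡⟨ cong (λ i → δ k * Q k ^ i) (exponent e j) ⟩
      δ k * Q k ^ (3 ℕ.+ k)               ≡⟨ cong (δ k *_) (growth k) ⟨
      δ k * Q (suc k)                     ≤⟨ δ*Q≤G k ⟩
      G                                   ≡⟨ *-identityˡ G ⟨
      1ℚ * G                              ∎)
      where
      exponent : ∀ e j → e ℕ.+ (3 ℕ.+ j) ≡ 3 ℕ.+ (e ℕ.+ j)
      exponent e j = trans (sym (ℕ.+-assoc e 3 j)) (trans (cong (ℕ._+ j) (ℕ.+-comm e 3)) (ℕ.+-assoc 3 e j))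

    half<1 : ∀ {p} → 0ℚ ≤ p → p + p ≤ 1ℚ → p < 1ℚ
    half<1 {p} 0≤p h with p <⊎≥ 1ℚ
    ... | inj₁ p<1 = p<1
    ... | inj₂ 1≤p = ⊥-elim (<-irrefl refl (<-≤-trans (p<p+q 1ℚ 0<1) (≤-trans (+-mono-≤ 1≤p 1≤p) h)))

    module _ {ξ : ℝ} (enclosed : ∀ k → Enclosed ξ 1 (L k) (U k)) where

      lower-0 : lower ξ 0ℚ
      lower-0 = below (enclosed 0) ≤-refl (0<L 0)

      rational-enclosed : ∀ {q} → ξ ≈ fromℚ q → ∀ k → L k ≤ q × q ≤ U k
      rational-enclosed {q} (ξ≤q , q≤ξ) k =
        ≮⇒≥ (λ q<L → let p , q<p , p<L = <-dense q<L in
          <-asym q<p (ξ≤q (below (enclosed k) (<⇒≤ (<-trans 0<q q<p)) (subst (_< L k) (sym (p^1≡p p)) p<L)))) ,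
        ≮⇒≥ (λ U<q → let p , U<p , p<q = <-dense U<q in
          <-irrefl refl (<-≤-trans U<p (lower⇒≤ (enclosed k) (0<U k) (q≤ξ p<q))))
        where
        0<q : 0ℚ < q
        0<q = ξ≤q lower-0

      -- A rational q equal to ξ shares every enclosure with `W k`. Eventually the enclosure is
      -- shorter than the least distance of two different fractions with their denominators, so q
      -- equals two consecutive values of `W`.
      irrational : Irrational ξ
      irrational q ξ≈q =
        W-distinct (ℕ.n<1+n (m ℕ.+ j₀)) (trans (sym (q≡W j₀ ℕ.≤-refl))
          (trans (q≡W (suc j₀) (ℕ.n≤1+n j₀)) (cong W (ℕ.+-suc m j₀))))
        where
        0<q : 0ℚ < q
        0<q = proj₁ ξ≈q lower-0
        X = ↧ₙ q
        j₀ = proj₁ (Q-exceeds (ι X * G * (G + G)))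
        exceeds = proj₂ (Q-exceeds (ι X * G * (G + G)))
        q≡W : ∀ j → j₀ ℕ.≤ j → q ≡ W (m ℕ.+ j)
        q≡W j j₀≤j = close⇒≡ X (D k) (proj₂ (proj₂ (positive-numerator 0<q))) (W*D k) 0<XD
          (+-mono-≤ (proj₂ bounds) (neg-antimono-≤ (L≤W k)))
          (+-mono-≤ (W≤U k) (neg-antimono-≤ (proj₁ bounds)))
          (half<1 (0≤* (0≤δ k) (<⇒≤ 0<XD))
            (δ-small m j (ι X * G) k refl XD≤ (exceeds (ℕ.≤-trans j₀≤j (ℕ.m≤n+m j 3)) k) (<⇒≤ 0<XD)))
          where
          k = m ℕ.+ j
          bounds = rational-enclosed ξ≈q k
          0<XD : 0ℚ < ι X * ι (D k)
          0<XD = 0<* (0<↧ q) (0<ι (D k) {{D-nonZero k}})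
          XD≤ : ι X * ι (D k) ≤ Q k ^ m * (ι X * G)
          XD≤ = begin
            ι X * ι (D k)          ≤⟨ *-monoʳ-≤ (0≤ι X) (D≤ k) ⟩
            ι X * (G * Q k ^ m)
              ≡⟨ solve 3 (λ x g e → x :* (g :* e) := e :* (x :* g)) refl (ι X) G (Q k ^ m) ⟩
            Q k ^ m * (ι X * G)    ∎

      lower-distance≤δ : ∀ {r} k → lower ∣ ξ - W k ∣ℝ r → r ≤ δ k
      lower-distance≤δ k (inj₁ r<0) = ≤-trans (<⇒≤ r<0) (0≤δ k)
      lower-distance≤δ {r} k (inj₂ (inj₁ l)) = begin
        r               ≡⟨ solve 2 (λ a r → r := a :+ r :- a) refl (W k) r ⟩
        W k + r - W k   ≤⟨ +-mono-≤ (lower⇒≤ (enclosed k) (0<U k) l) (neg-antimono-≤ (L≤W k)) ⟩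
        δ k             ∎
      lower-distance≤δ {r} k (inj₂ (inj₂ u)) = begin
        r                 ≡⟨ solve 2 (λ a r → r := a :- (a :- r)) refl (W k) r ⟩
        W k - (W k - r)   ≤⟨ +-mono-≤ (W≤U k) (neg-antimono-≤ (upper⇒≥ (enclosed k) (0<L k) u)) ⟩
        δ k               ∎

      liouville : 𝓛 ξ
      liouville = irrational , infinite
        where
        infinite : (η : ℝ⁺) → Infinite λ q → ∣ ξ - q ∣ℝ ≤ℝ ↧ₙ q ^- η
        infinite η qs = W k ,
          ≤^-intro {ξ} {W k} (↧ₙ (W k)) η N η<N (λ r 0≤r r<∣∣ → ≤-<-trans (bound r 0≤r r<∣∣) δM<1) ,
          W∉qs
          where
          N = proj₁ (ι-unbounded (proj₁ (upper-inhabited (val η))))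
          η<N : upper (val η) (fromℕ N)
          η<N = subst (upper (val η)) (ι≡fromℕ N)
            (upper-closed (val η) (proj₂ (ι-unbounded (proj₁ (upper-inhabited (val η)))))
              (proj₂ (upper-inhabited (val η))))
          j₀ = proj₁ (Q-exceeds (G ^ N * (G + G)))
          avoiding = W-avoids qs (m ℕ.* N ℕ.+ j₀)
          k = proj₁ avoiding
          W∉qs = proj₂ (proj₂ avoiding)
          j = k ℕ.∸ m ℕ.* N
          k≡ : k ≡ m ℕ.* N ℕ.+ j
          k≡ = sym (ℕ.m+[n∸m]≡n (ℕ.≤-trans (ℕ.m≤m+n (m ℕ.* N) j₀) (proj₁ (proj₂ avoiding))))
          j₀≤j : j₀ ℕ.≤ j
          j₀≤j = ℕ.m+n≤o⇒m≤o∸n j₀ (subst (ℕ._≤ k) (ℕ.+-comm (m ℕ.* N) j₀) (proj₁ (proj₂ avoiding)))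
          -- An upper bound for the N-th power of the reduced denominator of `W k`.
          M = (G * Q k ^ m) ^ N
          0≤M : 0ℚ ≤ M
          0≤M = 0≤^ (0≤* (<⇒≤ 0<G) (0≤^ (<⇒≤ (0<Q k)) m)) N
          M≡ : M ≡ Q k ^ (m ℕ.* N) * G ^ N
          M≡ = trans (^-distrib-* G (Q k ^ m) N) (trans (*-comm (G ^ N) ((Q k ^ m) ^ N))
            (cong (_* G ^ N) (^-assocʳ (Q k) m N)))
          δM<1 : δ k * M < 1ℚ
          δM<1 = half<1 (0≤* (0≤δ k) 0≤M) (δ-small (m ℕ.* N) j (G ^ N) k k≡ (≤-reflexive M≡)
            (proj₂ (Q-exceeds (G ^ N * (G + G))) (ℕ.≤-trans j₀≤j (ℕ.m≤n+m j 3)) k) 0≤M)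
          bound : ∀ r → 0ℚ ≤ r → lower ∣ ξ - W k ∣ℝ r → r * ι (↧ₙ (W k)) ^ N ≤ δ k * M
          bound r 0≤r r<∣∣ = *-mono-≤ 0≤r 0≤M (lower-distance≤δ k r<∣∣)
            (^-mono-≤ (0≤ι (↧ₙ (W k))) (≤-trans (ι-mono-≤ (↧≤ {W k} (D k) {{D-nonZero k}} (W*D k))) (D≤ k)) N)

    -- If x^(-N) is the error of an approximation q = y/x to ξ, take the first k for which the
    -- error of W k is well below 1/(xⁿ D k).  Then Q k is at most a fixed power of x, so the error
    -- of qⁿ is well below 1/(xⁿ D k) as well, which forces qⁿ = W k.
    module _ {ξ : ℝ} (n : ℕ) .{{_ : ℕ.NonZero n}} (enclosed : ∀ k → Enclosed ξ n (L k) (U k)) where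

      -- H bounds q + r, E is a Lipschitz constant of the n-th power on [0, H], and Z is the
      -- constant left in `rM` after all powers of X have been collected.
      H E Z : ℚ
      H = K ^ m + 1ℚ + 1ℚ
      E = ι n * H ^ n
      Z = (E + E + (E + E)) * G * (G * (G + G)) ^ (2 ℕ.* m)

      N : ℕ
      N = suc (n ℕ.+ (n ℕ.* (2 ℕ.* m)))

      1≤H : 1ℚ ≤ H
      1≤H = p≤q+p (0≤+ 0≤K^m (<⇒≤ 0<1))
        where
        p≤q+p : ∀ {p q} → 0ℚ ≤ q → p ≤ q + p
        p≤q+p {p} {q} 0≤q = subst (p ≤_) (+-comm p q) (p≤p+q p 0≤q)

      0≤H : 0ℚ ≤ H
      0≤H = ≤-trans (<⇒≤ 0<1) 1≤H

      0≤E : 0ℚ ≤ E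
      0≤E = 0≤* (0≤ι n) (0≤^ 0≤H n)

      -- Four ways in which x must be large, all secured by a suitable `x₀`: the first makes 2r ≤ 1,
      -- the second makes q - r positive, the third makes the search for k start with a failure, and
      -- the fourth beats the constant in `rM`.
      module _ {x₀ : ℕ} (a : Approximation ξ N x₀)
               (2≤x   : 1ℚ + 1ℚ ≤ ι (↧ₙ (Approximation.q a)))
               (2<L*x : 1ℚ + 1ℚ < L 0 * ι (↧ₙ (Approximation.q a)))
               (Q≤x   : Q (2 ℕ.* m) ^ (3 ℕ.+ m) ≤ ι (↧ₙ (Approximation.q a)))
               (Z<x   : Z < ι (↧ₙ (Approximation.q a))) where

        open Approximation a

        X Y : ℚ
        X = ι (↧ₙ q)
        Y = X ^ n * (G * (G + G))

        0<X : 0ℚ < X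
        0<X = 0<↧ q

        1≤X : 1ℚ ≤ X
        1≤X = 1≤ι (↧ₙ q)

        0≤r : 0ℚ ≤ r
        0≤r = <⇒≤ 0<r

        r*X≤1 : r * X ≤ 1ℚ
        r*X≤1 = subst (r * X ≤_) rx^N≡1 (*-monoʳ-≤ 0≤r (p≤p^ 1≤X N))

        r+r≤1 : r + r ≤ 1ℚ
        r+r≤1 = begin
          r + r           ≡⟨ solve 1 (λ r → r :+ r := r :* (con 1ℚ :+ con 1ℚ)) refl r ⟩
          r * (1ℚ + 1ℚ)   ≤⟨ *-monoʳ-≤ 0≤r 2≤x ⟩
          r * X           ≤⟨ r*X≤1 ⟩
          1ℚ              ∎

        0≤q+r : 0ℚ ≤ q + r
        0≤q+r = ≮⇒≥ λ q+r<0 → q+r-notlower (lower-closed ξ q+r<0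
          (below (enclosed 0) ≤-refl (subst (_< L 0) (sym (0^ n)) (0<L 0))))

        L≤[q+r]^n : ∀ k → L k ≤ (q + r) ^ n
        L≤[q+r]^n k = ≮⇒≥ λ h → q+r-notlower (below (enclosed k) 0≤q+r h)

        -- Otherwise q + r ≤ 2r, so that L 0 ≤ (2r)^n ≤ 2r, and r X ≤ 1 would give L 0 X ≤ 2.
        0<q-r : 0ℚ < q - r
        0<q-r = ≰⇒> λ q-r≤0 → <-irrefl refl (<-≤-trans 2<L*x (begin
          L 0 * X           ≤⟨ *-monoˡ-≤ (<⇒≤ 0<X) (L≤[q+r]^n 0) ⟩
          (q + r) ^ n * X   ≤⟨ *-monoˡ-≤ (<⇒≤ 0<X) (^-mono-≤ 0≤q+r (q+r≤ q-r≤0) n) ⟩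
          (r + r) ^ n * X   ≤⟨ *-monoˡ-≤ (<⇒≤ 0<X) (p^≤p (0≤+ 0≤r 0≤r) r+r≤1 n) ⟩
          (r + r) * X       ≡⟨ *-distribʳ-+ X r r ⟩
          r * X + r * X     ≤⟨ +-mono-≤ r*X≤1 r*X≤1 ⟩
          1ℚ + 1ℚ           ∎))
          where
          q+r≤ : q - r ≤ 0ℚ → q + r ≤ r + r
          q+r≤ h = begin
            q + r             ≡⟨ solve 2 (λ q r → q :+ r := q :- r :+ (r :+ r)) refl q r ⟩
            q - r + (r + r)   ≤⟨ +-monoˡ-≤ (r + r) h ⟩
            0ℚ + (r + r)      ≡⟨ +-identityˡ (r + r) ⟩
            r + r             ∎

        q-r≤q : q - r ≤ q
        q-r≤q = <⇒≤ (p-q<p q 0<r)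

        q≤q+r : q ≤ q + r
        q≤q+r = p≤p+q q 0≤r

        0<q : 0ℚ < q
        0<q = <-≤-trans 0<q-r q-r≤q

        [q-r]^n≤U : ∀ k → (q - r) ^ n ≤ U k
        [q-r]^n≤U k = ≮⇒≥ λ h → q-r-notupper (above (enclosed k) 0<q-r h)

        q+r≤H : q + r ≤ H
        q+r≤H = begin
          q + r             ≡⟨ solve 2 (λ q r → q :+ r := q :- r :+ (r :+ r)) refl q r ⟩
          q - r + (r + r)   ≤⟨ +-mono-≤ q-r≤ r+r≤1 ⟩
          K ^ m + 1ℚ        ≤⟨ p≤p+q (K ^ m + 1ℚ) (<⇒≤ 0<1) ⟩
          H                 ∎
          where
          q-r≤ : q - r ≤ K ^ m
          q-r≤ = ^-cancel-≤ n 0≤K^m (≤-trans ([q-r]^n≤U 0)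
            (≤-trans (^-mono-≤ (<⇒≤ (0<u 0)) (u≤K 0) m) (p≤p^ 1≤K^m n)))

        spread : (q + r) ^ n - (q - r) ^ n ≤ (r + r) * E
        spread = begin
          (q + r) ^ n - (q - r) ^ n    ≤⟨ ^-lipschitz (<⇒≤ 0<q-r) (≤-trans q-r≤q q≤q+r) q+r≤H 1≤H n ⟩
          (q + r - (q - r)) * E
            ≡⟨ cong (_* E) (solve 2 (λ q r → q :+ r :- (q :- r) := r :+ r) refl q r) ⟩
          (r + r) * E                  ∎

        -- The intervals from (q - r)^n to (q + r)^n and from L k to U k overlap, so a point of one
        -- and a point of the other differ by at most the sum of the two lengths.
        error : ℕ → ℚ
        error k = (r + r) * E + δ k

        q^n-W≤ : ∀ k → q ^ n - W k ≤ error k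
        q^n-W≤ k = begin
          q ^ n - W k
            ≤⟨ +-mono-≤ (^-mono-≤ (<⇒≤ 0<q) q≤q+r n) (neg-antimono-≤ (L≤W k)) ⟩
          (q + r) ^ n - L k
            ≡⟨ solve 3 (λ a b l → a :- l := a :- b :+ (b :- l)) refl ((q + r) ^ n) ((q - r) ^ n) (L k) ⟩
          (q + r) ^ n - (q - r) ^ n + ((q - r) ^ n - L k)
            ≤⟨ +-mono-≤ spread (+-monoˡ-≤ (- L k) ([q-r]^n≤U k)) ⟩
          error k ∎

        W-q^n≤ : ∀ k → W k - q ^ n ≤ error k
        W-q^n≤ k = begin
          W k - q ^ n
            ≤⟨ +-mono-≤ (W≤U k) (neg-antimono-≤ (^-mono-≤ (<⇒≤ 0<q-r) q-r≤q n)) ⟩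
          U k - (q - r) ^ n
            ≡⟨ solve 3 (λ a b u → u :- b := a :- b :+ (u :- a)) refl ((q + r) ^ n) ((q - r) ^ n) (U k) ⟩
          (q + r) ^ n - (q - r) ^ n + (U k - (q + r) ^ n)
            ≤⟨ +-mono-≤ spread (+-monoʳ-≤ (U k) (neg-antimono-≤ (L≤[q+r]^n k))) ⟩
          error k ∎

        -- At index k = 2m + j the exponent is 3 + k - m: what the growth exponent leaves after
        -- `D k` has used up m. The factor G (G + G) in Y is the one that `δ-small` asks for with c
        -- = X^n G.
        Resolved : ℕ → Set
        Resolved j = Y ≤ Q (2 ℕ.* m ℕ.+ j) ^ (3 ℕ.+ m ℕ.+ j)

        1<G*[G+G] : 1ℚ < G * (G + G)
        1<G*[G+G] = begin-strict
          1ℚ             <⟨ p<p+q 1ℚ 0<1 ⟩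
          1ℚ + 1ℚ        ≤⟨ +-mono-≤ 1≤G 1≤G ⟩
          G + G          ≡⟨ *-identityˡ (G + G) ⟨
          1ℚ * (G + G)   ≤⟨ *-monoˡ-≤ (0≤+ (<⇒≤ 0<G) (<⇒≤ 0<G)) 1≤G ⟩
          G * (G + G)    ∎

        X<Y : X < Y
        X<Y = begin-strict
          X            ≤⟨ p≤p^ 1≤X n ⟩
          X ^ n        ≡⟨ *-identityʳ (X ^ n) ⟨
          X ^ n * 1ℚ   <⟨ *-monoʳ-< (0<^ 0<X n) 1<G*[G+G] ⟩
          Y            ∎

        ¬Resolved0 : ¬ Resolved 0
        ¬Resolved0 h = <-irrefl refl (<-≤-trans X<Y (≤-trans h
          (subst (_≤ X) (cong₂ (λ i j → Q i ^ j)
            (sym (ℕ.+-identityʳ (2 ℕ.* m))) (sym (ℕ.+-identityʳ (3 ℕ.+ m)))) Q≤x)))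

        resolved : ∃ Resolved
        resolved = let j , exceeds = Q-exceeds Y in j , exceeds (ℕ.m≤n+m j (3 ℕ.+ m)) (2 ℕ.* m ℕ.+ j)

        onset : ∃ λ j → ¬ Resolved j × Resolved (suc j)
        onset = transition (λ j → Y ≤? Q (2 ℕ.* m ℕ.+ j) ^ (3 ℕ.+ m ℕ.+ j)) ¬Resolved0 (proj₂ resolved)

        j₀ : ℕ
        j₀ = proj₁ onset

        ¬resolved-j₀ : ¬ Resolved j₀
        ¬resolved-j₀ = proj₁ (proj₂ onset)

        resolved-1+j₀ : Resolved (suc j₀)
        resolved-1+j₀ = proj₂ (proj₂ onset)

        k : ℕ
        k = suc (2 ℕ.* m ℕ.+ j₀)

        -- At the preceding index the test fails, so the power of `Q` with exponent 3 + m + j₀ is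
        -- below Y. The growth exponent there, 3 + 2m + j₀, is at most twice as large; starting the
        -- search at 2m ensures this.
        Q≤Y² : Q k ≤ Y ^ 2
        Q≤Y² = begin
          Q k                               ≡⟨ growth k₀ ⟩
          Q k₀ ^ (3 ℕ.+ k₀)                 ≤⟨ ^-monoʳ-≤ (1≤Q k₀) exponent ⟩
          Q k₀ ^ ((3 ℕ.+ m ℕ.+ j₀) ℕ.* 2)   ≡⟨ ^-assocʳ (Q k₀) (3 ℕ.+ m ℕ.+ j₀) 2 ⟨
          (Q k₀ ^ (3 ℕ.+ m ℕ.+ j₀)) ^ 2
            ≤⟨ ^-mono-≤ (0≤^ (<⇒≤ (0<Q k₀)) (3 ℕ.+ m ℕ.+ j₀)) (<⇒≤ (≰⇒> ¬resolved-j₀)) 2 ⟩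
          Y ^ 2                                          ∎
          where
          k₀ = 2 ℕ.* m ℕ.+ j₀
          exponent : 3 ℕ.+ k₀ ℕ.≤ (3 ℕ.+ m ℕ.+ j₀) ℕ.* 2
          exponent = subst (3 ℕ.+ k₀ ℕ.≤_) (rearrange m j₀) (ℕ.m≤m+n (3 ℕ.+ k₀) (3 ℕ.+ j₀))
            where
            rearrange : ∀ m j → 3 ℕ.+ (2 ℕ.* m ℕ.+ j) ℕ.+ (3 ℕ.+ j) ≡ (3 ℕ.+ m ℕ.+ j) ℕ.* 2
            rearrange = solve-∀

        M : ℚ
        M = X ^ n * (G * Q k ^ m)

        0<M : 0ℚ < M
        0<M = 0<* (0<^ 0<X n) (0<* 0<G (0<^ (0<Q k) m))

        δM : δ k * M + δ k * M ≤ 1ℚ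
        δM = δ-small m (suc (m ℕ.+ j₀)) (X ^ n * G) k k≡ (≤-reflexive
          (solve 3 (λ x g e → x :* (g :* e) := e :* (x :* g)) refl (X ^ n) G (Q k ^ m)))
          (subst₂ _≤_ (sym (*-assoc (X ^ n) G (G + G)))
            (cong₂ (λ i j → Q i ^ j) (ℕ.+-suc (2 ℕ.* m) j₀) (ℕ.+-suc (3 ℕ.+ m) j₀))
            resolved-1+j₀)
          (<⇒≤ 0<M)
          where
          k≡ : k ≡ m ℕ.+ suc (m ℕ.+ j₀)
          k≡ = trans (cong suc (trans (cong (λ i → m ℕ.+ i ℕ.+ j₀) {m ℕ.+ 0} (ℕ.+-identityʳ m)) (ℕ.+-assoc m m j₀)))
            (sym (ℕ.+-suc m (m ℕ.+ j₀)))

        -- the exponent N is chosen such that r Xⁿ Y^2m X is constant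
        rM : (r + r) * E * M + (r + r) * E * M < 1ℚ
        rM = begin-strict
          (r + r) * E * M + (r + r) * E * M
            ≡⟨ solve 5 (λ r e x g q → (r :+ r) :* e :* (x :* (g :* q)) :+ (r :+ r) :* e :* (x :* (g :* q))
                 := r :* x :* ((e :+ e :+ (e :+ e)) :* g) :* q) refl r E (X ^ n) G (Q k ^ m) ⟩
          r * X ^ n * (E₄ * G) * Q k ^ m
            ≤⟨ *-monoʳ-≤ (0≤* (0≤* 0≤r (0≤^ (<⇒≤ 0<X) n)) (0≤* 0≤E₄ (<⇒≤ 0<G))) (^-mono-≤ (<⇒≤ (0<Q k)) Q≤Y² m) ⟩
          r * X ^ n * (E₄ * G) * (Y ^ 2) ^ m
            ≡⟨ cong (r * X ^ n * (E₄ * G) *_) Y^2m ⟩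
          r * X ^ n * (E₄ * G) * (X ^ (n ℕ.* (2 ℕ.* m)) * (G * (G + G)) ^ (2 ℕ.* m))
            ≡⟨ solve 5 (λ r x e y g → r :* x :* e :* (y :* g) := r :* (x :* y) :* (e :* g))
                 refl r (X ^ n) (E₄ * G) (X ^ (n ℕ.* (2 ℕ.* m))) ((G * (G + G)) ^ (2 ℕ.* m)) ⟩
          r * (X ^ n * X ^ (n ℕ.* (2 ℕ.* m))) * Z
            <⟨ *-monoʳ-< (0<* 0<r (0<* (0<^ 0<X n) (0<^ 0<X (n ℕ.* (2 ℕ.* m))))) Z<x ⟩
          r * (X ^ n * X ^ (n ℕ.* (2 ℕ.* m))) * X
            ≡⟨ cong (λ y → r * y * X) (^-homo-* X n (n ℕ.* (2 ℕ.* m))) ⟨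
          r * X ^ (n ℕ.+ n ℕ.* (2 ℕ.* m)) * X
            ≡⟨ solve 3 (λ r y x → r :* y :* x := r :* (x :* y)) refl r (X ^ (n ℕ.+ n ℕ.* (2 ℕ.* m))) X ⟩
          r * X ^ N
            ≡⟨ rx^N≡1 ⟩
          1ℚ ∎
          where
          E₄ = E + E + (E + E)
          0≤E₄ : 0ℚ ≤ E₄
          0≤E₄ = 0≤+ (0≤+ 0≤E 0≤E) (0≤+ 0≤E 0≤E)
          Y^2m : (Y ^ 2) ^ m ≡ X ^ (n ℕ.* (2 ℕ.* m)) * (G * (G + G)) ^ (2 ℕ.* m)
          Y^2m = trans (^-assocʳ Y 2 m) (trans (^-distrib-* (X ^ n) (G * (G + G)) (2 ℕ.* m))
            (cong (_* (G * (G + G)) ^ (2 ℕ.* m)) (^-assocʳ X n (2 ℕ.* m))))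

        x : ℕ
        x = ↧ₙ q

        0<XD : 0ℚ < ι (x ℕ.^ n) * ι (D k)
        0<XD = 0<* (subst (0ℚ <_) (sym (ι-^ x n)) (0<^ 0<X n)) (0<ι (D k) {{D-nonZero k}})

        error*XD<1 : error k * (ι (x ℕ.^ n) * ι (D k)) < 1ℚ
        error*XD<1 = begin-strict
          error k * (ι (x ℕ.^ n) * ι (D k))   ≤⟨ *-monoʳ-≤ (0≤+ (0≤* (0≤+ 0≤r 0≤r) 0≤E) (0≤δ k)) XD≤M ⟩
          error k * M                         ≡⟨ *-distribʳ-+ M ((r + r) * E) (δ k) ⟩
          (r + r) * E * M + δ k * M           <⟨ two-halves ((r + r) * E * M) (δ k * M) rM δM ⟩
          1ℚ                                  ∎
          where
          XD≤M : ι (x ℕ.^ n) * ι (D k) ≤ M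
          XD≤M = subst (λ y → y * ι (D k) ≤ M) (sym (ι-^ x n)) (*-monoʳ-≤ (0≤^ (<⇒≤ 0<X) n) (D≤ k))
          two-halves : ∀ s t → s + s < 1ℚ → t + t ≤ 1ℚ → s + t < 1ℚ
          two-halves s t s<½ t≤½ = ≰⇒> λ 1≤s+t → <-irrefl refl (begin-strict
            1ℚ + 1ℚ           ≤⟨ +-mono-≤ {1ℚ} {s + t} {1ℚ} {s + t} 1≤s+t 1≤s+t ⟩
            s + t + (s + t)   ≡⟨ solve 2 (λ s t → s :+ t :+ (s :+ t) := s :+ s :+ (t :+ t)) refl s t ⟩
            s + s + (t + t)   <⟨ +-mono-<-≤ s<½ t≤½ ⟩
            1ℚ + 1ℚ           ∎)

        y : ℕ
        y = proj₁ (positive-numerator 0<q)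

        q*x : q * ι x ≡ ι y
        q*x = proj₂ (proj₂ (positive-numerator 0<q))

        q^n*x^n : q ^ n * ι (x ℕ.^ n) ≡ ι (y ℕ.^ n)
        q^n*x^n = trans (cong (q ^ n *_) (ι-^ x n)) (trans (sym (^-distrib-* q (ι x) n))
          (trans (cong (_^ n) q*x) (sym (ι-^ y n))))

        q^n≡W : q ^ n ≡ W k
        q^n≡W = close⇒≡ (x ℕ.^ n) (D k) q^n*x^n (W*D k) 0<XD (q^n-W≤ k) (W-q^n≤ k) error*XD<1

        n∣m : n ℕ.∣ m
        n∣m = generic k m n x y ℕ.z<s (proj₁ (proj₂ (positive-numerator 0<q))) (ι-injective (begin-equality
          ι (y ℕ.^ n ℕ.* D k)             ≡⟨ ι-* (y ℕ.^ n) (D k) ⟩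
          ι (y ℕ.^ n) * ι (D k)           ≡⟨ cong (_* ι (D k)) q^n*x^n ⟨
          q ^ n * ι (x ℕ.^ n) * ι (D k)   ≡⟨ cong (λ z → z * ι (x ℕ.^ n) * ι (D k)) q^n≡W ⟩
          W k * ι (x ℕ.^ n) * ι (D k)
            ≡⟨ solve 3 (λ w x d → w :* x :* d := w :* d :* x) refl (W k) (ι (x ℕ.^ n)) (ι (D k)) ⟩
          W k * ι (D k) * ι (x ℕ.^ n)     ≡⟨ cong (_* ι (x ℕ.^ n)) (W*D k) ⟩
          ι (num k ℕ.^ m) * ι (x ℕ.^ n)   ≡⟨ ι-* (num k ℕ.^ m) (x ℕ.^ n) ⟨
          ι (num k ℕ.^ m ℕ.* x ℕ.^ n)     ∎))

      liouville⇒∣ : 𝓛 ξ → n ℕ.∣ m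
      liouville⇒∣ liouvilleξ =
        let c , 2<c*L = archimedean* (1ℚ + 1ℚ) (0<L 0)
            d , Q<d = ι-unbounded (Q (2 ℕ.* m) ^ (3 ℕ.+ m))
            e , Z<e = ι-unbounded Z
        in conclude c d e 2<c*L Q<d Z<e (approximation liouvilleξ N (2 ℕ.+ c ℕ.+ d ℕ.+ e))
        where
        ι-2 : ι 2 ≡ 1ℚ + 1ℚ
        ι-2 = trans (ι-suc 1) (cong (1ℚ +_) ι-1)
        conclude : ∀ c d e → 1ℚ + 1ℚ < fromℕ c * L 0 → Q (2 ℕ.* m) ^ (3 ℕ.+ m) < ι d → Z < ι e →
                   Approximation ξ N (2 ℕ.+ c ℕ.+ d ℕ.+ e) → n ℕ.∣ m
        conclude c d e 2<c*L Q<d Z<e a = n∣m a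
          (subst (_≤ ι (↧ₙ q)) ι-2 (≤x 2 (ℕ.≤-trans (ℕ.m≤m+n 2 c) 2+c≤)))
          (<-≤-trans (subst (1ℚ + 1ℚ <_) (trans (cong (_* L 0) (sym (ι≡fromℕ c))) (*-comm (ι c) (L 0))) 2<c*L)
            (*-monoʳ-≤ (<⇒≤ (0<L 0)) (≤x c (ℕ.≤-trans (ℕ.m≤n+m c 2) 2+c≤))))
          (≤-trans (<⇒≤ Q<d) (≤x d (ℕ.≤-trans (ℕ.m≤n+m d (2 ℕ.+ c)) 2+c+d≤)))
          (<-≤-trans Z<e (≤x e (ℕ.m≤n+m e (2 ℕ.+ c ℕ.+ d))))
          where
          open Approximation a
          2+c+d≤ : 2 ℕ.+ c ℕ.+ d ℕ.≤ 2 ℕ.+ c ℕ.+ d ℕ.+ e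
          2+c+d≤ = ℕ.m≤m+n (2 ℕ.+ c ℕ.+ d) e
          2+c≤ : 2 ℕ.+ c ℕ.≤ 2 ℕ.+ c ℕ.+ d ℕ.+ e
          2+c≤ = ℕ.≤-trans (ℕ.m≤m+n (2 ℕ.+ c) d) 2+c+d≤
          ≤x : ∀ i → i ℕ.≤ 2 ℕ.+ c ℕ.+ d ℕ.+ e → ι i ≤ ι (↧ₙ q)
          ≤x i i≤ = ι-mono-≤ (ℕ.≤-trans i≤ (ℕ.<⇒≤ x₀<x))

-- Construction of ζ and of the approximants of ζ and 1/ζ.

module RapidSequence where

  open TwoAdic using (Odd; odd-*; odd-^; odd-+; odd⇒0<; 2-adic-power)
  open RationalPowers
  open Enclosures
  open RapidApproximation
  open import Data.Rational
  open import Data.Rational.Properties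
  open ℚSolver.+-*-Solver using (solve; _:=_; _:+_; _:*_; _:-_; con)
  open ≤-Reasoning

  -- z k = 2 P k / Q k increases by 4 / Q (suc k) or by 8 / Q (suc k): the limit then lies
  -- below z k + 5 / Q (suc k) or above z k + 8 / Q (suc k), and choose tells which one to take.
  module Construction
    (P₀ Q₀ : ℕ) (odd-P₀ : Odd P₀) (odd-Q₀ : Odd Q₀) (10≤Q₀ : 10 ℕ.≤ Q₀)
    (A B : ℕ → Pred ℚ 0ℓ) (choose : ∀ n {q r} → 0ℚ < q → q < r → A n q ⊎ B n r) where

    Q : ℕ → ℕ
    Q zero    = Q₀
    Q (suc k) = Q k ℕ.^ (3 ℕ.+ k)

    odd-Q : ∀ k → Odd (Q k)
    odd-Q zero    = odd-Q₀
    odd-Q (suc k) = odd-^ (3 ℕ.+ k) (odd-Q k)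

    10≤Q : ∀ k → 10 ℕ.≤ Q k
    10≤Q zero    = 10≤Q₀
    10≤Q (suc k) = ℕ.≤-trans (10≤Q k) (ℕ.m≤m*n (Q k) (Q k ℕ.^ (2 ℕ.+ k)) {{ℕ.m^n≢0 (Q k) (2 ℕ.+ k) {{Q≢0}}}})
      where Q≢0 = ℕ.>-nonZero (odd⇒0< (odd-Q k))

    q : ℕ → ℚ
    q k = ι (Q k)

    ten≤q : ∀ k → ι 10 ≤ q k
    ten≤q k = ι-mono-≤ (10≤Q k)

    two≤q : ∀ k → 1ℚ + 1ℚ ≤ q k
    two≤q k = ≤-trans (≤-reflexive (sym (trans (ι-suc 1) (cong (1ℚ +_) ι-1))))
      (≤-trans (ι-mono-≤ {2} {10} (ℕ.s≤s (ℕ.s≤s ℕ.z≤n))) (ten≤q k))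

    0<q : ∀ k → 0ℚ < q k
    0<q k = <-≤-trans (0<ι 10) (ten≤q k)

    1≤q : ∀ k → 1ℚ ≤ q k
    1≤q k = ≤-trans (1≤ι 10) (ten≤q k)

    growth : ∀ k → q (suc k) ≡ q k ^ (3 ℕ.+ k)
    growth k = ι-^ (Q k) (3 ℕ.+ k)

    abstract
      β : ℕ → ℚ
      β k = proj₁ (inverse (0<q k))

      0<β : ∀ k → 0ℚ < β k
      0<β k = proj₁ (proj₂ (inverse (0<q k)))

      β*q : ∀ k → β k * q k ≡ 1ℚ
      β*q k = proj₂ (proj₂ (inverse (0<q k)))

    10β≤β : ∀ k → ι 10 * β (suc k) ≤ β k
    10β≤β k = *-cancelʳ-≤ (0<q (suc k)) (begin
      ι 10 * β (suc k) * q (suc k)     ≡⟨ *-assoc (ι 10) (β (suc k)) (q (suc k)) ⟩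
      ι 10 * (β (suc k) * q (suc k))   ≡⟨ cong (ι 10 *_) (β*q (suc k)) ⟩
      ι 10 * 1ℚ                        ≡⟨ *-identityʳ (ι 10) ⟩
      ι 10                             ≤⟨ ten≤q k ⟩
      q k                              ≤⟨ p≤p^ (1≤q k) (2 ℕ.+ k) ⟩
      q k ^ (2 ℕ.+ k)                  ≡⟨ *-identityˡ (q k ^ (2 ℕ.+ k)) ⟨
      1ℚ * q k ^ (2 ℕ.+ k)             ≡⟨ cong (_* q k ^ (2 ℕ.+ k)) (β*q k) ⟨
      β k * q k * q k ^ (2 ℕ.+ k)      ≡⟨ *-assoc (β k) (q k) (q k ^ (2 ℕ.+ k)) ⟩
      β k * q k ^ (3 ℕ.+ k)            ≡⟨ cong (β k *_) (growth k) ⟨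
      β k * q (suc k)                  ∎)

    record State (k : ℕ) : Set where
      field
        P        : ℕ
        odd-P    : Odd P
        z        : ℚ
        0<z      : 0ℚ < z
        fraction : z * q k ≡ ι (2 ℕ.* P)
    open State

    record Next (k : ℕ) (s : State k) : Set where
      field
        state  : State (suc k)
        rise   : z s < z state
        rise≤8 : z state ≤ z s + ι 8 * β (suc k)
        avoid  : ∃ λ p → 0ℚ < p × ((A k p × z state + β (suc k) ≤ p) ⊎ (B k p × p ≤ z state))

    -- Over the new denominator the numerator 2P turns into 2P Q^(k+2), to which 2d is added. P
    -- stays odd because d is even, so the smallest admissible rises are 4 and 8 units of
    -- `β (suc k)`.
    advance : ∀ k → State k → ∀ d → 2 ℕ.∣ d → State (suc k)
    advance k s d 2∣d = record
      { P        = P s ℕ.* Q k ℕ.^ (2 ℕ.+ k) ℕ.+ d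
      ; odd-P    = odd-+ (odd-* (odd-P s) (odd-^ (2 ℕ.+ k) (odd-Q k))) 2∣d
      ; z        = z s + ι (2 ℕ.* d) * β (suc k)
      ; 0<z      = <-≤-trans (0<z s) (p≤p+q (z s) (0≤* (0≤ι (2 ℕ.* d)) (<⇒≤ (0<β (suc k)))))
      ; fraction = begin-equality
          (z s + ι (2 ℕ.* d) * β (suc k)) * q (suc k)
            ≡⟨ solve 4 (λ z i b q → (z :+ i :* b) :* q := z :* q :+ i :* (b :* q))
                 refl (z s) (ι (2 ℕ.* d)) (β (suc k)) (q (suc k)) ⟩
          z s * q (suc k) + ι (2 ℕ.* d) * (β (suc k) * q (suc k))
            ≡⟨ cong₂ (λ a b → z s * a + ι (2 ℕ.* d) * b) (growth k) (β*q (suc k)) ⟩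
          z s * (q k * q k ^ (2 ℕ.+ k)) + ι (2 ℕ.* d) * 1ℚ
            ≡⟨ cong₂ _+_ (sym (*-assoc (z s) (q k) (q k ^ (2 ℕ.+ k)))) (*-identityʳ (ι (2 ℕ.* d))) ⟩
          z s * q k * q k ^ (2 ℕ.+ k) + ι (2 ℕ.* d)
            ≡⟨ cong₂ (λ a b → a * b + ι (2 ℕ.* d)) (fraction s) (sym (ι-^ (Q k) (2 ℕ.+ k))) ⟩
          ι (2 ℕ.* P s) * ι (Q k ℕ.^ (2 ℕ.+ k)) + ι (2 ℕ.* d)
            ≡⟨ cong (_+ ι (2 ℕ.* d)) (ι-* (2 ℕ.* P s) (Q k ℕ.^ (2 ℕ.+ k))) ⟨
          ι (2 ℕ.* P s ℕ.* Q k ℕ.^ (2 ℕ.+ k)) + ι (2 ℕ.* d)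
            ≡⟨ ι-+ (2 ℕ.* P s ℕ.* Q k ℕ.^ (2 ℕ.+ k)) (2 ℕ.* d) ⟨
          ι (2 ℕ.* P s ℕ.* Q k ℕ.^ (2 ℕ.+ k) ℕ.+ 2 ℕ.* d)
            ≡⟨ cong ι (trans (cong (ℕ._+ 2 ℕ.* d) (ℕ.*-assoc 2 (P s) (Q k ℕ.^ (2 ℕ.+ k))))
                 (sym (ℕ.*-distribˡ-+ 2 (P s ℕ.* Q k ℕ.^ (2 ℕ.+ k)) d))) ⟩
          ι (2 ℕ.* (P s ℕ.* Q k ℕ.^ (2 ℕ.+ k) ℕ.+ d)) ∎
      }

    next : ∀ k s → Next k s
    next k s = [ four , eight ]′ (choose k {p₅} {p₈} 0<p₅ p₅<p₈)
      where
      b = β (suc k)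
      p₅ = z s + ι 5 * b
      p₈ = z s + ι 8 * b
      0<p₅ : 0ℚ < p₅
      0<p₅ = <-≤-trans (0<z s) (p≤p+q (z s) (0≤* (0≤ι 5) (<⇒≤ (0<β (suc k)))))
      up : ∀ {i j} → i ℕ.≤ j → z s + ι i * b ≤ z s + ι j * b
      up i≤j = +-monoʳ-≤ (z s) (*-monoˡ-≤ (<⇒≤ (0<β (suc k))) (ι-mono-≤ i≤j))
      up< : ∀ {i j} → i ℕ.< j → z s + ι i * b < z s + ι j * b
      up< i<j = +-monoʳ-< (z s) (*-monoˡ-< (0<β (suc k)) (ι-mono-< i<j))
      p₅<p₈ : p₅ < p₈
      p₅<p₈ = up< {5} {8} (ℕ.m≤m+n 6 2)
      z< : ∀ i .{{_ : ℕ.NonZero i}} → z s < z s + ι i * b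
      z< i = p<p+q (z s) (0<* (0<ι i) (0<β (suc k)))
      four : A k p₅ → Next k s
      four a = record
        { state  = advance k s 2 (ℕ.divides 1 refl)
        ; rise   = z< 4
        ; rise≤8 = up {4} {8} (ℕ.m≤m+n 4 4)
        ; avoid  = p₅ , 0<p₅ , inj₁ (a , ≤-reflexive (trans
            (solve 3 (λ z i b → z :+ i :* b :+ b := z :+ (con 1ℚ :+ i) :* b) refl (z s) (ι 4) b)
            (cong (λ i → z s + i * b) (sym (ι-suc 4)))))
        }
      eight : B k p₈ → Next k s
      eight b′ = record
        { state  = advance k s 4 (ℕ.divides 2 refl)
        ; rise   = z< 8
        ; rise≤8 = ≤-refl
        ; avoid  = p₈ , <-trans 0<p₅ p₅<p₈ , inj₂ (b′ , ≤-refl)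
        }

    initial : State 0
    initial = record
      { P = P₀ ; odd-P = odd-P₀ ; z = ι (2 ℕ.* P₀) * β 0
      ; 0<z = 0<* (0<ι (2 ℕ.* P₀) {{ℕ.m*n≢0 2 P₀ {{_}} {{ℕ.>-nonZero (odd⇒0< odd-P₀)}}}}) (0<β 0)
      ; fraction = trans (*-assoc (ι (2 ℕ.* P₀)) (β 0) (q 0)) (trans (cong (ι (2 ℕ.* P₀) *_) (β*q 0)) (*-identityʳ _))
      }

    abstract
      states : ∀ k → State k
      states zero    = initial
      states (suc k) = Next.state (next k (states k))

      z₀ : z (states 0) ≡ ι (2 ℕ.* P₀) * β 0
      z₀ = refl

      z-rise : ∀ k → z (states k) < z (states (suc k))
      z-rise k = Next.rise (next k (states k))

      z-rise≤8 : ∀ k → z (states (suc k)) ≤ z (states k) + ι 8 * β (suc k)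
      z-rise≤8 k = Next.rise≤8 (next k (states k))

      z-avoid : ∀ k → ∃ λ p → 0ℚ < p × ((A k p × z (states (suc k)) + β (suc k) ≤ p) ⊎ (B k p × p ≤ z (states (suc k))))
      z-avoid k = Next.avoid (next k (states k))

    -- In units of `β (suc k)`, the next rise is at most 8 and the next enclosure at most 1 long,
    -- since 10 ≤ Q. As 8 + 1 < 10, the enclosures are nested.
    l u : ℕ → ℚ
    l k = z (states k)
    u k = l k + ι 10 * β (suc k)

    0<l : ∀ k → 0ℚ < l k
    0<l k = 0<z (states k)

    l<u : ∀ k → l k < u k
    l<u k = p<p+q (l k) (0<* (0<ι 10) (0<β (suc k)))

    0<u : ∀ k → 0ℚ < u k
    0<u k = <-trans (0<l k) (l<u k)

    u≤l+β : ∀ k → u k ≤ l k + β k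
    u≤l+β k = +-monoʳ-≤ (l k) (10β≤β k)

    u-fall : ∀ k → u (suc k) < u k
    u-fall k = begin-strict
      u (suc k)               ≤⟨ u≤l+β (suc k) ⟩
      l (suc k) + β (suc k)   ≤⟨ +-monoˡ-≤ (β (suc k)) (z-rise≤8 k) ⟩
      l k + ι 8 * β (suc k) + β (suc k)
        ≡⟨ solve 3 (λ z i b → z :+ i :* b :+ b := z :+ (con 1ℚ :+ i) :* b) refl (l k) (ι 8) (β (suc k)) ⟩
      l k + (1ℚ + ι 8) * β (suc k)             ≡⟨ cong (λ i → l k + i * β (suc k)) (ι-suc 8) ⟨
      l k + ι 9 * β (suc k)
        <⟨ +-monoʳ-< (l k) (*-monoˡ-< (0<β (suc k)) (ι-mono-< {9} {10} (ℕ.n<1+n 9))) ⟩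
      u k ∎

    l-mono : ∀ {j k} → j ℕ.≤′ k → l j ≤ l k
    l-mono (ℕ.≤′-reflexive refl) = ≤-refl
    l-mono (ℕ.≤′-step j≤k) = ≤-trans (l-mono j≤k) (<⇒≤ (z-rise _))

    u-anti : ∀ {j k} → j ℕ.≤′ k → u k ≤ u j
    u-anti (ℕ.≤′-reflexive refl) = ≤-refl
    u-anti (ℕ.≤′-step j≤k) = ≤-trans (<⇒≤ (u-fall _)) (u-anti j≤k)

    l<u′ : ∀ j k → l j < u k
    l<u′ j k = ≤-<-trans (l-mono (ℕ.≤⇒≤′ (ℕ.m≤m⊔n j k)))
      (<-≤-trans (l<u (j ℕ.⊔ k)) (u-anti (ℕ.≤⇒≤′ (ℕ.m≤n⊔m j k))))

    u≤u₀ : ∀ k → u k ≤ u 0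
    u≤u₀ k = u-anti (ℕ.≤⇒≤′ {0} {k} ℕ.z≤n)

    gap≡10 : ∀ k → (u k - l k) * q (suc k) ≡ ι 10
    gap≡10 k = begin-equality
      (l k + ι 10 * β (suc k) - l k) * q (suc k)
        ≡⟨ solve 4 (λ l i b q → (l :+ i :* b :- l) :* q := i :* (b :* q)) refl (l k) (ι 10) (β (suc k)) (q (suc k)) ⟩
      ι 10 * (β (suc k) * q (suc k))   ≡⟨ cong (ι 10 *_) (β*q (suc k)) ⟩
      ι 10 * 1ℚ                        ≡⟨ *-identityʳ (ι 10) ⟩
      ι 10                             ∎

    vanishing : ∀ {ε} → 0ℚ < ε → ∃ λ k → u k - l k < ε
    vanishing {ε} 0<ε = let n , 10<nε = archimedean* (ι 10) 0<ε in n , *-cancelʳ-< (0<q (suc n)) (begin-strict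
      (u n - l n) * q (suc n)   ≡⟨ gap≡10 n ⟩
      ι 10                      <⟨ 10<nε ⟩
      fromℕ n * ε               ≡⟨ cong (_* ε) (ι≡fromℕ n) ⟨
      ι n * ε
        ≤⟨ *-monoˡ-≤ (<⇒≤ 0<ε) (≤-trans (<⇒≤ (n<2^ (two≤q n) n)) (^-monoʳ-≤ (1≤q n) (ℕ.m≤n+m n 3))) ⟩
      q n ^ (3 ℕ.+ n) * ε   ≡⟨ cong (_* ε) (growth n) ⟨
      q (suc n) * ε         ≡⟨ *-comm (q (suc n)) ε ⟩
      ε * q (suc n)         ∎)

    ζ : ℝ
    ζ = record
      { lower           = λ p → ∃ λ k → p < l k
      ; upper           = λ p → ∃ λ k → u k < p
      ; lower-inhabited = 0ℚ , 0 , 0<l 0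
      ; upper-inhabited = u 0 + 1ℚ , 0 , p<p+q (u 0) 0<1
      ; lower-closed    = λ p<r (k , r<l) → k , <-trans p<r r<l
      ; upper-closed    = λ p<r (k , u<p) → k , <-trans u<p p<r
      ; lower-rounded   = λ (k , p<l) → let m , p<m , m<l = <-dense p<l in m , p<m , k , m<l
      ; upper-rounded   = λ (k , u<p) → let m , u<m , m<p = <-dense u<p in m , m<p , k , u<m
      ; disjoint        = λ ((j , p<l) , (k , u<p)) → <-asym (l<u′ j k) (<-trans u<p p<l)
      ; located         = locate
      }
      where
      locate : ∀ {p r} → p < r → (∃ λ k → p < l k) ⊎ (∃ λ k → u k < r)
      locate {p} {r} p<r = let k , gap<r-p = vanishing (0<q-p p<r) in
        [ (λ p<l → inj₁ (k , p<l)) , (λ l≤p → inj₂ (k , (begin-strict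
            u k               ≡⟨ solve 2 (λ u l → u := u :- l :+ l) refl (u k) (l k) ⟩
            u k - l k + l k   <⟨ +-mono-<-≤ gap<r-p l≤p ⟩
            r - p + p         ≡⟨ solve 2 (λ r p → r :- p :+ p := r) refl r p ⟩
            r                 ∎))) ]′ (p <⊎≥ l k)

    ζ>0 : Positiveℝ ζ
    ζ>0 = let p , 0<p , p<l = <-dense (0<l 0) in p , 0<p , 0 , p<l

    ζ-enclosed : ∀ k → Enclosed ζ 1 (l k) (u k)
    ζ-enclosed k = record
      { below = λ {A} _ h → k , subst (_< l k) (p^1≡p A) h
      ; above = λ {B} _ h → k , subst (u k <_) (p^1≡p B) h
      }

    -- The choice against the n-th real is made in the step from n to n + 1, so it is enclosure n +
    -- 1 that is separated from it.
    ζ-avoid : ∀ n → ∃₂ λ k p → 0ℚ < p × ((A n p × u k ≤ p) ⊎ (B n p × p ≤ l k))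
    ζ-avoid n with z-avoid n
    ... | p , 0<p , inj₁ (a , h) = suc n , p , 0<p , inj₁ (a , ≤-trans (u≤l+β (suc n)) h)
    ... | p , 0<p , inj₂ (b , h) = suc n , p , 0<p , inj₂ (b , h)

    l<l : ∀ {j k} → j ℕ.< k → l j < l k
    l<l {j} j<k = <-≤-trans (z-rise j) (l-mono (ℕ.≤⇒≤′ j<k))

    0<P : ∀ k → 0 ℕ.< 2 ℕ.* P (states k)
    0<P k = ℕ.*-mono-< {0} {2} ℕ.z<s (odd⇒0< (odd-P (states k)))

    approximants : Approximants
    approximants = record
      { Q = q ; l = l ; w = l ; u = u ; K = K
      ; num = λ k → 2 ℕ.* P (states k) ; den = Q
      ; 2≤Q = two≤q ; growth = growth
      ; 1≤K = 1≤K
      ; 0<l = 0<l ; l≤w = λ k → ≤-refl ; w≤u = λ k → <⇒≤ (l<u k)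
      ; u≤K = λ k → ≤-trans (u≤u₀ k) (p≤p+q (u 0) (0≤ι 10))
      ; gap = λ k → ≤-trans (≤-reflexive (gap≡10 k)) ten≤K
      ; 0<den = λ k → odd⇒0< (odd-Q k)
      ; den≤ = λ k → subst (_≤ K * q k) (*-identityˡ (q k)) (*-monoˡ-≤ (<⇒≤ (0<q k)) 1≤K)
      ; fraction = λ k → fraction (states k)
      ; distinct = λ j<k eq → <-irrefl eq (l<l j<k)
      ; generic = λ k m n x y 0<x 0<y → 2-adic-power m n (odd-P (states k)) (odd-Q k) 0<x 0<y
      }
      where
      K = u 0 + ι 10
      ten≤K : ι 10 ≤ K
      ten≤K = subst (ι 10 ≤_) (+-comm (ι 10) (u 0)) (p≤p+q (ι 10) (<⇒≤ (0<u 0)))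
      1≤K : 1ℚ ≤ K
      1≤K = ≤-trans (1≤ι 10) ten≤K

    abstract
      l⁻¹ u⁻¹ : ℕ → ℚ
      l⁻¹ k = proj₁ (inverse (0<l k))
      u⁻¹ k = proj₁ (inverse (0<u k))

      0<l⁻¹ : ∀ k → 0ℚ < l⁻¹ k
      0<l⁻¹ k = proj₁ (proj₂ (inverse (0<l k)))

      0<u⁻¹ : ∀ k → 0ℚ < u⁻¹ k
      0<u⁻¹ k = proj₁ (proj₂ (inverse (0<u k)))

      l⁻¹*l : ∀ k → l⁻¹ k * l k ≡ 1ℚ
      l⁻¹*l k = proj₂ (proj₂ (inverse (0<l k)))

      u⁻¹*u : ∀ k → u⁻¹ k * u k ≡ 1ℚ
      u⁻¹*u k = proj₂ (proj₂ (inverse (0<u k)))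

    u⁻¹<l⁻¹ : ∀ k → u⁻¹ k < l⁻¹ k
    u⁻¹<l⁻¹ k = inverse-antimono-< (0<l⁻¹ k) (0<u⁻¹ k)
      (trans (*-comm (l k) (l⁻¹ k)) (l⁻¹*l k)) (trans (*-comm (u k) (u⁻¹ k)) (u⁻¹*u k)) (l<u k)

    l⁻¹<l⁻¹ : ∀ {j k} → j ℕ.< k → l⁻¹ k < l⁻¹ j
    l⁻¹<l⁻¹ {j} {k} j<k = inverse-antimono-< (0<l⁻¹ j) (0<l⁻¹ k)
      (trans (*-comm (l j) (l⁻¹ j)) (l⁻¹*l j)) (trans (*-comm (l k) (l⁻¹ k)) (l⁻¹*l k)) (l<l j<k)

    l⁻¹≤l₀⁻¹ : ∀ k → l⁻¹ k ≤ l⁻¹ 0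
    l⁻¹≤l₀⁻¹ zero    = ≤-refl
    l⁻¹≤l₀⁻¹ (suc k) = <⇒≤ (l⁻¹<l⁻¹ {0} {suc k} ℕ.z<s)

    -- Numerator and denominator change places, so the single factor 2 now sits in the denominator;
    -- the argument on exponents of 2 applies with x and y exchanged.
    inverse-approximants : Approximants
    inverse-approximants = record
      { Q = q ; l = u⁻¹ ; w = l⁻¹ ; u = l⁻¹ ; K = K
      ; num = Q ; den = λ k → 2 ℕ.* P (states k)
      ; 2≤Q = two≤q ; growth = growth
      ; 1≤K = ≤-trans (p≤p+q 1ℚ (<⇒≤ 0<a)) (≤-trans (p≤p+q (1ℚ + a) 0≤c) (p≤p+q (1ℚ + a + c) 0≤u₀))
      ; 0<l = 0<u⁻¹ ; l≤w = λ k → <⇒≤ (u⁻¹<l⁻¹ k) ; w≤u = λ k → ≤-refl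
      ; u≤K = λ k → ≤-trans (l⁻¹≤l₀⁻¹ k) (≤-trans (subst (a ≤_) (+-comm a 1ℚ) (p≤p+q a (<⇒≤ 0<1)))
          (≤-trans (p≤p+q (1ℚ + a) 0≤c) (p≤p+q (1ℚ + a + c) 0≤u₀)))
      ; gap = gap
      ; 0<den = 0<P
      ; den≤ = λ k → ≤-trans (≤-reflexive (sym (fraction (states k)))) (*-monoˡ-≤ (<⇒≤ (0<q k))
          (≤-trans (<⇒≤ (l<u′ k 0)) (subst (u 0 ≤_) (+-comm (u 0) (1ℚ + a + c))
            (p≤p+q (u 0) (0≤+ (0≤+ (<⇒≤ 0<1) (<⇒≤ 0<a)) 0≤c)))))
      ; fraction = λ k → trans (cong (l⁻¹ k *_) (sym (fraction (states k))))
          (trans (sym (*-assoc (l⁻¹ k) (l k) (q k))) (trans (cong (_* q k) (l⁻¹*l k)) (*-identityˡ (q k))))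
      ; distinct = λ j<k eq → <-irrefl (sym eq) (l⁻¹<l⁻¹ j<k)
      ; generic = λ k m n x y 0<x 0<y eq → 2-adic-power m n (odd-P (states k)) (odd-Q k) 0<y 0<x
          (trans (ℕ.*-comm (x ℕ.^ n) (Q k ℕ.^ m)) (trans (sym eq) (ℕ.*-comm (y ℕ.^ n) _)))
      }
      where
      a = l⁻¹ 0
      c = ι 10 * (a * a)
      -- One summand for each bound: 1 for `1≤K`, a for the values 1/l, c for the gap 1/l - 1/u = (u
      -- - l)/(l u), and u 0 for 2P = l Q ≤ u 0 Q.
      K = 1ℚ + a + c + u 0
      0<a = 0<l⁻¹ 0
      0≤u₀ = <⇒≤ (0<u 0)
      0≤c : 0ℚ ≤ c
      0≤c = 0≤* (0≤ι 10) (<⇒≤ (0<* 0<a 0<a))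
      gap : ∀ k → (l⁻¹ k - u⁻¹ k) * q (suc k) ≤ K
      gap k = begin
        (l⁻¹ k - u⁻¹ k) * q (suc k)
          ≡⟨ cong₂ (λ x y → (x - y) * q (suc k)) (*-identityʳ (l⁻¹ k)) (*-identityʳ (u⁻¹ k)) ⟨
        (l⁻¹ k * 1ℚ - u⁻¹ k * 1ℚ) * q (suc k)
          ≡⟨ cong₂ (λ x y → (l⁻¹ k * x - u⁻¹ k * y) * q (suc k)) (u⁻¹*u k) (l⁻¹*l k) ⟨
        (l⁻¹ k * (u⁻¹ k * u k) - u⁻¹ k * (l⁻¹ k * l k)) * q (suc k)
          ≡⟨ solve 5 (λ l′ u′ l u q → (l′ :* (u′ :* u) :- u′ :* (l′ :* l)) :* q := (u :- l) :* q :* (l′ :* u′))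
               refl (l⁻¹ k) (u⁻¹ k) (l k) (u k) (q (suc k)) ⟩
        (u k - l k) * q (suc k) * (l⁻¹ k * u⁻¹ k)
          ≡⟨ cong (_* (l⁻¹ k * u⁻¹ k)) (gap≡10 k) ⟩
        ι 10 * (l⁻¹ k * u⁻¹ k)
          ≤⟨ *-monoʳ-≤ (0≤ι 10) (*-mono-≤ (<⇒≤ (0<l⁻¹ k)) (<⇒≤ 0<a) (l⁻¹≤l₀⁻¹ k)
            (≤-trans (<⇒≤ (u⁻¹<l⁻¹ k)) (l⁻¹≤l₀⁻¹ k))) ⟩
        c
          ≤⟨ subst (c ≤_) (+-comm c (1ℚ + a)) (p≤p+q c (0≤+ (<⇒≤ 0<1) (<⇒≤ 0<a))) ⟩
        1ℚ + a + c
          ≤⟨ p≤p+q (1ℚ + a + c) 0≤u₀ ⟩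
        K ∎

-- Rational powers of ζ and the two assertions.

module PowersOfLiouville where

  open TwoAdic using (Odd; odd-1; odd-+)
  open RationalPowers
  open Enclosures
  open RapidApproximation
  open RapidSequence
  open import Data.Nat.Tactic.RingSolver using (solve-∀)
  open import Data.Rational
  open import Data.Rational.Properties
  open ℚSolver.+-*-Solver using (solve; _:=_; _:+_; _:*_; _:-_)
  open ≤-Reasoning

  odd-2n+1 : ∀ n → Odd (2 ℕ.* n ℕ.+ 1)
  odd-2n+1 n = subst Odd (ℕ.+-comm 1 (2 ℕ.* n)) (odd-+ odd-1 (ℕ.m∣m*n n))

  -- With 4j ≤ c Q₀ < 4(j + 1), the number 2P₀ = 4j + 6 is twice an odd number and exceeds c Q₀. The
  -- extra 1 is room for the whole enclosure of ζ, at most 1/Q₀ long, so 4j + 7 has to stay below d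
  -- Q₀; hence the demand (d - c) Q₀ > 7.
  starting-point : ∀ {c d} → 0ℚ ≤ c → c < d → ∃₂ λ P₀ Q₀ → Odd P₀ × Odd Q₀ × 10 ℕ.≤ Q₀ ×
                   c * ι Q₀ < ι (2 ℕ.* P₀) × ι (2 ℕ.* P₀) + 1ℚ < d * ι Q₀
  starting-point {c} {d} 0≤c c<d =
    2 ℕ.* suc j ℕ.+ 1 , Q₀ , odd-2n+1 (suc j) , odd-2n+1 (5 ℕ.+ n) ,
    ℕ.≤-trans (ℕ.*-monoʳ-≤ 2 (ℕ.m≤m+n 5 n)) (ℕ.m≤m+n _ 1) ,
    <-≤-trans t<4[j+1] (ι-mono-≤ (subst (4 ℕ.* suc j ℕ.≤_) (double (suc j)) (ℕ.m≤m+n (4 ℕ.* suc j) 2))) ,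
    (begin-strict
      ι (2 ℕ.* (2 ℕ.* suc j ℕ.+ 1)) + 1ℚ   ≡⟨ cong (_+ 1ℚ) (cong ι (expand j)) ⟩
      ι (4 ℕ.* j ℕ.+ 6) + 1ℚ               ≡⟨ cong (ι (4 ℕ.* j ℕ.+ 6) +_) ι-1 ⟨
      ι (4 ℕ.* j ℕ.+ 6) + ι 1              ≡⟨ ι-+ (4 ℕ.* j ℕ.+ 6) 1 ⟨
      ι (4 ℕ.* j ℕ.+ 6 ℕ.+ 1)              ≡⟨ cong ι (ℕ.+-assoc (4 ℕ.* j) 6 1) ⟩
      ι (4 ℕ.* j ℕ.+ 7)                    ≡⟨ ι-+ (4 ℕ.* j) 7 ⟩
      ι (4 ℕ.* j) + ι 7                    ≤⟨ +-monoˡ-≤ (ι 7) (≮⇒≥ t≮4j) ⟩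
      t + ι 7                              <⟨ +-monoʳ-< t 7<[d-c]Q₀ ⟩
      t + ι Q₀ * (d - c)
        ≡⟨ solve 3 (λ c d q → c :* q :+ q :* (d :- c) := d :* q) refl c d (ι Q₀) ⟩
      d * ι Q₀                              ∎)
    where
    n Q₀ j : ℕ
    n = proj₁ (archimedean* (ι 7) (0<q-p c<d))
    Q₀ = 2 ℕ.* (5 ℕ.+ n) ℕ.+ 1
    n≤Q₀ : n ℕ.≤ Q₀
    n≤Q₀ = ℕ.≤-trans (ℕ.m≤n+m n 5) (ℕ.≤-trans (ℕ.m≤m+n (5 ℕ.+ n) _) (ℕ.m≤m+n (2 ℕ.* (5 ℕ.+ n)) 1))
    7<[d-c]Q₀ : ι 7 < ι Q₀ * (d - c)
    7<[d-c]Q₀ = <-≤-trans (proj₂ (archimedean* (ι 7) (0<q-p c<d)))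
      (*-monoˡ-≤ (<⇒≤ (0<q-p c<d)) (subst (_≤ ι Q₀) (ι≡fromℕ n) (ι-mono-≤ n≤Q₀)))
    t = c * ι Q₀
    crossing : ∃ λ j → ¬ t < ι (4 ℕ.* j) × t < ι (4 ℕ.* suc j)
    crossing = transition (λ j → t <? ι (4 ℕ.* j))
      (λ t<0 → <-irrefl refl (<-≤-trans t<0 (subst (_≤ t) (sym ι-0) (0≤* 0≤c (0≤ι Q₀)))))
      {proj₁ (ι-unbounded t)} (<-≤-trans (proj₂ (ι-unbounded t)) (ι-mono-≤ (ℕ.m≤m+n (proj₁ (ι-unbounded t)) _)))
    j = proj₁ crossing
    t≮4j = proj₁ (proj₂ crossing)
    t<4[j+1] = proj₂ (proj₂ crossing)
    double : ∀ i → 4 ℕ.* i ℕ.+ 2 ≡ 2 ℕ.* (2 ℕ.* i ℕ.+ 1)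
    double = solve-∀
    expand : ∀ i → 2 ℕ.* (2 ℕ.* suc i ℕ.+ 1) ≡ 4 ℕ.* i ℕ.+ 6
    expand = solve-∀

  f-sign : ∀ a b .{{_ : ℤ.NonZero b}} →
           (∀ z → f a b z ≡ pow ℤ.∣ a ∣ ℤ.∣ b ∣ z) ⊎ (∀ z → f a b z ≡ inv (pow ℤ.∣ a ∣ ℤ.∣ b ∣ z))
  f-sign (ℤ.+ _)      (ℤ.+ _)      = inj₁ λ z → refl
  f-sign (ℤ.+ _)      ℤ.-[1+ _ ]   = inj₂ λ z → refl
  f-sign ℤ.-[1+ _ ]   (ℤ.+ _)      = inj₂ λ z → refl
  f-sign ℤ.-[1+ _ ]   ℤ.-[1+ _ ]   = inj₁ λ z → refl

  ∈-image : ∀ (g : ℝ⁺ → ℝ⁺) z → 𝓛 (val z) → Image⁺ g 𝓛 (val (g z))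
  ∈-image g z z∈𝓛 = z , z∈𝓛 , (λ h → h) , (λ h → h)

  module PowersOf
    (ζ⁺ : ℝ⁺) (approximants inverse-approximants : Approximants)
    (l⁻¹*l : ∀ k → Approximants.u inverse-approximants k * Approximants.l approximants k ≡ 1ℚ)
    (u⁻¹*u : ∀ k → Approximants.l inverse-approximants k * Approximants.u approximants k ≡ 1ℚ)
    (ζ-enclosed : ∀ k → Enclosed (val ζ⁺) 1 (Approximants.l approximants k) (Approximants.u approximants k)) where

    open Approximants approximants using (l; u; 0<l; 0<u)
    open Approximants inverse-approximants using ()
      renaming (l to u⁻¹; u to l⁻¹; 0<l to 0<u⁻¹; 0<u to 0<l⁻¹)

    pow-enclosed : ∀ m n .{{_ : ℕ.NonZero m}} .{{_ : ℕ.NonZero n}} k →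
                   Enclosed (val (pow m n ζ⁺)) n (l k ^ m) (u k ^ m)
    pow-enclosed m n k = enclosed-pow ζ⁺ {l k} {u k} m n (<⇒≤ (0<l k)) (<⇒≤ (0<u k)) (ζ-enclosed k)

    inv-pow-enclosed : ∀ m n .{{_ : ℕ.NonZero m}} .{{_ : ℕ.NonZero n}} k →
                       Enclosed (val (inv (pow m n ζ⁺))) n (u⁻¹ k ^ m) (l⁻¹ k ^ m)
    inv-pow-enclosed m n k = enclosed-inv (pow m n ζ⁺) {l k ^ m} {u k ^ m} {l⁻¹ k ^ m} {u⁻¹ k ^ m} n
      (0<^ (0<l k) m) (0<^ (0<u k) m) (0<^ (0<l⁻¹ k) m)
      (^-inverse {l⁻¹ k} {l k} m (l⁻¹*l k)) (^-inverse {u⁻¹ k} {u k} m (u⁻¹*u k)) (pow-enclosed m n k)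

    ∣⇒pow-𝓛 : ∀ m n .{{_ : ℕ.NonZero m}} .{{_ : ℕ.NonZero n}} → n ℕ.∣ m → 𝓛 (val (pow m n ζ⁺))
    ∣⇒pow-𝓛 m n (ℕ.divides c refl) = Powers.liouville approximants c {{ℕ.m*n≢0⇒m≢0 c}} λ k →
      enclosed-root c n (<⇒≤ (0<l k)) (<⇒≤ (0<u k)) (pow-enclosed m n k)

    ∣⇒inv-pow-𝓛 : ∀ m n .{{_ : ℕ.NonZero m}} .{{_ : ℕ.NonZero n}} → n ℕ.∣ m → 𝓛 (val (inv (pow m n ζ⁺)))
    ∣⇒inv-pow-𝓛 m n (ℕ.divides c refl) = Powers.liouville inverse-approximants c {{ℕ.m*n≢0⇒m≢0 c}} λ k →
      enclosed-root c n (<⇒≤ (0<u⁻¹ k)) (<⇒≤ (0<l⁻¹ k)) (inv-pow-enclosed m n k)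

    ζ-𝓛 : 𝓛 (val ζ⁺)
    ζ-𝓛 = Powers.liouville approximants 1 λ k →
      subst₂ (Enclosed (val ζ⁺) 1) (sym (p^1≡p (l k))) (sym (p^1≡p (u k))) (ζ-enclosed k)

    f-𝓛 : ∀ a b .{{_ : ℤ.NonZero a}} .{{_ : ℤ.NonZero b}} → 𝓛 (val (f a b ζ⁺)) ⇔ b ℤ.∣ a
    f-𝓛 a b = [ positive-case , negative-case ]′ (f-sign a b)
      where
      positive-case : (∀ z → f a b z ≡ pow ℤ.∣ a ∣ ℤ.∣ b ∣ z) → 𝓛 (val (f a b ζ⁺)) ⇔ b ℤ.∣ a
      positive-case eq = subst (λ z → 𝓛 (val z) ⇔ b ℤ.∣ a) (sym (eq ζ⁺)) (mk⇔
        (λ h → ℤ.∣ᵤ⇒∣ (Powers.liouville⇒∣ approximants ℤ.∣ a ∣ ℤ.∣ b ∣ (pow-enclosed ℤ.∣ a ∣ ℤ.∣ b ∣) h))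
        (λ b∣a → ∣⇒pow-𝓛 ℤ.∣ a ∣ ℤ.∣ b ∣ (ℤ.∣⇒∣ᵤ b∣a)))
      negative-case : (∀ z → f a b z ≡ inv (pow ℤ.∣ a ∣ ℤ.∣ b ∣ z)) → 𝓛 (val (f a b ζ⁺)) ⇔ b ℤ.∣ a
      negative-case eq = subst (λ z → 𝓛 (val z) ⇔ b ℤ.∣ a) (sym (eq ζ⁺)) (mk⇔
        (λ h → ℤ.∣ᵤ⇒∣ (Powers.liouville⇒∣ inverse-approximants ℤ.∣ a ∣ ℤ.∣ b ∣ (inv-pow-enclosed ℤ.∣ a ∣ ℤ.∣ b ∣) h))
        (λ b∣a → ∣⇒inv-pow-𝓛 ℤ.∣ a ∣ ℤ.∣ b ∣ (ℤ.∣⇒∣ᵤ b∣a)))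

    ^-^-swap : ∀ p m n → (p ^ n) ^ m ≡ p ^ (m ℕ.* n)
    ^-^-swap p m n = trans (^-assocʳ p n m) (cong (p ^_) (ℕ.*-comm n m))

    root-of-pow-enclosed : ∀ m n .{{_ : ℕ.NonZero m}} .{{_ : ℕ.NonZero n}} k →
                           Enclosed (val (pow m n (pow n 1 ζ⁺))) 1 (l k ^ m) (u k ^ m)
    root-of-pow-enclosed m n k = enclosed-root m n (<⇒≤ (0<l k)) (<⇒≤ (0<u k))
      (subst₂ (Enclosed _ n) (^-^-swap (l k) m n) (^-^-swap (u k) m n)
        (enclosed-pow (pow n 1 ζ⁺) m n (0≤^ (<⇒≤ (0<l k)) n) (0≤^ (<⇒≤ (0<u k)) n) (pow-enclosed n 1 k)))

    root-of-inv-enclosed : ∀ m n .{{_ : ℕ.NonZero m}} .{{_ : ℕ.NonZero n}} k →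
                           Enclosed (val (inv (pow m n (inv (pow n 1 ζ⁺))))) 1 (l k ^ m) (u k ^ m)
    root-of-inv-enclosed m n k = enclosed-root m n (<⇒≤ (0<l k)) (<⇒≤ (0<u k))
      (enclosed-inv (pow m n (inv (pow n 1 ζ⁺))) n
        (0<^ (0<^ (0<u⁻¹ k) n) m) (0<^ (0<^ (0<l⁻¹ k) n) m) (0<^ (0<u k) (m ℕ.* n))
        (inverse-power (trans (*-comm (u k) (u⁻¹ k)) (u⁻¹*u k)))
        (inverse-power (trans (*-comm (l k) (l⁻¹ k)) (l⁻¹*l k)))
        (enclosed-pow (inv (pow n 1 ζ⁺)) m n (0≤^ (<⇒≤ (0<u⁻¹ k)) n) (0≤^ (<⇒≤ (0<l⁻¹ k)) n)
          (inv-pow-enclosed n 1 k)))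
      where
      inverse-power : ∀ {p q} → p * q ≡ 1ℚ → p ^ (m ℕ.* n) * (q ^ n) ^ m ≡ 1ℚ
      inverse-power {p} {q} pq = trans (cong (p ^ (m ℕ.* n) *_) (^-^-swap q m n)) (^-inverse (m ℕ.* n) pq)

    -- The preimage is ζ^n or ζ^(-n), according to the sign of the exponent of g. Either way its
    -- image is ζ^m, with the same enclosures, so one way of avoiding a sequence serves both signs.
    image-member : ∀ (g : ℝ⁺ → ℝ⁺) m n .{{_ : ℕ.NonZero m}} .{{_ : ℕ.NonZero n}} →
                   (∀ z → g z ≡ pow m n z) ⊎ (∀ z → g z ≡ inv (pow m n z)) →
                   ∃ λ y → (Image⁺ g 𝓛 y × 𝓛 y) × ∀ k → Enclosed y 1 (l k ^ m) (u k ^ m)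
    image-member g m n = [ positive-case , negative-case ]′
      where
      Member : Set₁
      Member = ∃ λ y → (Image⁺ g 𝓛 y × 𝓛 y) × ∀ k → Enclosed y 1 (l k ^ m) (u k ^ m)
      member : ∀ z → 𝓛 (val z) → (∀ k → Enclosed (val (g z)) 1 (l k ^ m) (u k ^ m)) → Member
      member z z∈𝓛 e = val (g z) , (∈-image g z z∈𝓛 , Powers.liouville approximants m e) , e
      positive-case : (∀ z → g z ≡ pow m n z) → Member
      positive-case eq = member (pow n 1 ζ⁺) (∣⇒pow-𝓛 n 1 (ℕ.1∣ n)) λ k →
        subst (λ y → Enclosed (val y) 1 (l k ^ m) (u k ^ m)) (sym (eq (pow n 1 ζ⁺))) (root-of-pow-enclosed m n k)
      negative-case : (∀ z → g z ≡ inv (pow m n z)) → Member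
      negative-case eq = member (inv (pow n 1 ζ⁺)) (∣⇒inv-pow-𝓛 n 1 (ℕ.1∣ n)) λ k →
        subst (λ y → Enclosed (val y) 1 (l k ^ m) (u k ^ m)) (sym (eq (inv (pow n 1 ζ⁺)))) (root-of-inv-enclosed m n k)

  integer-powers-liouville : ∀ {ℓ} (I : Pred ℝ ℓ) → I ⊆ Positiveℝ → Satisfiable (Interior I) →
    Uncountable (λ ζ → 𝓛 ζ × I ζ × Σ[ ζ>0 ∈ Positiveℝ ζ ]
      (∀ (a b : ℤ) .{{_ : ℤ.NonZero a}} .{{_ : ℤ.NonZero b}} → 𝓛 (val (f a b (ζ , ζ>0))) ⇔ b ℤ.∣ a))
  integer-powers-liouville I I⊆Pos (x , c , d , c<x@(c₁ , c<c₁ , c₁<x) , x<d@(d₀ , x<d₀ , d₀<d) , I-between) s =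
    from-positive (I⊆Pos (I-between x c<x x<d))
    where
    Goal = ∃ λ ζ → (𝓛 ζ × I ζ × Σ[ ζ>0 ∈ Positiveℝ ζ ]
      (∀ (a b : ℤ) .{{_ : ℤ.NonZero a}} .{{_ : ℤ.NonZero b}} → 𝓛 (val (f a b (ζ , ζ>0))) ⇔ b ℤ.∣ a)) ×
      ∀ n → ¬ ζ ≈ s n
    within : ∀ c₀ → 0ℚ < c₀ → upper c c₀ → lower x c₀ → Goal
    within c₀ 0<c₀ c<c₀ c₀<x = conclude (starting-point (<⇒≤ 0<c₀) (lower<upper x c₀<x x<d₀))
      where
      conclude : (∃₂ λ P₀ Q₀ → Odd P₀ × Odd Q₀ × 10 ℕ.≤ Q₀ ×
                   c₀ * ι Q₀ < ι (2 ℕ.* P₀) × ι (2 ℕ.* P₀) + 1ℚ < d₀ * ι Q₀) → Goal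
      conclude (P₀ , Q₀ , odd-P₀ , odd-Q₀ , 10≤Q₀ , c₀<P₀/Q₀ , P₀/Q₀<d₀) =
        ζ , (ζ-𝓛 , I-between ζ (c₀ , c<c₀ , 0 , c₀<l₀) (d₀ , (0 , u₀<d₀) , d₀<d) , ζ>0 , f-𝓛) , avoids
        where
        open Construction P₀ Q₀ odd-P₀ odd-Q₀ 10≤Q₀
          (λ n → lower (s n)) (λ n → upper (s n)) (λ n _ → located (s n))
        open PowersOf (ζ , ζ>0) approximants inverse-approximants l⁻¹*l u⁻¹*u ζ-enclosed
        l₀*Q₀ : l 0 * ι Q₀ ≡ ι (2 ℕ.* P₀)
        l₀*Q₀ = trans (cong (_* ι Q₀) z₀) (trans (*-assoc (ι (2 ℕ.* P₀)) (β 0) (ι Q₀))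
          (trans (cong (ι (2 ℕ.* P₀) *_) (β*q 0)) (*-identityʳ (ι (2 ℕ.* P₀)))))
        c₀<l₀ : c₀ < l 0
        c₀<l₀ = *-cancelʳ-< (0<q 0) (subst (c₀ * ι Q₀ <_) (sym l₀*Q₀) c₀<P₀/Q₀)
        u₀<d₀ : u 0 < d₀
        u₀<d₀ = *-cancelʳ-< (0<q 0) (begin-strict
          u 0 * ι Q₀                ≤⟨ *-monoˡ-≤ (0≤ι Q₀) (u≤l+β 0) ⟩
          (l 0 + β 0) * ι Q₀        ≡⟨ *-distribʳ-+ (ι Q₀) (l 0) (β 0) ⟩
          l 0 * ι Q₀ + β 0 * ι Q₀   ≡⟨ cong₂ _+_ l₀*Q₀ (β*q 0) ⟩
          ι (2 ℕ.* P₀) + 1ℚ         <⟨ P₀/Q₀<d₀ ⟩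
          d₀ * ι Q₀                 ∎)
        avoids : ∀ n → ¬ ζ ≈ s n
        avoids n = let k , p , _ , separated = ζ-avoid n in
          enclosed⇒≉ {s = s n} (ζ-enclosed k) (0<l k) (0<u k) separated
    -- The left end c of the interval may be negative. The larger of c₁ and a positive rational
    -- below x is a positive left end.
    from-positive : Positiveℝ x → Goal
    from-positive (s₀ , 0<s₀ , s₀<x) =
      [ (λ c₁<s₀ → within s₀ 0<s₀ (upper-closed c c₁<s₀ c<c₁) s₀<x)
      , (λ s₀≤c₁ → within c₁ (<-≤-trans 0<s₀ s₀≤c₁) c<c₁ c₁<x)
      ]′ (c₁ <⊎≥ s₀)

  image-uncountable : ∀ (g : ℝ⁺ → ℝ⁺) m n .{{_ : ℕ.NonZero m}} .{{_ : ℕ.NonZero n}} →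
                      (∀ z → g z ≡ pow m n z) ⊎ (∀ z → g z ≡ inv (pow m n z)) →
                      Uncountable (Image⁺ g 𝓛 ∩ 𝓛)
  image-uncountable g m n g-sign s = conclude (starting-point ≤-refl 0<1)
    where
    conclude : (∃₂ λ P₀ Q₀ → Odd P₀ × Odd Q₀ × 10 ℕ.≤ Q₀ ×
                 0ℚ * ι Q₀ < ι (2 ℕ.* P₀) × ι (2 ℕ.* P₀) + 1ℚ < 1ℚ * ι Q₀) →
               ∃ λ y → (Image⁺ g 𝓛 y × 𝓛 y) × ∀ n → ¬ y ≈ s n
    conclude (P₀ , Q₀ , odd-P₀ , odd-Q₀ , 10≤Q₀ , _) = y , y∈ , avoids
      where
      open Construction P₀ Q₀ odd-P₀ odd-Q₀ 10≤Q₀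
        -- Since ζ^m is to differ from s n, the test points for ζ are compared with s n through
        -- their m-th powers.
        (λ n p → lower (s n) (p ^ m)) (λ n p → upper (s n) (p ^ m))
        (λ n 0<q q<r → located (s n) (^-mono-< (<⇒≤ 0<q) q<r m))
      open PowersOf (ζ , ζ>0) approximants inverse-approximants l⁻¹*l u⁻¹*u ζ-enclosed
      member = image-member g m n g-sign
      y = proj₁ member
      y∈ = proj₁ (proj₂ member)
      y-enclosed = proj₂ (proj₂ member)
      avoids : ∀ n → ¬ y ≈ s n
      avoids n = let k , p , 0<p , separated = ζ-avoid n in
        enclosed⇒≉ {s = s n} (y-enclosed k) (0<^ (0<l k) m) (0<^ (0<u k) m)
          ([ (λ (p<s , u≤p) → inj₁ (p<s , ^-mono-≤ (<⇒≤ (0<u k)) u≤p m))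
           , (λ (s<p , p≤l) → inj₂ (s<p , ^-mono-≤ (<⇒≤ 0<p) p≤l m)) ]′ separated)

  -- A single ζ is enough, so the sequence to be avoided is a dummy constant. If the image of ζ were
  -- in `𝓛`, then b would divide a, and coprimality would force b to be 1 or -1.
  image⊈𝓛 : ∀ (a b : ℤ) .{{_ : ℤ.NonZero a}} .{{_ : ℤ.NonZero b}} → ℤ.Coprime a b → 2 ℕ.≤ ℤ.∣ b ∣ →
            Image⁺ (f a b) 𝓛 ⊈ 𝓛
  image⊈𝓛 a b coprime 2≤b image⊆𝓛 = contradict (integer-powers-liouville Positiveℝ (λ h → h)
    (fromℚ 1ℚ , fromℚ 0ℚ , fromℚ (1ℚ + 1ℚ) , between 0<1 , between (p<p+q 1ℚ 0<1) , λ y h _ → h) (λ _ → fromℚ 0ℚ))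
    where
    between : ∀ {p q} → p < q → fromℚ p <ℝ fromℚ q
    between p<q = let r , p<r , r<q = <-dense p<q in r , p<r , r<q
    contradict : (∃ λ ζ → (𝓛 ζ × Positiveℝ ζ × Σ[ ζ>0 ∈ Positiveℝ ζ ]
      (∀ (a b : ℤ) .{{_ : ℤ.NonZero a}} .{{_ : ℤ.NonZero b}} → 𝓛 (val (f a b (ζ , ζ>0))) ⇔ b ℤ.∣ a)) ×
      ∀ n → ¬ ζ ≈ fromℚ 0ℚ) → ⊥
    contradict (ζ , (ζ∈𝓛 , _ , ζ>0 , f-𝓛) , _) = ℕ.<⇒≢ 2≤b (sym (coprime (ℤ.∣⇒∣ᵤ b∣a , ℕ.∣-refl)))
      where
      b∣a : b ℤ.∣ a
      b∣a = Equivalence.to (f-𝓛 a b) (image⊆𝓛 {val (f a b (ζ , ζ>0))} (∈-image (f a b) (ζ , ζ>0) ζ∈𝓛))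

open PowersOfLiouville
open import Data.Integer using (ℤ; ∣_∣; NonZero)
open import Data.Integer.Coprimality using (Coprime)
open import Data.Integer.Divisibility.Signed using (_∣_)
open import Data.Nat using (_≤_)
open import Data.Product using (Σ-syntax; _×_; _,_)
open import Function using (_⇔_)
open import Relation.Unary using (Pred; _⊆_; _⊈_; _∩_; Satisfiable)

theorem6p2 : ∀ {ℓ} →
    (∀ (I : Pred ℝ ℓ) → I ⊆ Positiveℝ → Satisfiable (Interior I) →
    Uncountable (λ ζ → 𝓛 ζ × I ζ × Σ[ ζ>0 ∈ Positiveℝ ζ ]
    (∀ (a b : ℤ) .{{_ : NonZero a}} .{{_ : NonZero b}} →
    𝓛 (val (f a b (ζ , ζ>0))) ⇔ b ∣ a)))
    × (∀ (a b : ℤ) .{{_ : NonZero a}} .{{_ : NonZero b}} → Coprime a b → 2 ≤ ∣ b ∣ →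
    Uncountable (Image⁺ (f a b) 𝓛 ∩ 𝓛) × Image⁺ (f a b) 𝓛 ⊈ 𝓛)
theorem6p2 = integer-powers-liouville , λ a b coprime 2≤∣b∣ →
  image-uncountable (f a b) ∣ a ∣ ∣ b ∣ (f-sign a b) , image⊈𝓛 a b coprime 2≤∣b∣
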